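{- For every real $\varepsilon > 0$, every integer $k \geq 2$ and every linear $k$-hypertree $T$, there exist positive real numbers $C = C(\varepsilon, T)$ and $n_0 = n_0(\varepsilon, T)$ such that the following holds for all $n \geq n_0$. If $H$ is an $n$-vertex linear $k$-graph with $\delta(H) \geq \frac{n}{k} + C$, then $H$ contains a collection of vertex-disjoint copies of $T$ that covers at least $(1 - \varepsilon)n$ vertices of $H$.
   Context: A $k$-graph is a (simple, finite) hypergraph in which every edge has exactly $k$ vertices. A hypergraph is linear if every two distinct edges share at most one vertex. The degree of a vertex is the number of edges containing it, and $\delta(H)$ denotes the minimum degree of $H$. A copy of $T$ in $H$ is a (not necessarily induced) sub-hypergraph of $H$ isomorphic to $T$. Linear paths. For $\ell\ge 2$, a linear ($k$-)path of length $\ell$ is a $k$-graph with vertex set $\{x_1,\dots,x_{\ell+1}\}\cup\{y_{i,j}: 1\le i\le \ell,\ 1\le j\le k-2\}$ (all these vertices distinct) and edges $\{x_i,y_{i,1},\dots,y_{i,k-2},x_{i+1}\}$ for $1\le i\le \ell$. Its two ends are the sets $\{x_1,y_{1,1},\dots,y_{1,k-2}\}$ and $\{x_{\ell+1},y_{\ell,1},\dots,y_{\ell,k-2}\}$. A linear path of length one is a $k$-graph with $k$ vertices and one edge. A linear $u$--$v$ path is a linear path together with two distinct vertices $u,v$ such that, if the length is at least $2$, $u$ lies in one end and $v$ lies in the other end, and, if the length is one, $u,v$ are any two vertices of the edge. A linear $k$-hypertree is a $k$-graph $T$ such that for every pair $\{u,v\}$ of distinct vertices of $T$ there is a unique linear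 $u$--$v$ path in $T$ (as a sub-hypergraph). -}

module Defs where

open import Data.Fin using (Fin; zero; suc; inject₁; fromℕ)
open import Data.Fin.Subset using (Subset; _∈_; _⊆_; _∩_; ∣_∣; Empty; ⋃)
open import Data.Integer using (+_)
open import Data.List using (List; map; allFin)
open import Data.List.Extrema.Nat using (min)

open import Data.List.Relation.Unary.AllPairs using (AllPairs)
open import Data.Nat as ℕ using (ℕ; zero; suc; _⊔_; _∸_)
import Data.Nat.Properties as ℕ
open import Data.Product using (∃!; ∃-syntax; _×_; _,_; proj₁; proj₂)
open import Data.Rational as ℚ using (ℚ; 0ℚ; 1ℚ; ½)
import Data.Rational.Properties as ℚ
open import Data.Rational.Solver using (module +-*-Solver)
open import Data.Sum using (_⊎_)
open import Data.Vec using (lookup; tabulate)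
open import Function.Bundles using (_⇔_)
open import Function.Definitions using (Injective)
open import Relation.Binary.PropositionalEquality

-- Reals are Cauchy sequences of rationals carrying a modulus; equality of reals
-- is never used, only < and ≤.
record ℝ : Set where
  field
    seq    : ℕ → ℚ
    cauchy : ∀ (δ : ℚ) → 0ℚ ℚ.< δ →
             ∃[ N ] (∀ i j → N ℕ.≤ i → N ℕ.≤ j → ℚ.∣ seq i ℚ.- seq j ∣ ℚ.≤ δ)

open ℝ

infix  4 _<ℝ_ _≤ℝ_
infixl 6 _+ℝ_ _-ℝ_
infixl 7 _·_

_<ℝ_ : ℝ → ℝ → Set
x <ℝ y = ∃[ δ ] (0ℚ ℚ.< δ × ∃[ N ] (∀ i → N ℕ.≤ i → seq x i ℚ.+ δ ℚ.≤ seq y i))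

_≤ℝ_ : ℝ → ℝ → Set
x ≤ℝ y = ∀ (δ : ℚ) → 0ℚ ℚ.< δ → ∃[ N ] (∀ i → N ℕ.≤ i → seq x i ℚ.≤ seq y i ℚ.+ δ)

fromℚ : ℚ → ℝ
fromℚ q .seq _ = q
fromℚ q .cauchy δ 0<δ = 0 , λ _ _ _ _ →
  subst (ℚ._≤ δ) (cong ℚ.∣_∣ (sym (ℚ.+-inverseʳ q))) (ℚ.<⇒≤ 0<δ)

fromNat : ℕ → ℝ
fromNat n = fromℚ (+ n ℚ./ 1)

0ℝ 1ℝ : ℝ
0ℝ = fromℚ 0ℚ
1ℝ = fromℚ 1ℚ

private
  half-pos : ∀ δ → 0ℚ ℚ.< δ → 0ℚ ℚ.< δ ℚ.* ½
  half-pos δ 0<δ = ℚ.*-monoˡ-<-pos ½ 0<δ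

  half+half : ∀ δ → δ ℚ.* ½ ℚ.+ δ ℚ.* ½ ≡ δ
  half+half δ = trans (sym (ℚ.*-distribˡ-+ δ ½ ½)) (ℚ.*-identityʳ δ)

  +-diff : ∀ a b c d → (a ℚ.+ b) ℚ.- (c ℚ.+ d) ≡ (a ℚ.- c) ℚ.+ (b ℚ.- d)
  +-diff = solve 4 (λ a b c d → (a :+ b) :- (c :+ d) := (a :- c) :+ (b :- d)) refl
    where open +-*-Solver

  neg-diff : ∀ a b → (ℚ.- a) ℚ.- (ℚ.- b) ≡ ℚ.- (a ℚ.- b)
  neg-diff a b = sym (ℚ.neg-distrib-+ a (ℚ.- b))

_+ℝ_ : ℝ → ℝ → ℝ
(x +ℝ y) .seq i = seq x i ℚ.+ seq y i
(x +ℝ y) .cauchy δ 0<δ = M ⊔ N , λ i j p q →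
  subst₂ ℚ._≤_ (cong ℚ.∣_∣ (sym (+-diff (seq x i) (seq y i) (seq x j) (seq y j)))) (half+half δ)
    (ℚ.≤-trans (ℚ.∣p+q∣≤∣p∣+∣q∣ (seq x i ℚ.- seq x j) (seq y i ℚ.- seq y j))
      (ℚ.+-mono-≤
        (proj₂ cx i j (ℕ.≤-trans (ℕ.m≤m⊔n M N) p) (ℕ.≤-trans (ℕ.m≤m⊔n M N) q))
        (proj₂ cy i j (ℕ.≤-trans (ℕ.m≤n⊔m M N) p) (ℕ.≤-trans (ℕ.m≤n⊔m M N) q))))
  where
  cx = cauchy x (δ ℚ.* ½) (half-pos δ 0<δ)
  cy = cauchy y (δ ℚ.* ½) (half-pos δ 0<δ)
  M = proj₁ cx
  N = proj₁ cy

-ℝ_ : ℝ → ℝ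
(-ℝ x) .seq i = ℚ.- seq x i
(-ℝ x) .cauchy δ 0<δ = proj₁ cx , λ i j p q →
  subst (ℚ._≤ δ)
    (sym (trans (cong ℚ.∣_∣ (neg-diff (seq x i) (seq x j))) (ℚ.∣-p∣≡∣p∣ (seq x i ℚ.- seq x j))))
    (proj₂ cx i j p q)
  where cx = cauchy x δ 0<δ

_-ℝ_ : ℝ → ℝ → ℝ
x -ℝ y = x +ℝ (-ℝ y)

_·_ : ℕ → ℝ → ℝ
zero  · x = 0ℝ
suc n · x = x +ℝ n · x

-- The vertices are Fin n; edges are named by Fin size, and simplicity is
-- the injectivity of edge.
record KGraph (k n : ℕ) : Set where
  field
    size    : ℕ
    edge    : Fin size → Subset n
    simple  : Injective _≡_ _≡_ edge
    uniform : ∀ e → ∣ edge e ∣ ≡ k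

open KGraph

Linear : ∀ {k n} → KGraph k n → Set
Linear H = ∀ e f → e ≢ f → ∣ edge H e ∩ edge H f ∣ ℕ.≤ 1

degree : ∀ {k n} → KGraph k n → Fin n → ℕ
degree H v = ∣ tabulate (λ e → lookup (edge H e) v) ∣

-- A degree never exceeds size H, so for n ≥ 1 the default value size H does
-- not affect the minimum; for n = 0 the value is the default.
minDegree : ∀ {k n} → KGraph k n → ℕ
minDegree {n = n} H = min (size H) (map (degree H) (allFin n))

record SubHypergraph {k n} (H : KGraph k n) : Set where
  field
    vertices : Subset n
    edges    : Subset (size H)
    closed   : ∀ e → e ∈ edges → edge H e ⊆ vertices

open SubHypergraph

infix 4 _≈ₛ_
_≈ₛ_ : ∀ {k n} {H : KGraph k n} → SubHypergraph H → SubHypergraph H → Set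
S ≈ₛ S′ = vertices S ≡ vertices S′ × edges S ≡ edges S′

-- A hypergraph on an arbitrary vertex type, so that linear paths can be
-- given with their labelled vertices.
record Incidence : Set₁ where
  field
    Vertex : Set
    Edge   : Set
    _on_   : Vertex → Edge → Set

open Incidence

incidence : ∀ {k n} → KGraph k n → Incidence
incidence {n = n} H = record
  { Vertex = Fin n
  ; Edge   = Fin (size H)
  ; _on_   = λ v e → v ∈ edge H e
  }

-- Injectivity of onEdges need not be required: wherever distinct edges of G
-- have distinct vertex sets, it follows from incident and vertex-injective.
record _≅_ (G : Incidence) {k n} {H : KGraph k n} (S : SubHypergraph H) : Set where
  field
    onVertices       : Vertex G → Fin n
    vertex-injective : Injective _≡_ _≡_ onVertices
    vertex-image     : ∀ v → v ∈ vertices S ⇔ (∃[ a ] onVertices a ≡ v)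
    onEdges          : Edge G → Fin (size H)
    edge-image       : ∀ e → e ∈ edges S ⇔ (∃[ b ] onEdges b ≡ e)
    incident         : ∀ b v → v ∈ edge H (onEdges b) ⇔ (∃[ a ] (_on_ G a b × onVertices a ≡ v))

open _≅_

IsCopyOf : ∀ {k t n} → KGraph k t → {H : KGraph k n} → SubHypergraph H → Set
IsCopyOf T S = incidence T ≅ S

data PathVertex (k ℓ : ℕ) : Set where
  x : Fin (suc ℓ) → PathVertex k ℓ
  y : Fin ℓ → Fin (k ∸ 2) → PathVertex k ℓ

data PathOn {k ℓ : ℕ} : PathVertex k ℓ → Fin ℓ → Set where
  left  : ∀ i → PathOn (x (inject₁ i)) i
  inner : ∀ i j → PathOn (y i j) i
  right : ∀ i → PathOn (x (suc i)) i

-- For ℓ = 1 this is a single edge with its k vertices (k ≥ 2).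
linearPath : ℕ → ℕ → Incidence
linearPath k ℓ = record { Vertex = PathVertex k ℓ ; Edge = Fin ℓ ; _on_ = PathOn }

data FirstEnd {k ℓ} : PathVertex k (suc ℓ) → Set where
  x₁ : FirstEnd (x zero)
  y₁ : ∀ j → FirstEnd (y zero j)

data LastEnd {k ℓ} : PathVertex k (suc ℓ) → Set where
  x-last : LastEnd (x (fromℕ (suc ℓ)))
  y-last : ∀ j → LastEnd (y (fromℕ ℓ) j)

module _ {k n} {H : KGraph k n} where

  InFirstEnd InLastEnd : ∀ {ℓ} {S : SubHypergraph H} → linearPath k (suc ℓ) ≅ S → Fin n → Set
  InFirstEnd φ u = ∃[ a ] (FirstEnd a × onVertices φ a ≡ u)
  InLastEnd  φ u = ∃[ a ] (LastEnd a × onVertices φ a ≡ u)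

  data IsLinearPath (u v : Fin n) (S : SubHypergraph H) : Set where
    length-one : linearPath k 1 ≅ S → u ∈ vertices S → v ∈ vertices S → IsLinearPath u v S
    length-≥2  : ∀ {ℓ} (φ : linearPath k (suc (suc ℓ)) ≅ S) →
                 (InFirstEnd φ u × InLastEnd φ v) ⊎ (InLastEnd φ u × InFirstEnd φ v) →
                 IsLinearPath u v S

-- As usual, a hypertree has a nonempty vertex set; with no vertices the
-- path condition would hold vacuously.
record IsLinearHypertree {k t} (T : KGraph k t) : Set where
  field
    nonempty   : 1 ℕ.≤ t
    uniquePath : ∀ u v → u ≢ v → ∃! (_≈ₛ_ {H = T}) (IsLinearPath u v)

VertexDisjoint : ∀ {k n} {H : KGraph k n} → List (SubHypergraph H) → Set
VertexDisjoint = AllPairs (λ S S′ → Empty (vertices S ∩ vertices S′))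

covered : ∀ {k n} {H : KGraph k n} → List (SubHypergraph H) → ℕ
covered 𝒮 = ∣ ⋃ (map vertices 𝒮) ∣

{-# OPTIONS --safe #-}

-- Write c(v) for the number of copies of T through v in a family of copies.  Because H is linear and every
-- degree is at least n/k, averaging over the edges at a vertex of least (suitably perturbed) c shows that many
-- edges have total c at most k times the average.  Pigeonholing on the values of c along enumerated edges,
-- pruning, and embedding T greedily with a rainbow k-colouring, rotated so that the cheapest colour classes are
-- used, gives a copy whose vertices have average c at most the overall average (up to a constant) and which
-- shares at most one vertex with every earlier copy.  Adding such copies one at a time gives an almost disjoint
-- family in which nearly all vertices have nearly the same constant degree D: Σ (c - D)² ≤ 3nD.
--
-- Such a family has a nearly perfect matching.  Copies are removed greedily, together with everything they meet,
-- and the potential Φ = Σ (d(v) - a)² over the vertices v still uncovered, for a target degree a, is kept small: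
-- averaged over the choice of the next copy the first-order change of Φ is at most a multiple of Φ, provided a
-- decreases by t (t - 1) a / r when r vertices are left.

module Submission where

open import Data.Bool.Base using (true; false; if_then_else_)
open import Data.Empty using (⊥-elim)
open import Data.Fin using (Fin; zero; suc)
import Data.Fin.Properties as Fin
open import Data.Fin.Subset using (Subset; ∣_∣; _∩_; _⊆_) renaming (_∈_ to _∈ₛ_; _∉_ to _∉ₛ_)
open import Data.Fin.Subset.Properties using (_∈?_)
open import Data.List using (List; []; _∷_; allFin; filter; length)
open import Data.List.Membership.Propositional using (_∈_)
open import Data.List.Membership.Propositional.Properties using (∈-allFin; ∈-filter⁻)
open import Data.List.Relation.Unary.All as All using (All; []; _∷_)
open import Data.List.Relation.Unary.AllPairs using (AllPairs; []; _∷_)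
open import Data.List.Relation.Unary.Any using (here; there)
open import Data.List.Relation.Unary.Unique.Propositional using (Unique)
open import Data.Product using (_×_; _,_; proj₁; proj₂; ∃-syntax)
open import Data.Sum using (_⊎_; inj₁; inj₂)
open import Function using (_∘_)
open import Relation.Binary.PropositionalEquality
open import Relation.Nullary using (Dec; yes; no; does; ¬_)
open import Relation.Nullary.Decidable using (_×-dec_; ¬?)

-- At degree n/k the averaging at a vertex of least c is tight: it yields one edge whose total c is
-- at most k times the average plus k, whereas the greedy embedding needs linearly many. Hence c is
-- perturbed by the degree in these low edges themselves: if they were few, a vertex of least
-- perturbed value would still lie on linearly many of them, which makes that least value exceed the
-- average. The embedding does not control which edges it uses, so the cost of a vertex has to
-- depend only on its position in an edge; this is the purpose of the pigeonholing. The k colour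
-- classes of T may differ in size, and only the mean over all rotations is balanced. A cheap copy
-- raises the sum of c² by little more than an average one would, so at average degree D the
-- potential is O(nD), smaller than nD² by a factor D. It may therefore grow by a constant factor
-- during the whole removal process. The constants are fixed in the order ε, q, D, n: at most n/q
-- vertices stay uncovered, D depends on t and q only, and n is large for D.

-- Finite sums over ordered commutative semirings.

module OrderedSums where

  open import Algebra.Structures using (IsCommutativeSemiring)
  open import Data.List using (map)
  import Data.List.Properties as List
  open import Data.List.Relation.Unary.Unique.Propositional.Properties using (allFin⁺)
  open import Data.Nat using (ℕ; suc)
  open import Data.Vec using (lookup)
  open import Function using (id)
  open import Level using (0ℓ)
  open import Relation.Binary.Core using (Rel)
  open import Relation.Binary.Structures using (IsTotalOrder)
  open import Relation.Binary.Definitions using () renaming (Decidable to Decidable₂)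
  open import Relation.Unary using (Pred; Decidable)

  module Sums {A : Set} (_+_ _*_ : A → A → A) (0# 1# : A)
    (isCS : IsCommutativeSemiring _≡_ _+_ _*_ 0# 1#)
    (_≤_ : Rel A 0ℓ) (isTO : IsTotalOrder _≡_ _≤_) (_≤?_ : Decidable₂ _≤_)
    (+-mono-≤ : ∀ {a b c d} → a ≤ b → c ≤ d → (a + c) ≤ (b + d))
    -- This replaces subtraction, so that the averaging principle `∑-exists-≤` holds over ℕ as well
    -- as over ℚ.
    (+-cancel : ∀ {a b c d} → (a + c) ≤ (b + d) → ¬ (a ≤ b) → c ≤ d)
    (0≤1 : 0# ≤ 1#)
    where

    private
      module S = IsCommutativeSemiring isCS
      module O = IsTotalOrder isTO
      variable
        X Y : Set
        n : ℕ

    ∑ : List X → (X → A) → A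
    ∑ []       f = 0#
    ∑ (x ∷ xs) f = f x + ∑ xs f

    ∑-cong-∈ : ∀ (xs : List X) {f g} → (∀ {x} → x ∈ xs → f x ≡ g x) → ∑ xs f ≡ ∑ xs g
    ∑-cong-∈ []       h = refl
    ∑-cong-∈ (x ∷ xs) h = cong₂ _+_ (h (here refl)) (∑-cong-∈ xs (h ∘ there))

    ∑-cong : ∀ (xs : List X) {f g} → (∀ x → f x ≡ g x) → ∑ xs f ≡ ∑ xs g
    ∑-cong xs h = ∑-cong-∈ xs (λ {x} _ → h x)

    ∑-mono-∈ : ∀ (xs : List X) {f g} → (∀ {x} → x ∈ xs → f x ≤ g x) → ∑ xs f ≤ ∑ xs g
    ∑-mono-∈ []       h = O.refl
    ∑-mono-∈ (x ∷ xs) h = +-mono-≤ (h (here refl)) (∑-mono-∈ xs (h ∘ there))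

    ∑-mono : ∀ (xs : List X) {f g} → (∀ x → f x ≤ g x) → ∑ xs f ≤ ∑ xs g
    ∑-mono xs h = ∑-mono-∈ xs (λ {x} _ → h x)

    ∑-zero : ∀ (xs : List X) → ∑ xs (λ _ → 0#) ≡ 0#
    ∑-zero []       = refl
    ∑-zero (x ∷ xs) = trans (S.+-identityˡ _) (∑-zero xs)

    ∑-nonneg : ∀ (xs : List X) {f} → (∀ x → 0# ≤ f x) → 0# ≤ ∑ xs f
    ∑-nonneg xs h = O.trans (O.reflexive (sym (∑-zero xs))) (∑-mono xs h)

    interchange : ∀ a b c d → (a + b) + (c + d) ≡ (a + c) + (b + d)
    interchange a b c d = begin
      (a + b) + (c + d) ≡⟨ S.+-assoc a b _ ⟩
      a + (b + (c + d)) ≡⟨ cong (a +_) (S.+-assoc b c d) ⟨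
      a + ((b + c) + d) ≡⟨ cong (λ z → a + (z + d)) (S.+-comm b c) ⟩
      a + ((c + b) + d) ≡⟨ cong (a +_) (S.+-assoc c b d) ⟩
      a + (c + (b + d)) ≡⟨ S.+-assoc a c _ ⟨
      (a + c) + (b + d) ∎
      where open ≡-Reasoning

    ∑-+ : ∀ (xs : List X) f g → ∑ xs (λ x → f x + g x) ≡ ∑ xs f + ∑ xs g
    ∑-+ []       f g = sym (S.+-identityˡ _)
    ∑-+ (x ∷ xs) f g = trans (cong (_ +_) (∑-+ xs f g)) (interchange _ _ _ _)

    ∑-*ˡ : ∀ (xs : List X) c f → ∑ xs (λ x → c * f x) ≡ c * ∑ xs f
    ∑-*ˡ []       c f = sym (S.zeroʳ c)
    ∑-*ˡ (x ∷ xs) c f = trans (cong (_ +_) (∑-*ˡ xs c f)) (sym (S.distribˡ c _ _))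

    ∑-*ʳ : ∀ (xs : List X) c f → ∑ xs (λ x → f x * c) ≡ ∑ xs f * c
    ∑-*ʳ xs c f = trans (∑-cong xs (λ x → S.*-comm _ c)) (trans (∑-*ˡ xs c f) (S.*-comm c _))

    ∑-swap : ∀ (xs : List X) (ys : List Y) (f : X → Y → A) →
             ∑ xs (λ x → ∑ ys (f x)) ≡ ∑ ys (λ y → ∑ xs (λ x → f x y))
    ∑-swap []       ys f = sym (∑-zero ys)
    ∑-swap (x ∷ xs) ys f =
      trans (cong (_ +_) (∑-swap xs ys f)) (sym (∑-+ ys (f x) (λ y → ∑ xs (λ x → f x y))))

    ∑-term : ∀ (xs : List X) {f} → (∀ x → 0# ≤ f x) → ∀ {x} → x ∈ xs → f x ≤ ∑ xs f
    ∑-term (_ ∷ xs) h (here refl) =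
      O.trans (O.reflexive (sym (S.+-identityʳ _))) (+-mono-≤ O.refl (∑-nonneg xs h))
    ∑-term (_ ∷ xs) h (there p) =
      O.trans (O.reflexive (sym (S.+-identityˡ _))) (+-mono-≤ (h _) (∑-term xs h p))

    ∑-filter : ∀ {P : Pred X 0ℓ} (P? : Decidable P) xs f →
               ∑ (filter P? xs) f ≡ ∑ xs (λ x → if does (P? x) then f x else 0#)
    ∑-filter P? []       f = refl
    ∑-filter P? (x ∷ xs) f with does (P? x)
    ... | true  = cong (f x +_) (∑-filter P? xs f)
    ... | false = trans (∑-filter P? xs f) (sym (S.+-identityˡ _))

    ∑-filter-≤ : ∀ {P : Pred X 0ℓ} (P? : Decidable P) xs {f} → (∀ x → 0# ≤ f x) →
                 ∑ (filter P? xs) f ≤ ∑ xs f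
    ∑-filter-≤ P? xs {f} h = O.trans (O.reflexive (∑-filter P? xs f)) (∑-mono xs bound)
      where
      bound : ∀ x → (if does (P? x) then f x else 0#) ≤ f x
      bound x with does (P? x)
      ... | true  = O.refl
      ... | false = h x

    ∑-exists-≤ : ∀ (x : X) xs {f g} → ∑ (x ∷ xs) f ≤ ∑ (x ∷ xs) g → ∃[ y ] (y ∈ x ∷ xs × f y ≤ g y)
    ∑-exists-≤ x []       h = x , here refl ,
      subst₂ _≤_ (S.+-identityʳ _) (S.+-identityʳ _) h
    ∑-exists-≤ x (y ∷ ys) {f} {g} h with f x ≤? g x
    ... | yes p = x , here refl , p
    ... | no ¬p with ∑-exists-≤ y ys (+-cancel h ¬p)
    ...   | z , z∈ , q = z , there z∈ , q

    ∑-exists-≤′ : ∀ (xs : List X) {f g} → xs ≢ [] → ∑ xs f ≤ ∑ xs g → ∃[ y ] (y ∈ xs × f y ≤ g y)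
    ∑-exists-≤′ []       []≢[] h = ⊥-elim ([]≢[] refl)
    ∑-exists-≤′ (x ∷ xs) _     h = ∑-exists-≤ x xs h

    ι : Subset n → Fin n → A
    ι S v = if lookup S v then 1# else 0#

    δ : Fin n → Fin n → A
    δ u v = if does (u Fin.≟ v) then 1# else 0#

    if-nonneg : ∀ b {x} → 0# ≤ x → 0# ≤ (if b then x else 0#)
    if-nonneg true  p = p
    if-nonneg false p = O.refl

    ι-nonneg : ∀ (S : Subset n) v → 0# ≤ ι S v
    ι-nonneg S v = if-nonneg (lookup S v) 0≤1

    δ-nonneg : ∀ (u v : Fin n) → 0# ≤ δ u v
    δ-nonneg u v = if-nonneg (does (u Fin.≟ v)) 0≤1

    δ-refl : ∀ (u : Fin n) → δ u u ≡ 1#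
    δ-refl u with u Fin.≟ u
    ... | yes _ = refl
    ... | no ¬p = ⊥-elim (¬p refl)

    δ-≢ : ∀ {u v : Fin n} → u ≢ v → δ u v ≡ 0#
    δ-≢ {u = u} {v} u≢v with u Fin.≟ v
    ... | yes p = ⊥-elim (u≢v p)
    ... | no _  = refl

    δ-sym : ∀ (u v : Fin n) → δ u v ≡ δ v u
    δ-sym u v with u Fin.≟ v | v Fin.≟ u
    ... | yes _ | yes _ = refl
    ... | no _  | no _  = refl
    ... | yes p | no ¬q = ⊥-elim (¬q (sym p))
    ... | no ¬p | yes q = ⊥-elim (¬p (sym q))

    ι-idem : ∀ (S : Subset n) v → ι S v * ι S v ≡ ι S v
    ι-idem S v with lookup S v
    ... | true  = S.*-identityˡ 1#
    ... | false = S.zeroˡ 0#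

    private
      ∑-δ-∉ : ∀ (xs : List (Fin n)) u (f : Fin n → A) → All (u ≢_) xs → ∑ xs (λ v → δ u v * f v) ≡ 0#
      ∑-δ-∉ []       u f []       = refl
      ∑-δ-∉ (x ∷ xs) u f (p ∷ ps) =
        trans (cong₂ _+_ (trans (cong (_* f x) (δ-≢ p)) (S.zeroˡ _)) (∑-δ-∉ xs u f ps)) (S.+-identityˡ _)

      ∑-δ-∈ : ∀ (xs : List (Fin n)) u (f : Fin n → A) → Unique xs → u ∈ xs → ∑ xs (λ v → δ u v * f v) ≡ f u
      ∑-δ-∈ (x ∷ xs) .x f (p ∷ ps) (here refl) =
        trans (cong₂ _+_ (trans (cong (_* f x) (δ-refl x)) (S.*-identityˡ _)) (∑-δ-∉ xs x f p))
              (S.+-identityʳ _)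
      ∑-δ-∈ (x ∷ xs) u f (p ∷ ps) (there u∈) =
        trans (cong₂ _+_ (trans (cong (_* f x) (δ-≢ (≢-sym (All.lookup p u∈)))) (S.zeroˡ _))
                         (∑-δ-∈ xs u f ps u∈))
              (S.+-identityˡ _)

    ∑ᵥ : (Fin n → A) → A
    ∑ᵥ {n} f = ∑ (allFin n) f

    ∑-δ : ∀ (u : Fin n) (f : Fin n → A) → ∑ᵥ (λ v → δ u v * f v) ≡ f u
    ∑-δ {n} u f = ∑-δ-∈ (allFin n) u f (allFin⁺ n) (∈-allFin u)

    ∑-map : ∀ (h : X → Y) xs f → ∑ (map h xs) f ≡ ∑ xs (f ∘ h)
    ∑-map h []       f = refl
    ∑-map h (x ∷ xs) f = cong (_ +_) (∑-map h xs f)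

    ∑ᵥ-suc : ∀ (f : Fin (suc n) → A) → ∑ᵥ f ≡ f zero + ∑ᵥ (f ∘ suc)
    ∑ᵥ-suc {n} f = cong (f zero +_)
      (trans (cong (λ l → ∑ l f) (sym (List.map-tabulate {n = n} id suc))) (∑-map suc (allFin n) f))

-- Arithmetic of inequalities in ℚ and ℕ.

module Numbers where

  open import Algebra.Structures using (IsCommutativeRing)
  open import Data.Nat as ℕ using (ℕ; zero; suc)
  import Data.Nat.Properties as ℕ
  open import Data.Rational using (ℚ; 0ℚ; 1ℚ; _+_; _*_; -_; _-_; _≤_; _<_; _≤?_; _≟_; *≤*; *<*; positive;
    nonNegative)
  import Data.Integer as ℤ
  import Data.Rational.Properties as ℚₚ
  open ℚₚ using (+-mono-≤; +-mono-<; *-zeroʳ; *-zeroˡ; *-monoˡ-≤-nonNeg; *-monoʳ-≤-nonNeg; ≤-trans; ≤-refl; ≤-reflexive; ≤-total; neg-antimono-≤; +-inverseʳ; +-monoˡ-≤; +-monoʳ-≤; +-identityʳ; +-identityˡ; +-assoc; *-cancelˡ-≤-pos; *-monoʳ-<-pos; <-irrefl; <-≤-trans; ≰⇒>)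
  open import Level using (0ℓ)
  open import Relation.Nullary.Decidable using (dec⇒maybe)
  import Tactic.RingSolver.Core.AlmostCommutativeRing as ACR
  open OrderedSums

  module Rationals where

    open import Tactic.RingSolver public using (solve-∀)

    ring : ACR.AlmostCommutativeRing 0ℓ 0ℓ
    ring = ACR.fromCommutativeRing ℚₚ.+-*-commutativeRing (λ x → dec⇒maybe (0ℚ ≟ x))

    +≥0 : ∀ {p q} → 0ℚ ≤ p → 0ℚ ≤ q → 0ℚ ≤ p + q
    +≥0 = +-mono-≤

    *≥0 : ∀ {p q} → 0ℚ ≤ p → 0ℚ ≤ q → 0ℚ ≤ p * q
    *≥0 {p} {q} 0≤p 0≤q =
      subst (_≤ p * q) (*-zeroʳ p) (*-monoˡ-≤-nonNeg p {{nonNegative 0≤p}} 0≤q)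

    *-mono-≥0 : ∀ {p q r s} → 0ℚ ≤ p → 0ℚ ≤ r → p ≤ q → r ≤ s → p * r ≤ q * s
    *-mono-≥0 {p} {q} {r} {s} 0≤p 0≤r p≤q r≤s = ≤-trans
      (*-monoʳ-≤-nonNeg r {{nonNegative 0≤r}} p≤q)
      (*-monoˡ-≤-nonNeg q {{nonNegative (≤-trans 0≤p p≤q)}} r≤s)

    *-monoˡ : ∀ {p r s} → 0ℚ ≤ p → r ≤ s → p * r ≤ p * s
    *-monoˡ {p} 0≤p = *-monoˡ-≤-nonNeg p {{nonNegative 0≤p}}

    *-monoʳ : ∀ {p r s} → 0ℚ ≤ p → r ≤ s → r * p ≤ s * p
    *-monoʳ {p} 0≤p = *-monoʳ-≤-nonNeg p {{nonNegative 0≤p}}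

    sq≥0 : ∀ p → 0ℚ ≤ p * p
    sq≥0 p with ≤-total 0ℚ p
    ... | inj₁ 0≤p = *≥0 0≤p 0≤p
    ... | inj₂ p≤0 = subst (0ℚ ≤_) (lemma p) (*≥0 (neg-antimono-≤ p≤0) (neg-antimono-≤ p≤0))
      where
      lemma : ∀ p → (- p) * (- p) ≡ p * p
      lemma = solve-∀ ring

    ≤⇒0≤- : ∀ {p q} → p ≤ q → 0ℚ ≤ q - p
    ≤⇒0≤- {p} {q} p≤q = subst (_≤ q - p) (+-inverseʳ p) (+-monoˡ-≤ (- p) p≤q)

    -- Certificate form of an inequality: the sign of the difference `d` is shown by hand, and the
    -- remaining identity is left to the ring solver.
    ≤-by : ∀ {p q} d → 0ℚ ≤ d → q ≡ p + d → p ≤ q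
    ≤-by {p} d 0≤d refl = subst (_≤ p + d) (+-identityʳ p) (+-monoʳ-≤ p 0≤d)

    *-cancelˡ-≤ : ∀ {p q r} → 0ℚ < p → p * q ≤ p * r → q ≤ r
    *-cancelˡ-≤ {p} 0<p = *-cancelˡ-≤-pos p {{positive 0<p}}

    *>0 : ∀ {p q} → 0ℚ < p → 0ℚ < q → 0ℚ < p * q
    *>0 {p} {q} 0<p 0<q =
      subst (_< p * q) (*-zeroʳ p) (*-monoʳ-<-pos p {{positive 0<p}} 0<q)

    +-cancel : ∀ {a b c d} → a + c ≤ b + d → ¬ (a ≤ b) → c ≤ d
    +-cancel {a} {b} {c} {d} h a≰b with c ≤? d
    ... | yes p = p
    ... | no c≰d = ⊥-elim (<-irrefl refl (<-≤-trans (+-mono-< (≰⇒> a≰b) (≰⇒> c≰d)) h))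

    0≤1 : 0ℚ ≤ 1ℚ
    0≤1 = *≤* (ℤ.+≤+ ℕ.z≤n)
    0<1 : 0ℚ < 1ℚ
    0<1 = *<* (ℤ.+<+ (ℕ.s≤s ℕ.z≤n))
    -- Recursive rather than `+ n / 1`: numerals unfold to sums of `1ℚ`, and in this form they occur
    -- in the identities given to the ring solver. `⟦⟧≡/1` identifies the two embeddings.
    ⟦_⟧ : ℕ → ℚ
    ⟦ zero ⟧  = 0ℚ
    ⟦ suc n ⟧ = 1ℚ + ⟦ n ⟧

    ⟦⟧-+ : ∀ m n → ⟦ m ℕ.+ n ⟧ ≡ ⟦ m ⟧ + ⟦ n ⟧
    ⟦⟧-+ zero    n = sym (+-identityˡ ⟦ n ⟧)
    ⟦⟧-+ (suc m) n = trans (cong (1ℚ +_) (⟦⟧-+ m n)) (sym (+-assoc 1ℚ ⟦ m ⟧ ⟦ n ⟧))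

    ⟦⟧-* : ∀ m n → ⟦ m ℕ.* n ⟧ ≡ ⟦ m ⟧ * ⟦ n ⟧
    ⟦⟧-* zero    n = sym (*-zeroˡ ⟦ n ⟧)
    ⟦⟧-* (suc m) n = trans (⟦⟧-+ n (m ℕ.* n))
      (trans (cong (⟦ n ⟧ +_) (⟦⟧-* m n)) (lemma ⟦ m ⟧ ⟦ n ⟧))
      where
      lemma : ∀ p q → q + p * q ≡ (1ℚ + p) * q
      lemma = solve-∀ ring

    ⟦⟧≥0 : ∀ n → 0ℚ ≤ ⟦ n ⟧
    ⟦⟧≥0 zero    = ≤-refl
    ⟦⟧≥0 (suc n) = +≥0 0≤1 (⟦⟧≥0 n)

    ⟦⟧-mono : ∀ {m n} → m ℕ.≤ n → ⟦ m ⟧ ≤ ⟦ n ⟧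
    ⟦⟧-mono {n = n} ℕ.z≤n = ⟦⟧≥0 n
    ⟦⟧-mono (ℕ.s≤s p) = +-monoʳ-≤ 1ℚ (⟦⟧-mono p)

    ⟦⟧>0 : ∀ {n} → 1 ℕ.≤ n → 0ℚ < ⟦ n ⟧
    ⟦⟧>0 p = <-≤-trans 0<1 (≤-trans (≤-reflexive (sym (+-identityʳ 1ℚ))) (⟦⟧-mono p))

    ⟦⟧≥1 : ∀ {n} → 1 ℕ.≤ n → 1ℚ ≤ ⟦ n ⟧
    ⟦⟧≥1 p = ≤-trans (≤-reflexive (sym (+-identityʳ 1ℚ))) (⟦⟧-mono p)

  ℕ-+-cancel : ∀ {a b c d} → a ℕ.+ c ℕ.≤ b ℕ.+ d → ¬ (a ℕ.≤ b) → c ℕ.≤ d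
  ℕ-+-cancel {c = c} {d} h a≰b with c ℕ.≤? d
  ... | yes p = p
  ... | no c≰d = ⊥-elim (ℕ.<-irrefl refl (ℕ.<-≤-trans (ℕ.+-mono-< (ℕ.≰⇒> a≰b) (ℕ.≰⇒> c≰d)) h))

  module ∑ℚ = Sums _+_ _*_ 0ℚ 1ℚ (IsCommutativeRing.isCommutativeSemiring ℚₚ.+-*-isCommutativeRing)
    _≤_ ℚₚ.≤-isTotalOrder _≤?_ +-mono-≤ Rationals.+-cancel Rationals.0≤1

  module ∑ℕ = Sums ℕ._+_ ℕ._*_ 0 1 ℕ.+-*-isCommutativeSemiring
    ℕ._≤_ ℕ.≤-isTotalOrder ℕ._≤?_ ℕ.+-mono-≤ ℕ-+-cancel ℕ.z≤n

-- Bounds for powers of 1 - c/n and 1 + c/n.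

module Powers where

  open import Data.Nat as ℕ using (ℕ; zero; suc; z≤n; s≤s)
  import Data.Nat.DivMod as ℕ
  import Data.Nat.Properties as ℕ
  open import Data.Nat.Tactic.RingSolver using () renaming (solve-∀ to solveℕ)
  open import Data.Rational using (ℚ; 0ℚ; 1ℚ; _+_; _*_; -_; _-_; _≤_)
  open import Data.Rational.Properties
  open Numbers
  open Rationals

  infixr 8 _^_
  _^_ : ℚ → ℕ → ℚ
  p ^ zero  = 1ℚ
  p ^ suc i = p * p ^ i

  ^-≥0 : ∀ {p} → 0ℚ ≤ p → ∀ i → 0ℚ ≤ p ^ i
  ^-≥0 0≤p zero    = 0≤1
  ^-≥0 0≤p (suc i) = *≥0 0≤p (^-≥0 0≤p i)

  ^-≥1 : ∀ {p} → 1ℚ ≤ p → ∀ i → 1ℚ ≤ p ^ i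
  ^-≥1 1≤p zero    = ≤-refl
  ^-≥1 {p} 1≤p (suc i) = ≤-trans (≤-reflexive (sym (*-identityˡ 1ℚ)))
    (*-mono-≥0 0≤1 0≤1 1≤p (^-≥1 1≤p i))

  ^-≤1 : ∀ {p} → 0ℚ ≤ p → p ≤ 1ℚ → ∀ i → p ^ i ≤ 1ℚ
  ^-≤1 0≤p p≤1 zero    = ≤-refl
  ^-≤1 {p} 0≤p p≤1 (suc i) = ≤-trans (*-mono-≥0 0≤p (^-≥0 0≤p i) p≤1 (^-≤1 0≤p p≤1 i))
    (≤-reflexive (*-identityˡ 1ℚ))

  ^-+ : ∀ p i j → p ^ (i ℕ.+ j) ≡ p ^ i * p ^ j
  ^-+ p zero    j = sym (*-identityˡ (p ^ j))
  ^-+ p (suc i) j = trans (cong (p *_) (^-+ p i j)) (sym (*-assoc p (p ^ i) (p ^ j)))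

  ^-* : ∀ p q i → (p * q) ^ i ≡ p ^ i * q ^ i
  ^-* p q zero    = sym (*-identityˡ 1ℚ)
  ^-* p q (suc i) = trans (cong (p * q *_) (^-* p q i)) (lemma p q (p ^ i) (q ^ i))
    where
    lemma : ∀ p q r s → p * q * (r * s) ≡ p * r * (q * s)
    lemma = solve-∀ ring

  ^-antitone : ∀ {p} → 0ℚ ≤ p → p ≤ 1ℚ → ∀ {i j} → i ℕ.≤ j → p ^ j ≤ p ^ i
  ^-antitone 0≤p p≤1 {j = j} z≤n = ^-≤1 0≤p p≤1 j
  ^-antitone 0≤p p≤1 (s≤s i≤j)   = *-monoˡ 0≤p (^-antitone 0≤p p≤1 i≤j)

  bernoulli : ∀ {x} → 0ℚ ≤ x → x ≤ 1ℚ → ∀ s → 1ℚ - ⟦ s ⟧ * x ≤ (1ℚ - x) ^ s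
  bernoulli {x} 0≤x x≤1 zero    = ≤-reflexive (lemma x)
    where
    lemma : ∀ x → 1ℚ - 0ℚ * x ≡ 1ℚ
    lemma = solve-∀ ring
  bernoulli {x} 0≤x x≤1 (suc s) = ≤-trans
    (≤-by (⟦ s ⟧ * (x * x)) (*≥0 (⟦⟧≥0 s) (sq≥0 x)) (lemma ⟦ s ⟧ x))
    (*-monoˡ (≤⇒0≤- x≤1) (bernoulli 0≤x x≤1 s))
    where
    lemma : ∀ s x → (1ℚ - x) * (1ℚ - s * x) ≡ (1ℚ - (1ℚ + s) * x) + s * (x * x)
    lemma = solve-∀ ring

  module _ {n : ℕ} {ν : ℚ} (ν*n : ν * ⟦ n ⟧ ≡ 1ℚ) (0≤ν : 0ℚ ≤ ν) {c : ℕ}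
           (1≤c : 1 ℕ.≤ c) (2c≤n : 2 ℕ.* c ℕ.≤ n) where

    private
      instance
        2c≢0 : ℕ.NonZero (2 ℕ.* c)
        2c≢0 = ℕ.>-nonZero (ℕ.≤-trans 1≤c (ℕ.m≤m+n c _))

      x : ℚ
      x = ⟦ c ⟧ * ν
      s : ℕ
      s = n ℕ./ (2 ℕ.* c)

    c*ν≥0 : 0ℚ ≤ ⟦ c ⟧ * ν
    c*ν≥0 = *≥0 (⟦⟧≥0 c) 0≤ν

    c*ν≤1 : ⟦ c ⟧ * ν ≤ 1ℚ
    c*ν≤1 = ≤-trans (*-monoʳ 0≤ν (⟦⟧-mono (ℕ.≤-trans (ℕ.m≤m+n c _) 2c≤n)))
                    (≤-reflexive (trans (*-comm ⟦ n ⟧ ν) ν*n))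

    private
      0≤y : 0ℚ ≤ 1ℚ - x
      0≤y = ≤⇒0≤- c*ν≤1
      y≤1 : 1ℚ - x ≤ 1ℚ
      y≤1 = ≤-by x c*ν≥0 (lemma x)
        where
        lemma : ∀ x → 1ℚ ≡ (1ℚ - x) + x
        lemma = solve-∀ ring

      -- A block of `s` factors loses at most one half: Bernoulli leaves at least `1 - s c / n`, and
      -- `2 s c ≤ n`.
      half : 1ℚ ≤ ⟦ 2 ⟧ * (1ℚ - x) ^ s
      half = ≤-trans (≤-by (1ℚ - ⟦ s ℕ.* (2 ℕ.* c) ⟧ * ν) (≤⇒0≤- 2scν≤1)
          (trans (lemma ⟦ s ⟧ ⟦ c ⟧ ν)
            (cong (λ p → 1ℚ + (1ℚ - p * ν)) (sym (trans (⟦⟧-* s (2 ℕ.* c)) (cong (⟦ s ⟧ *_) (⟦⟧-* 2 c)))))))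
        (*-monoˡ (⟦⟧≥0 2) (bernoulli c*ν≥0 c*ν≤1 s))
        where
        2scν≤1 : ⟦ s ℕ.* (2 ℕ.* c) ⟧ * ν ≤ 1ℚ
        2scν≤1 = ≤-trans (*-monoʳ 0≤ν (⟦⟧-mono (ℕ.m/n*n≤m n (2 ℕ.* c))))
                         (≤-reflexive (trans (*-comm ⟦ n ⟧ ν) ν*n))
        lemma : ∀ s c ν → (1ℚ + (1ℚ + 0ℚ)) * (1ℚ - s * (c * ν)) ≡ 1ℚ + (1ℚ - s * ((1ℚ + (1ℚ + 0ℚ)) * c) * ν)
        lemma = solve-∀ ring

      blocks : ∀ j → 1ℚ ≤ ⟦ 2 ℕ.^ j ⟧ * (1ℚ - x) ^ (j ℕ.* s)
      blocks zero    = ≤-reflexive (sym (trans (*-identityʳ ⟦ 1 ⟧) (+-identityʳ 1ℚ)))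
      blocks (suc j) = ≤-trans (≤-reflexive (sym (*-identityˡ 1ℚ)))
        (≤-trans (*-mono-≥0 0≤1 0≤1 half (blocks j))
          (≤-reflexive (trans (lemma ⟦ 2 ⟧ ((1ℚ - x) ^ s) ⟦ 2 ℕ.^ j ⟧ ((1ℚ - x) ^ (j ℕ.* s)))
            (cong₂ _*_ (sym (⟦⟧-* 2 (2 ℕ.^ j))) (sym (^-+ (1ℚ - x) s (j ℕ.* s)))))))
        where
        lemma : ∀ p q r s → (p * q) * (r * s) ≡ (p * r) * (q * s)
        lemma = solve-∀ ring

      -- Rounding in `s` loses less than `2 * c`, which is at most `2 * c * s` since `2 * c ≤ n`
      -- makes `s` positive. Hence `4 * c` blocks cover all `n` factors.
      n≤4cs : n ℕ.≤ 4 ℕ.* c ℕ.* s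
      n≤4cs = begin
        n                             ≡⟨ ℕ.m≡m%n+[m/n]*n n (2 ℕ.* c) ⟩
        n ℕ.% (2 ℕ.* c) ℕ.+ s ℕ.* (2 ℕ.* c)
          ≤⟨ ℕ.+-monoˡ-≤ _ (ℕ.<⇒≤ (ℕ.m%n<n n (2 ℕ.* c))) ⟩
        2 ℕ.* c ℕ.+ s ℕ.* (2 ℕ.* c)
          ≤⟨ ℕ.+-monoˡ-≤ _ (ℕ.≤-trans (ℕ.≤-reflexive (sym (ℕ.*-identityˡ _))) (ℕ.*-monoˡ-≤ (2 ℕ.* c) 1≤s)) ⟩
        s ℕ.* (2 ℕ.* c) ℕ.+ s ℕ.* (2 ℕ.* c) ≡⟨ lemma s c ⟩
        4 ℕ.* c ℕ.* s ∎
        where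
        open ℕ.≤-Reasoning
        lemma : ∀ s c → s ℕ.* (2 ℕ.* c) ℕ.+ s ℕ.* (2 ℕ.* c) ≡ 4 ℕ.* c ℕ.* s
        lemma = solveℕ
        1≤s : 1 ℕ.≤ s
        1≤s = ℕ.m≥n⇒m/n>0 2c≤n

    -- (1 - c/n)^i ≥ 2^(-4c) for i ≤ n, from Bernoulli's inequality on blocks of n/(2c) factors.
    power-lower : ∀ {i} → i ℕ.≤ n → 1ℚ ≤ ⟦ 2 ℕ.^ (4 ℕ.* c) ⟧ * (1ℚ - ⟦ c ⟧ * ν) ^ i
    power-lower i≤n = ≤-trans (blocks (4 ℕ.* c))
      (*-monoˡ (⟦⟧≥0 (2 ℕ.^ (4 ℕ.* c))) (^-antitone 0≤y y≤1 (ℕ.≤-trans i≤n n≤4cs)))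

    -- As `(1 + x) (1 - x) ≤ 1`, a power of `1 + x` is at most the inverse of the same power of
    -- `1 - x`, which `power-lower` controls.
    power-upper : ∀ {i} → i ℕ.≤ n → (1ℚ + ⟦ c ⟧ * ν) ^ i ≤ ⟦ 2 ℕ.^ (4 ℕ.* c) ⟧
    power-upper {i} i≤n = begin
      z ^ i                       ≡⟨ *-identityʳ (z ^ i) ⟨
      z ^ i * 1ℚ                  ≤⟨ *-monoˡ (^-≥0 0≤z i) (power-lower i≤n) ⟩
      z ^ i * (h * y ^ i)         ≡⟨ rot (z ^ i) h (y ^ i) ⟩
      h * (z ^ i * y ^ i)         ≡⟨ cong (h *_) (^-* z y i) ⟨
      h * (z * y) ^ i             ≤⟨ *-monoˡ (⟦⟧≥0 (2 ℕ.^ (4 ℕ.* c))) (^-≤1 (*≥0 0≤z 0≤y) zy≤1 i) ⟩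
      h * 1ℚ                      ≡⟨ *-identityʳ h ⟩
      h ∎
      where
      open ≤-Reasoning
      h z y : ℚ
      h = ⟦ 2 ℕ.^ (4 ℕ.* c) ⟧
      z = 1ℚ + x
      y = 1ℚ - x
      0≤z : 0ℚ ≤ z
      0≤z = +≥0 0≤1 c*ν≥0
      rot : ∀ z h y → z * (h * y) ≡ h * (z * y)
      rot = solve-∀ ring
      zy≤1 : z * y ≤ 1ℚ
      zy≤1 = ≤-by (x * x) (sq≥0 x) (lemma x)
        where
        lemma : ∀ x → 1ℚ ≡ (1ℚ + x) * (1ℚ - x) + x * x
        lemma = solve-∀ ring

-- Indicators, almost disjoint families and enumerations of subsets.

module SetFamilies where

  open import Data.Bool.Base using (_∧_)
  open import Data.Fin.Subset.Properties using (∩-comm; drop-there)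
  open import Data.Fin.Subset using (_─_)
  open import Data.Nat
  open import Data.Nat.Properties
  import Data.List.Properties as List
  open import Data.Vec using (lookup; []; _∷_; here; there; tabulate)
  open import Data.Vec.Properties using (lookup∘tabulate; lookup-zipWith; []=⇒lookup; lookup⇒[]=)
  open import Relation.Nullary.Decidable using (dec-true)
  open Numbers

  open ∑ℕ

  private variable n : ℕ

  ι-∈ : ∀ {S : Subset n} {v} → v ∈ₛ S → ι S v ≡ 1
  ι-∈ v∈ rewrite []=⇒lookup v∈ = refl

  ι-∉ : ∀ {S : Subset n} {v} → v ∉ₛ S → ι S v ≡ 0
  ι-∉ {S = S} {v} v∉ with lookup S v in eq
  ... | true  = ⊥-elim (v∉ (lookup⇒[]= v S eq))
  ... | false = refl

  ι-0 : ∀ {S : Subset n} {v} → ι S v ≡ 0 → v ∉ₛ S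
  ι-0 eq v∈ with trans (sym (ι-∈ v∈)) eq
  ... | ()

  ι-≤1 : ∀ (S : Subset n) v → ι S v ≤ 1
  ι-≤1 S v with lookup S v
  ... | true  = ≤-refl
  ... | false = z≤n

  ∣∣≡∑ : ∀ (S : Subset n) → ∣ S ∣ ≡ ∑ᵥ (ι S)
  ∣∣≡∑ []          = refl
  ∣∣≡∑ (true ∷ S)  = trans (cong suc (∣∣≡∑ S)) (sym (∑ᵥ-suc (ι (true ∷ S))))
  ∣∣≡∑ (false ∷ S) = trans (∣∣≡∑ S) (sym (∑ᵥ-suc (ι (false ∷ S))))

  ι-∩ : ∀ (S T : Subset n) v → ι (S ∩ T) v ≡ ι S v * ι T v
  ι-∩ S T v rewrite lookup-zipWith _∧_ v S T with lookup S v | lookup T v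
  ... | true  | true  = refl
  ... | true  | false = refl
  ... | false | _     = refl

  ∣∩∣≡∑ : ∀ (S T : Subset n) → ∣ S ∩ T ∣ ≡ ∑ᵥ (λ v → ι S v * ι T v)
  ∣∩∣≡∑ S T = trans (∣∣≡∑ (S ∩ T)) (∑-cong (allFin _) (ι-∩ S T))

  length≡∑ : ∀ {X : Set} (xs : List X) → length xs ≡ ∑ xs (λ _ → 1)
  length≡∑ []       = refl
  length≡∑ (x ∷ xs) = cong suc (length≡∑ xs)

  ∑-const : ∀ {X : Set} (xs : List X) c → ∑ xs (λ _ → c) ≡ length xs * c
  ∑-const []       c = refl
  ∑-const (x ∷ xs) c = cong (c +_) (∑-const xs c)

  two-terms : ∀ (f : Fin n → ℕ) {u v} → u ≢ v → f u + f v ≤ ∑ᵥ f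
  two-terms {n} f {u} {v} u≢v = begin
    f u + f v
      ≡⟨ cong₂ _+_ (sym (∑-δ u f)) (sym (∑-δ v f)) ⟩
    ∑ᵥ (λ w → δ u w * f w) + ∑ᵥ (λ w → δ v w * f w)
      ≡⟨ ∑-+ (allFin n) (λ w → δ u w * f w) (λ w → δ v w * f w) ⟨
    ∑ᵥ (λ w → δ u w * f w + δ v w * f w)
      ≤⟨ ∑-mono (allFin n) bound ⟩
    ∑ᵥ f ∎
    where
    open ≤-Reasoning
    bound : ∀ w → δ u w * f w + δ v w * f w ≤ f w
    bound w with u Fin.≟ w | v Fin.≟ w
    ... | yes refl | yes refl = ⊥-elim (u≢v refl)
    ... | yes _    | no _     = ≤-reflexive (trans (+-identityʳ _) (+-identityʳ _))
    ... | no _     | yes _    = ≤-reflexive (+-identityʳ _)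
    ... | no _     | no _     = z≤n

  -- The pairs are pairs of list positions, so a set with at most one element may be repeated; this
  -- happens for the copies of a one-vertex hypertree.
  AlmostDisjoint : List (Subset n) → Set
  AlmostDisjoint = AllPairs (λ f g → ∣ f ∩ g ∣ ≤ 1)

  almostDisjoint-∈ : ∀ {E : List (Subset n)} → AlmostDisjoint E → ∀ {e f} → e ∈ E → f ∈ E →
                     e ≡ f ⊎ ∣ e ∩ f ∣ ≤ 1
  almostDisjoint-∈ (p ∷ ps) (here refl) (here refl) = inj₁ refl
  almostDisjoint-∈ (p ∷ ps) (here refl) (there f∈)  = inj₂ (All.lookup p f∈)
  almostDisjoint-∈ (p ∷ ps) {e} {f} (there e∈) (here refl) =
    inj₂ (subst (λ S → ∣ S ∣ ≤ 1) (∩-comm f e) (All.lookup p e∈))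
  almostDisjoint-∈ (p ∷ ps) (there e∈) (there f∈)   = almostDisjoint-∈ ps e∈ f∈

  -- Two members through both `u` and `v` would share two vertices; so once a member contains both,
  -- all later summands vanish.
  codegree≤1 : ∀ {E : List (Subset n)} → AlmostDisjoint E → ∀ {u v} → u ≢ v →
               ∑ E (λ f → ι f u * ι f v) ≤ 1
  codegree≤1 [] u≢v = z≤n
  codegree≤1 {E = e ∷ E} (p ∷ ps) {u} {v} u≢v with ι e u * ι e v ≟ 0
  ... | yes eq rewrite eq = codegree≤1 ps u≢v
  ... | no ¬0 = ≤-trans (≤-reflexive (trans (cong (ι e u * ι e v +_) rest) (+-identityʳ _)))
                        (*-mono-≤ (ι-≤1 e u) (ι-≤1 e v))
    where
    e-both : ι e u ≡ 1 × ι e v ≡ 1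
    e-both with lookup e u | lookup e v
    ... | true  | true  = refl , refl
    ... | true  | false = ⊥-elim (¬0 refl)
    ... | false | _     = ⊥-elim (¬0 refl)
    pairwise : ∀ {f} → f ∈ E → ι f u * ι f v ≡ 0
    pairwise {f} f∈ with lookup f u in eqᵤ | lookup f v in eqᵥ
    ... | true  | false = refl
    ... | false | _     = refl
    ... | true  | true  = ⊥-elim (<⇒≱ (s≤s (s≤s z≤n)) (≤-trans
            (≤-trans (≤-reflexive (sym (cong₂ _+_ (one u (proj₁ e-both) eqᵤ)
                                                  (one v (proj₂ e-both) eqᵥ))))
                     (two-terms (λ w → ι e w * ι f w) u≢v))
            (≤-trans (≤-reflexive (sym (∣∩∣≡∑ e f))) (All.lookup p f∈))))
      where
      one : ∀ w → ι e w ≡ 1 → lookup f w ≡ true → ι e w * ι f w ≡ 1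
      one w p q rewrite p | q = refl
    rest : ∑ E (λ f → ι f u * ι f v) ≡ 0
    rest = trans (∑-cong-∈ E pairwise) (∑-zero E)

  ∣p─q∣+∣q∣ : ∀ {n} (p q : Subset n) → q ⊆ p → ∣ p ─ q ∣ + ∣ q ∣ ≡ ∣ p ∣
  ∣p─q∣+∣q∣ []           []           q⊆p = refl
  ∣p─q∣+∣q∣ (true ∷ p)  (true ∷ q)  q⊆p = trans (+-suc ∣ p ─ q ∣ ∣ q ∣) (cong suc (∣p─q∣+∣q∣ p q (λ v∈ → drop-there (q⊆p (there v∈)))))
  ∣p─q∣+∣q∣ (true ∷ p)  (false ∷ q) q⊆p = cong suc (∣p─q∣+∣q∣ p q (λ v∈ → drop-there (q⊆p (there v∈))))
  ∣p─q∣+∣q∣ (false ∷ p) (true ∷ q)  q⊆p with q⊆p here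
  ... | ()
  ∣p─q∣+∣q∣ (false ∷ p) (false ∷ q) q⊆p = ∣p─q∣+∣q∣ p q (λ v∈ → drop-there (q⊆p (there v∈)))

  record Enumeration (p : Subset n) (m : ℕ) : Set where
    field
      at           : Fin m → Fin n
      at-injective : ∀ {i j} → at i ≡ at j → i ≡ j
      at-∈         : ∀ i → at i ∈ₛ p
      index        : ∀ {v} → v ∈ₛ p → ∃[ i ] at i ≡ v

  open Enumeration

  enumerate : (p : Subset n) → Enumeration p ∣ p ∣
  enumerate [] = record { at = λ () ; at-injective = λ { {()} } ; at-∈ = λ () ; index = λ () }
  enumerate (true ∷ p) = record
    { at           = at′
    ; at-injective = injective
    ; at-∈         = λ { zero → here ; (suc i) → there (at-∈ rec i) }
    ; index        = λ { here → zero , refl ; (there v∈) → let (i , eq) = index rec v∈ in suc i , cong suc eq }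
    }
    where
    rec = enumerate p
    at′ : Fin (suc ∣ p ∣) → Fin _
    at′ zero    = zero
    at′ (suc i) = suc (at rec i)
    injective : ∀ {i j} → at′ i ≡ at′ j → i ≡ j
    injective {zero}  {zero}  _  = refl
    injective {suc i} {suc j} eq = cong suc (at-injective rec (Fin.suc-injective eq))
  enumerate (false ∷ p) = record
    { at           = λ i → suc (at rec i)
    ; at-injective = λ eq → at-injective rec (Fin.suc-injective eq)
    ; at-∈         = λ i → there (at-∈ rec i)
    ; index        = λ { (there v∈) → let (i , eq) = index rec v∈ in i , cong suc eq }
    }
    where rec = enumerate p

  ι-enumeration : ∀ {p : Subset n} {m} (en : Enumeration p m) → ∀ v → ι p v ≡ ∑ᵥ (λ i → δ (at en i) v)
  ι-enumeration {n} {p} {m} en v with Fin.any? (λ i → at en i Fin.≟ v)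
  ... | yes (i , refl) = trans (ι-∈ (at-∈ en i)) (sym (trans (∑-cong (allFin m) same) (∑-δ i (λ _ → 1))))
    where
    same : ∀ j → δ (at en j) (at en i) ≡ δ i j * 1
    same j with j Fin.≟ i
    ... | yes refl = trans (δ-refl (at en j)) (sym (trans (*-identityʳ _) (δ-refl j)))
    ... | no j≢i   = trans (δ-≢ (j≢i ∘ at-injective en)) (sym (trans (*-identityʳ _) (δ-≢ (≢-sym j≢i))))
  ... | no none = trans (ι-∉ (none ∘ index en))
        (sym (trans (∑-cong (allFin m) (λ i → δ-≢ (λ eq → none (i , eq)))) (∑-zero (allFin m))))

  -- The indicator is a sum of deltas, and the two sums are exchanged. This passes from vertices of
  -- an edge to positions in it, to which the colours of the hypertree are matched.
  ∑-enumeration : ∀ {p : Subset n} {m} (en : Enumeration p m) (c : Fin n → ℕ) →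
                  ∑ᵥ (λ v → ι p v * c v) ≡ ∑ᵥ (λ i → c (at en i))
  ∑-enumeration {n} {p} {m} en c = begin
    ∑ᵥ (λ v → ι p v * c v)
      ≡⟨ ∑-cong (allFin n) (λ v → trans (cong (_* c v) (ι-enumeration en v)) (sym (∑-*ʳ (allFin m) (c v) (λ i → δ (at en i) v)))) ⟩
    ∑ᵥ (λ v → ∑ᵥ (λ i → δ (at en i) v * c v)) ≡⟨ ∑-swap (allFin n) (allFin m) (λ v i → δ (at en i) v * c v) ⟩
    ∑ᵥ (λ i → ∑ᵥ (λ v → δ (at en i) v * c v)) ≡⟨ ∑-cong (allFin m) (λ i → ∑-δ (at en i) c) ⟩
    ∑ᵥ (λ i → c (at en i)) ∎
    where open ≡-Reasoning

  length-allFin : ∀ n → length (allFin n) ≡ n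
  length-allFin n = List.length-tabulate {n = n} (λ i → i)

  enumeration-size : ∀ {p : Subset n} {m} → Enumeration p m → ∣ p ∣ ≡ m
  enumeration-size {n} {p} {m} en = trans (∣∣≡∑ p) (trans (∑-cong (allFin n) (λ v → sym (*-identityʳ (ι p v))))
    (trans (∑-enumeration en (λ _ → 1)) (trans (sym (length≡∑ (allFin m))) (length-allFin m))))

  at-most-one : ∀ (p : Subset n) → (∀ {u v} → u ∈ₛ p → v ∈ₛ p → u ≡ v) → ∣ p ∣ ≤ 1
  at-most-one p same = go ∣ p ∣ (enumerate p)
    where
    go : ∀ m → Enumeration p m → m ≤ 1
    go zero          _  = z≤n
    go (suc zero)    _  = ≤-refl
    go (suc (suc m)) en with at-injective en (same (at-∈ en zero) (at-∈ en (suc zero)))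
    ... | ()

  module Comprehension {P : Fin n → Set} (P? : ∀ v → Dec (P v)) where
    ⟪⟫ : Subset n
    ⟪⟫ = tabulate (λ v → does (P? v))

    ∈⟪⟫⁺ : ∀ {v} → P v → v ∈ₛ ⟪⟫
    ∈⟪⟫⁺ {v} pv = lookup⇒[]= v ⟪⟫ (trans (lookup∘tabulate _ v) (dec-true (P? v) pv))

    ∈⟪⟫⁻ : ∀ {v} → v ∈ₛ ⟪⟫ → P v
    ∈⟪⟫⁻ {v} v∈ with P? v | trans (sym (lookup∘tabulate (λ v → does (P? v)) v)) ([]=⇒lookup v∈)
    ... | yes pv | _ = pv
    ... | no _   | ()

-- Change of the potential when one edge is removed.

module PotentialDrift where

  open import Data.Nat using (ℕ)
  open import Data.Rational using (ℚ; 0ℚ; 1ℚ; _+_; _*_; -_; _-_; _≤_; _<_)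
  open import Data.Rational.Properties
  open Numbers

  -- ρ is the indicator of the uncovered vertices and a the target degree; when e is removed, an uncovered vertex v
  -- outside e loses L e v of its d v edges.
  module RemovalStep {n : ℕ} (E : List (Subset n)) (ρ : Fin n → ℚ) (t a b B g : ℚ) where
    open Rationals
    open ∑ℚ

    d X : Fin n → ℚ
    d v = ∑ E (λ f → ι f v)
    X v = d v - a * ρ v

    r m Φ : ℚ
    r = ∑ᵥ ρ
    m = ∑ E (λ _ → 1ℚ)
    Φ = ∑ᵥ (λ v → X v * X v)

    -- Dropping the diagonal keeps every entry of `A` at most one, so that `L≤t` holds also at the
    -- vertices of `e`; at a vertex outside `e` the diagonal does not enter.
    cod A : Fin n → Fin n → ℚ
    cod u v = ∑ E (λ f → ι f u * ι f v)
    A u v = (1ℚ - δ u v) * cod u v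

    hits L : Subset n → Fin n → ℚ
    hits e v = ∑ᵥ (λ u → ι e u * cod u v)
    L e v = ∑ᵥ (λ u → ι e u * A u v)

    module Bounds
      (ι-live : ∀ {f} → f ∈ E → ∀ v → ι f v * ρ v ≡ ι f v)
      (ρ-idem : ∀ v → ρ v * ρ v ≡ ρ v)
      (uniform : ∀ {f} → f ∈ E → ∑ᵥ (ι f) ≡ t)
      (cod≤1 : ∀ {u v} → u ≢ v → cod u v ≤ 1ℚ)
      (d≤B : ∀ v → d v ≤ B)
      (b*r : b * r ≡ t * (t - 1ℚ) * a)
      (0<r : 0ℚ < r) (0≤a : 0ℚ ≤ a) (1≤t : 1ℚ ≤ t) (0≤B : 0ℚ ≤ B)
      where

      private
        V = allFin n
        0≤t : 0ℚ ≤ t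
        0≤t = ≤-trans 0≤1 1≤t
        XF D : Subset n → ℚ
        XF f = ∑ᵥ (λ v → ι f v * X v)
        D f = ∑ᵥ (λ u → ι f u * d u)
        σ = ∑ᵥ X
        ∑ιD : Fin n → ℚ
        ∑ιD v = ∑ E (λ f → ι f v * D f)

      dρ : ∀ v → d v * ρ v ≡ d v
      dρ v = trans (sym (∑-*ʳ E (ρ v) (λ f → ι f v))) (∑-cong-∈ E (λ f∈ → ι-live f∈ v))

      Xρ : ∀ v → X v * ρ v ≡ X v
      Xρ v = trans (lemma (d v) a (ρ v)) (cong₂ (λ p q → p - a * q) (dρ v) (ρ-idem v))
        where
        lemma : ∀ d a ρ → (d - a * ρ) * ρ ≡ d * ρ - a * (ρ * ρ)
        lemma = solve-∀ ring

      d≡ : ∀ v → d v ≡ X v + a * ρ v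
      d≡ v = lemma (d v) (a * ρ v)
        where
        lemma : ∀ p q → p ≡ (p - q) + q
        lemma = solve-∀ ring

      -- The squares of `r X - σ ρ` sum to `r (r Φ - σ²)`: since `X` is supported on the uncovered
      -- vertices, the cross term is again a multiple of `σ`. The positive factor `r` is then
      -- cancelled.
      cauchy-schwarz : σ * σ ≤ r * Φ
      cauchy-schwarz = *-cancelˡ-≤ 0<r (≤-by (∑ᵥ (λ v → (r * X v - σ * ρ v) * (r * X v - σ * ρ v)))
        (∑-nonneg V (λ v → sq≥0 (r * X v - σ * ρ v)))
        (sym (trans (cong (r * (σ * σ) +_) expand) (final r σ Φ))))
        where
        pointwise : ∀ r x σ ρ → (r * x - σ * ρ) * (r * x - σ * ρ)
                              ≡ (r * r * (x * x) + (- (r * σ + r * σ)) * (x * ρ)) + σ * σ * (ρ * ρ)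
        pointwise = solve-∀ ring
        final : ∀ r σ Φ → r * (σ * σ) + ((r * r * Φ + (- (r * σ + r * σ)) * σ) + σ * σ * r) ≡ r * (r * Φ)
        final = solve-∀ ring
        expand : ∑ᵥ (λ v → (r * X v - σ * ρ v) * (r * X v - σ * ρ v))
                 ≡ (r * r * Φ + (- (r * σ + r * σ)) * σ) + σ * σ * r
        expand = begin
          ∑ᵥ (λ v → (r * X v - σ * ρ v) * (r * X v - σ * ρ v))
            ≡⟨ ∑-cong V (λ v → trans (pointwise r (X v) σ (ρ v))
                 (cong₂ (λ p q → (r * r * (X v * X v) + (- (r * σ + r * σ)) * p) + σ * σ * q) (Xρ v) (ρ-idem v))) ⟩
          ∑ᵥ (λ v → (r * r * (X v * X v) + (- (r * σ + r * σ)) * X v) + σ * σ * ρ v)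
            ≡⟨ ∑-+ V (λ v → r * r * (X v * X v) + (- (r * σ + r * σ)) * X v) (λ v → σ * σ * ρ v) ⟩
          ∑ᵥ (λ v → r * r * (X v * X v) + (- (r * σ + r * σ)) * X v) + ∑ᵥ (λ v → σ * σ * ρ v)
            ≡⟨ cong₂ _+_ (∑-+ V (λ v → r * r * (X v * X v)) (λ v → (- (r * σ + r * σ)) * X v))
                         (∑-*ˡ V (σ * σ) ρ) ⟩
          (∑ᵥ (λ v → r * r * (X v * X v)) + ∑ᵥ (λ v → (- (r * σ + r * σ)) * X v)) + σ * σ * r
            ≡⟨ cong (_+ σ * σ * r) (cong₂ _+_ (∑-*ˡ V (r * r) (λ v → X v * X v))
                                             (∑-*ˡ V (- (r * σ + r * σ)) X)) ⟩
          (r * r * Φ + (- (r * σ + r * σ)) * σ) + σ * σ * r ∎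
          where open ≡-Reasoning

      m*t : m * t ≡ σ + a * r
      m*t = begin
        m * t                          ≡⟨ ∑-*ʳ E t (λ _ → 1ℚ) ⟨
        ∑ E (λ _ → 1ℚ * t)             ≡⟨ ∑-cong-∈ E (λ f∈ → trans (*-identityˡ t) (sym (uniform f∈))) ⟩
        ∑ E (λ f → ∑ᵥ (ι f))           ≡⟨ ∑-swap E V ι ⟩
        ∑ᵥ d                           ≡⟨ ∑-cong V d≡ ⟩
        ∑ᵥ (λ v → X v + a * ρ v)       ≡⟨ ∑-+ V X (λ v → a * ρ v) ⟩
        σ + ∑ᵥ (λ v → a * ρ v)         ≡⟨ cong (σ +_) (∑-*ˡ V a ρ) ⟩
        σ + a * r ∎
        where open ≡-Reasoning

      private
        ΣdX² = ∑ᵥ (λ v → d v * (X v * X v))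

      L≡ : ∀ e v → L e v ≡ hits e v - ι e v * d v
      L≡ e v = begin
        ∑ᵥ (λ u → ι e u * ((1ℚ - δ u v) * cod u v))
          ≡⟨ ∑-cong V (λ u → trans (pointwise (ι e u) (δ u v) (cod u v))
                (cong (λ p → ι e u * cod u v + (- 1ℚ) * p) (cong (_* (ι e u * cod u v)) (δ-sym u v)))) ⟩
        ∑ᵥ (λ u → ι e u * cod u v + (- 1ℚ) * (δ v u * (ι e u * cod u v)))
          ≡⟨ ∑-+ V (λ u → ι e u * cod u v) (λ u → (- 1ℚ) * (δ v u * (ι e u * cod u v))) ⟩
        hits e v + ∑ᵥ (λ u → (- 1ℚ) * (δ v u * (ι e u * cod u v)))
          ≡⟨ cong (hits e v +_)
               (trans (∑-*ˡ V (- 1ℚ) (λ u → δ v u * (ι e u * cod u v)))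
                      (cong ((- 1ℚ) *_) (∑-δ v (λ u → ι e u * cod u v)))) ⟩
        hits e v + (- 1ℚ) * (ι e v * cod v v)
          ≡⟨ cong (λ p → hits e v + (- 1ℚ) * (ι e v * p))
                  (∑-cong E (λ f → ι-idem f v)) ⟩
        hits e v + (- 1ℚ) * (ι e v * d v)
          ≡⟨ final (hits e v) (ι e v * d v) ⟩
        hits e v - ι e v * d v ∎
        where
        open ≡-Reasoning
        pointwise : ∀ x y z → x * ((1ℚ - y) * z) ≡ x * z + (- 1ℚ) * (y * (x * z))
        pointwise = solve-∀ ring
        final : ∀ x y → x + (- 1ℚ) * y ≡ x - y
        final = solve-∀ ring

      -- An edge `f` through `v` is met, at each of its vertices `u`, by `d u` edges, which yields
      -- the sum of `D f`; the excluded terms `u = v` account for the square of `d v`.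
      ∑L : ∀ v → ∑ E (λ e → L e v) ≡ ∑ιD v - d v * d v
      ∑L v = begin
        ∑ E (λ e → L e v)
          ≡⟨ ∑-cong E (λ e → trans (L≡ e v) (final (hits e v) (ι e v) (d v))) ⟩
        ∑ E (λ e → hits e v + ι e v * (- d v))
          ≡⟨ ∑-+ E (λ e → hits e v) (λ e → ι e v * (- d v)) ⟩
        ∑ E (λ e → hits e v) + ∑ E (λ e → ι e v * (- d v))
          ≡⟨ cong₂ _+_ main (∑-*ʳ E (- d v) (λ e → ι e v)) ⟩
        ∑ιD v + d v * (- d v)
          ≡⟨ fin (∑ιD v) (d v) ⟩
        ∑ιD v - d v * d v ∎
        where
        open ≡-Reasoning
        final : ∀ x y z → x - y * z ≡ x + y * (- z)
        final = solve-∀ ring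
        fin : ∀ x y → x + y * (- y) ≡ x - y * y
        fin = solve-∀ ring
        rot : ∀ x y z → x * (y * z) ≡ z * (y * x)
        rot = solve-∀ ring
        main : ∑ E (λ e → hits e v) ≡ ∑ιD v
        main = begin
          ∑ E (λ e → hits e v) ≡⟨ ∑-swap E V (λ e u → ι e u * cod u v) ⟩
          ∑ᵥ (λ u → ∑ E (λ e → ι e u * cod u v)) ≡⟨ ∑-cong V (λ u → ∑-*ʳ E (cod u v) (λ e → ι e u)) ⟩
          ∑ᵥ (λ u → d u * cod u v)
            ≡⟨ ∑-cong V (λ u → sym (∑-*ˡ E (d u) (λ f → ι f u * ι f v))) ⟩
          ∑ᵥ (λ u → ∑ E (λ f → d u * (ι f u * ι f v)))
            ≡⟨ ∑-swap V E (λ u f → d u * (ι f u * ι f v)) ⟩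
          ∑ E (λ f → ∑ᵥ (λ u → d u * (ι f u * ι f v)))
            ≡⟨ ∑-cong E (λ f → trans (∑-cong V (λ u → rot (d u) (ι f u) (ι f v)))
                                     (∑-*ˡ V (ι f v) (λ u → ι f u * d u))) ⟩
          ∑ιD v ∎

      D≡ : ∀ {f} → f ∈ E → D f ≡ XF f + a * t
      D≡ {f} f∈ = begin
        ∑ᵥ (λ u → ι f u * d u)
          ≡⟨ ∑-cong V (λ u → trans (cong (ι f u *_) (d≡ u)) (trans (pw (ι f u) (X u) a (ρ u))
               (cong (λ p → ι f u * X u + a * p) (ι-live f∈ u)))) ⟩
        ∑ᵥ (λ u → ι f u * X u + a * ι f u) ≡⟨ ∑-+ V (λ u → ι f u * X u) (λ u → a * ι f u) ⟩
        XF f + ∑ᵥ (λ u → a * ι f u) ≡⟨ cong (XF f +_) (trans (∑-*ˡ V a (ι f)) (cong (a *_) (uniform f∈))) ⟩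
        XF f + a * t ∎
        where
        open ≡-Reasoning
        pw : ∀ i x a ρ → i * (x + a * ρ) ≡ i * x + a * (i * ρ)
        pw = solve-∀ ring

      private
        ΣXd ΣXd² ΣXF² S₁ : ℚ
        ΣXd  = ∑ᵥ (λ v → X v * d v)
        ΣXd² = ∑ᵥ (λ v → X v * (d v * d v))
        ΣXF² = ∑ E (λ f → XF f * XF f)
        S₁   = ∑ E (λ e → ∑ᵥ (λ v → X v * L e v))

      ΣXd≡ : ΣXd ≡ Φ + a * σ
      ΣXd≡ = begin
        ΣXd ≡⟨ ∑-cong V (λ v → trans (cong (X v *_) (d≡ v)) (trans (pw (X v) a (ρ v))
                  (cong (λ p → X v * X v + a * p) (Xρ v)))) ⟩
        ∑ᵥ (λ v → X v * X v + a * X v) ≡⟨ ∑-+ V (λ v → X v * X v) (λ v → a * X v) ⟩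
        Φ + ∑ᵥ (λ v → a * X v) ≡⟨ cong (Φ +_) (∑-*ˡ V a X) ⟩
        Φ + a * σ ∎
        where
        open ≡-Reasoning
        pw : ∀ x a ρ → x * (x + a * ρ) ≡ x * x + a * (x * ρ)
        pw = solve-∀ ring

      ΣXd²≡ : ΣXd² ≡ ΣdX² + a * ΣXd
      ΣXd²≡ = begin
        ΣXd² ≡⟨ ∑-cong V (λ v → trans (cong (λ p → X v * (d v * p)) (d≡ v)) (trans (pw (X v) (d v) a (ρ v))
                  (cong (λ p → d v * (X v * X v) + a * (X v * p)) (dρ v)))) ⟩
        ∑ᵥ (λ v → d v * (X v * X v) + a * (X v * d v)) ≡⟨ ∑-+ V (λ v → d v * (X v * X v)) (λ v → a * (X v * d v)) ⟩
        ΣdX² + ∑ᵥ (λ v → a * (X v * d v)) ≡⟨ cong (ΣdX² +_) (∑-*ˡ V a (λ v → X v * d v)) ⟩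
        ΣdX² + a * ΣXd ∎
        where
        open ≡-Reasoning
        pw : ∀ x d a ρ → x * (d * (x + a * ρ)) ≡ d * (x * x) + a * (x * (d * ρ))
        pw = solve-∀ ring

      ∑XF : ∑ E XF ≡ ΣXd
      ∑XF = trans (∑-swap E V (λ f v → ι f v * X v)) (∑-cong V (λ v →
              trans (∑-*ʳ E (X v) (λ f → ι f v)) (*-comm (d v) (X v))))

      -- Inserting `∑L` and exchanging sums leaves the products `D f * XF f`. By `D≡` the first
      -- factor is `XF f` plus a constant, and so squares appear.
      S₁≡ : S₁ ≡ (ΣXF² + a * t * ΣXd) - ΣXd²
      S₁≡ = begin
        S₁ ≡⟨ ∑-swap E V (λ e v → X v * L e v) ⟩
        ∑ᵥ (λ v → ∑ E (λ e → X v * L e v))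
          ≡⟨ ∑-cong V (λ v → trans (∑-*ˡ E (X v) (λ e → L e v)) (trans (cong (X v *_) (∑L v))
               (pw (X v) (∑ιD v) (d v * d v)))) ⟩
        ∑ᵥ (λ v → X v * ∑ιD v + (- 1ℚ) * (X v * (d v * d v)))
          ≡⟨ ∑-+ V (λ v → X v * ∑ιD v) (λ v → (- 1ℚ) * (X v * (d v * d v))) ⟩
        ∑ᵥ (λ v → X v * ∑ιD v) + ∑ᵥ (λ v → (- 1ℚ) * (X v * (d v * d v)))
          ≡⟨ cong₂ _+_ main (∑-*ˡ V (- 1ℚ) (λ v → X v * (d v * d v))) ⟩
        (ΣXF² + a * t * ΣXd) + (- 1ℚ) * ΣXd²
          ≡⟨ fin (ΣXF² + a * t * ΣXd) ΣXd² ⟩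
        (ΣXF² + a * t * ΣXd) - ΣXd² ∎
        where
        open ≡-Reasoning
        pw : ∀ x p q → x * (p - q) ≡ x * p + (- 1ℚ) * (x * q)
        pw = solve-∀ ring
        fin : ∀ x y → x + (- 1ℚ) * y ≡ x - y
        fin = solve-∀ ring
        rot : ∀ x y z → x * (y * z) ≡ z * (y * x)
        rot = solve-∀ ring
        dist : ∀ x c → (x + c) * x ≡ x * x + c * x
        dist = solve-∀ ring
        main : ∑ᵥ (λ v → X v * ∑ιD v) ≡ ΣXF² + a * t * ΣXd
        main = begin
          ∑ᵥ (λ v → X v * ∑ιD v)
            ≡⟨ ∑-cong V (λ v → sym (∑-*ˡ E (X v) (λ f → ι f v * D f))) ⟩
          ∑ᵥ (λ v → ∑ E (λ f → X v * (ι f v * D f))) ≡⟨ ∑-swap V E (λ v f → X v * (ι f v * D f)) ⟩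
          ∑ E (λ f → ∑ᵥ (λ v → X v * (ι f v * D f)))
            ≡⟨ ∑-cong E (λ f → trans (∑-cong V (λ v → rot (X v) (ι f v) (D f))) (∑-*ˡ V (D f) (λ v → ι f v * X v))) ⟩
          ∑ E (λ f → D f * XF f)
            ≡⟨ ∑-cong-∈ E (λ {f} f∈ → trans (cong (_* XF f) (D≡ f∈)) (dist (XF f) (a * t))) ⟩
          ∑ E (λ f → XF f * XF f + a * t * XF f) ≡⟨ ∑-+ E (λ f → XF f * XF f) (λ f → a * t * XF f) ⟩
          ΣXF² + ∑ E (λ f → a * t * XF f) ≡⟨ cong (ΣXF² +_) (trans (∑-*ˡ E (a * t) XF) (cong (a * t *_) ∑XF)) ⟩
          ΣXF² + a * t * ΣXd ∎

      -- The choice b r = t (t - 1) a cancels all terms linear in σ.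
      drift≤0 : (b * m * σ + a * Φ + a * a * σ) - a * t * (Φ + a * σ) ≤ 0ℚ
      drift≤0 = *-cancelˡ-≤ 0<r (≤-by ((t - 1ℚ) * a * (r * Φ - σ * σ))
        (*≥0 (*≥0 (≤⇒0≤- 1≤t) 0≤a) (≤⇒0≤- cauchy-schwarz))
        (sym (trans (lemma₁ r b m σ a Φ t ((t - 1ℚ) * a * (r * Φ - σ * σ)))
          (trans (cong (λ p → p * m * σ + (r * (a * Φ + a * a * σ - a * t * (Φ + a * σ)) + (t - 1ℚ) * a * (r * Φ - σ * σ))) b*r)
          (trans (lemma₂ t a m σ (r * (a * Φ + a * a * σ - a * t * (Φ + a * σ)) + (t - 1ℚ) * a * (r * Φ - σ * σ)))
          (trans (cong (λ p → (t - 1ℚ) * a * p * σ + (r * (a * Φ + a * a * σ - a * t * (Φ + a * σ)) + (t - 1ℚ) * a * (r * Φ - σ * σ))) m*t)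
            (lemma₃ r σ a Φ t)))))))
        where
        lemma₁ : ∀ r b m σ a Φ t z → r * ((b * m * σ + a * Φ + a * a * σ) - a * t * (Φ + a * σ)) + z
               ≡ b * r * m * σ + (r * (a * Φ + a * a * σ - a * t * (Φ + a * σ)) + z)
        lemma₁ = solve-∀ ring
        lemma₂ : ∀ t a m σ z → t * (t - 1ℚ) * a * m * σ + z ≡ (t - 1ℚ) * a * (m * t) * σ + z
        lemma₂ = solve-∀ ring
        lemma₃ : ∀ r σ a Φ t → (t - 1ℚ) * a * (σ + a * r) * σ
                  + (r * (a * Φ + a * a * σ - a * t * (Φ + a * σ)) + (t - 1ℚ) * a * (r * Φ - σ * σ)) ≡ r * 0ℚ
        lemma₃ = solve-∀ ring

      -- Expanding by `S₁≡` gives the sum of `d X²`, where `d ≤ B`, plus the bracket of `drift≤0`,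
      -- minus the sum of squares `ΣXF²`.
      average : ∑ E (λ e → ∑ᵥ (λ v → X v * (b * ρ v - L e v))) ≤ B * Φ
      average = ≤-trans (≤-reflexive eq₁) (≤-trans bound
        (≤-trans (+-mono-≤ ΣdX²≤ drift≤0) (≤-reflexive (+-identityʳ (B * Φ)))))
        where
        open ≡-Reasoning
        pw : ∀ x b ρ l → x * (b * ρ - l) ≡ b * (x * ρ) + (- 1ℚ) * (x * l)
        pw = solve-∀ ring
        eq₀ : ∀ e → ∑ᵥ (λ v → X v * (b * ρ v - L e v)) ≡ 1ℚ * (b * σ) + (- 1ℚ) * ∑ᵥ (λ v → X v * L e v)
        eq₀ e = begin
          ∑ᵥ (λ v → X v * (b * ρ v - L e v))
            ≡⟨ ∑-cong V (λ v → trans (pw (X v) b (ρ v) (L e v)) (cong (λ p → b * p + (- 1ℚ) * (X v * L e v)) (Xρ v))) ⟩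
          ∑ᵥ (λ v → b * X v + (- 1ℚ) * (X v * L e v)) ≡⟨ ∑-+ V (λ v → b * X v) (λ v → (- 1ℚ) * (X v * L e v)) ⟩
          ∑ᵥ (λ v → b * X v) + ∑ᵥ (λ v → (- 1ℚ) * (X v * L e v))
            ≡⟨ cong₂ _+_ (trans (∑-*ˡ V b X) (sym (*-identityˡ (b * σ)))) (∑-*ˡ V (- 1ℚ) (λ v → X v * L e v)) ⟩
          1ℚ * (b * σ) + (- 1ℚ) * ∑ᵥ (λ v → X v * L e v) ∎
        eq₁ : ∑ E (λ e → ∑ᵥ (λ v → X v * (b * ρ v - L e v))) ≡ m * (b * σ) + (- 1ℚ) * S₁
        eq₁ = begin
          ∑ E (λ e → ∑ᵥ (λ v → X v * (b * ρ v - L e v))) ≡⟨ ∑-cong E eq₀ ⟩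
          ∑ E (λ e → 1ℚ * (b * σ) + (- 1ℚ) * ∑ᵥ (λ v → X v * L e v))
            ≡⟨ ∑-+ E (λ e → 1ℚ * (b * σ)) (λ e → (- 1ℚ) * ∑ᵥ (λ v → X v * L e v)) ⟩
          ∑ E (λ e → 1ℚ * (b * σ)) + ∑ E (λ e → (- 1ℚ) * ∑ᵥ (λ v → X v * L e v))
            ≡⟨ cong₂ _+_ (∑-*ʳ E (b * σ) (λ _ → 1ℚ)) (∑-*ˡ E (- 1ℚ) (λ e → ∑ᵥ (λ v → X v * L e v))) ⟩
          m * (b * σ) + (- 1ℚ) * S₁ ∎
        total : ∀ m b σ a t Φ F S → m * (b * σ) + (- 1ℚ) * ((F + a * t * (Φ + a * σ)) - (S + a * (Φ + a * σ))) + F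
              ≡ S + ((b * m * σ + a * Φ + a * a * σ) - a * t * (Φ + a * σ))
        total = solve-∀ ring
        bound : m * (b * σ) + (- 1ℚ) * S₁ ≤ ΣdX² + ((b * m * σ + a * Φ + a * a * σ) - a * t * (Φ + a * σ))
        bound = ≤-by ΣXF² (∑-nonneg E (λ f → sq≥0 (XF f))) (sym (trans
          (cong (λ p → m * (b * σ) + (- 1ℚ) * p + ΣXF²) (trans S₁≡ (trans
            (cong (λ p → (ΣXF² + a * t * ΣXd) - p) ΣXd²≡)
            (cong (λ p → (ΣXF² + a * t * p) - (ΣdX² + a * p)) ΣXd≡))))
          (total m b σ a t Φ ΣXF² ΣdX²)))
        ΣdX²≤ : ΣdX² ≤ B * Φ
        ΣdX²≤ = ≤-trans (∑-mono V (λ v → *-monoʳ (sq≥0 (X v)) (d≤B v)))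
                        (≤-reflexive (∑-*ˡ V B (λ v → X v * X v)))

      0≤d : ∀ v → 0ℚ ≤ d v
      0≤d v = ∑-nonneg E (λ f → ι-nonneg f v)

      0≤cod : ∀ u v → 0ℚ ≤ cod u v
      0≤cod u v = ∑-nonneg E (λ f → *≥0 (ι-nonneg f u) (ι-nonneg f v))

      0≤A≤1 : ∀ u v → 0ℚ ≤ A u v × A u v ≤ 1ℚ
      0≤A≤1 u v with u Fin.≟ v
      ... | yes _  = ≤-reflexive (sym (zero-case (cod u v))) , ≤-trans (≤-reflexive (zero-case (cod u v))) 0≤1
        where
        zero-case : ∀ c → (1ℚ - 1ℚ) * c ≡ 0ℚ
        zero-case = solve-∀ ring
      ... | no u≢v = ≤-trans (0≤cod u v) (≤-reflexive (sym (one-case (cod u v))))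
                   , ≤-trans (≤-reflexive (one-case (cod u v))) (cod≤1 u≢v)
        where
        one-case : ∀ c → (1ℚ - 0ℚ) * c ≡ c
        one-case = solve-∀ ring

      A≤cod : ∀ u v → A u v ≤ cod u v
      A≤cod u v = ≤-by (δ u v * cod u v) (*≥0 (δ-nonneg u v) (0≤cod u v)) (lemma (δ u v) (cod u v))
        where
        lemma : ∀ x c → c ≡ (1ℚ - x) * c + x * c
        lemma = solve-∀ ring

      0≤L : ∀ e v → 0ℚ ≤ L e v
      0≤L e v = ∑-nonneg V (λ u → *≥0 (ι-nonneg e u) (proj₁ (0≤A≤1 u v)))

      L≤t : ∀ {e} → e ∈ E → ∀ v → L e v ≤ t
      L≤t {e} e∈ v = ≤-trans
        (∑-mono V (λ u → *-monoˡ (ι-nonneg e u) (proj₂ (0≤A≤1 u v))))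
        (≤-reflexive (trans (∑-cong V (λ u → *-identityʳ (ι e u))) (uniform e∈)))

      ∑cod : ∀ u → ∑ᵥ (cod u) ≡ t * d u
      ∑cod u = begin
        ∑ᵥ (λ v → ∑ E (λ f → ι f u * ι f v)) ≡⟨ ∑-swap V E (λ v f → ι f u * ι f v) ⟩
        ∑ E (λ f → ∑ᵥ (λ v → ι f u * ι f v))
          ≡⟨ ∑-cong-∈ E (λ {f} f∈ → trans (∑-*ˡ V (ι f u) (ι f)) (trans (cong (ι f u *_) (uniform f∈)) (*-comm (ι f u) t))) ⟩
        ∑ E (λ f → t * ι f u) ≡⟨ ∑-*ˡ E t (λ f → ι f u) ⟩
        t * d u ∎
        where open ≡-Reasoning

      -- Each of the `t` vertices `u` of `e` contributes at most the total codegree at `u`, which is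
      -- `t * d u`. So a removal causes a total loss bounded independently of the number of
      -- vertices.
      ∑L≤ : ∀ {e} → e ∈ E → ∑ᵥ (L e) ≤ t * (t * B)
      ∑L≤ {e} e∈ = begin
        ∑ᵥ (λ v → ∑ᵥ (λ u → ι e u * A u v)) ≡⟨ ∑-swap V V (λ v u → ι e u * A u v) ⟩
        ∑ᵥ (λ u → ∑ᵥ (λ v → ι e u * A u v)) ≡⟨ ∑-cong V (λ u → ∑-*ˡ V (ι e u) (A u)) ⟩
        ∑ᵥ (λ u → ι e u * ∑ᵥ (A u))
          ≤⟨ ∑-mono V (λ u → *-monoˡ (ι-nonneg e u) (≤-trans (∑-mono V (A≤cod u))
               (≤-trans (≤-reflexive (∑cod u)) (*-monoˡ 0≤t (d≤B u))))) ⟩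
        ∑ᵥ (λ u → ι e u * (t * B)) ≡⟨ ∑-*ʳ V (t * B) (ι e) ⟩
        ∑ᵥ (ι e) * (t * B) ≡⟨ cong (_* (t * B)) (uniform e∈) ⟩
        t * (t * B) ∎
        where open ≤-Reasoning

      ∑L²≤ : ∀ {e} → e ∈ E → ∑ᵥ (λ v → L e v * L e v) ≤ t * (t * (t * B))
      ∑L²≤ {e} e∈ = begin
        ∑ᵥ (λ v → L e v * L e v) ≤⟨ ∑-mono V (λ v → *-monoʳ (0≤L e v) (L≤t e∈ v)) ⟩
        ∑ᵥ (λ v → t * L e v)     ≡⟨ ∑-*ˡ V t (L e) ⟩
        t * ∑ᵥ (L e)             ≤⟨ *-monoˡ 0≤t (∑L≤ e∈) ⟩
        t * (t * (t * B)) ∎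
        where open ≤-Reasoning

      W : Subset n → ℚ
      W e = ∑ᵥ (λ v → (X v + (b * ρ v - L e v)) * (X v + (b * ρ v - L e v)))

      κ : ℚ
      κ = (b * b * r + b * b * r) + (t * (t * (t * B)) + t * (t * (t * B)))

      W≤ : ∀ {e} → e ∈ E → let F = ∑ᵥ (λ v → X v * (b * ρ v - L e v)) in W e ≤ (Φ + (F + F)) + κ
      W≤ {e} e∈ = begin
        -- The square of the increment `b ρ - L` is at most `2 (b ρ)² + 2 L²`, the difference being
        -- the square of `b ρ + L`.
        W e ≤⟨ ∑-mono V (λ v → ≤-by ((b * ρ v + L e v) * (b * ρ v + L e v)) (sq≥0 (b * ρ v + L e v))
                 (trans (cong (λ p → (X v * X v + (xp v + xp v)) + ((b * b * p + b * b * p) + (ll v + ll v))) (sym (ρ-idem v)))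
                        (pw (X v) b (ρ v) (L e v)))) ⟩
        ∑ᵥ (λ v → (X v * X v + (xp v + xp v)) + ((b * b * ρ v + b * b * ρ v) + (ll v + ll v)))
          ≡⟨ trans (∑-+ V (λ v → X v * X v + (xp v + xp v)) (λ v → (b * b * ρ v + b * b * ρ v) + (ll v + ll v)))
               (cong₂ _+_ (trans (∑-+ V (λ v → X v * X v) (λ v → xp v + xp v)) (cong (Φ +_) (∑-+ V xp xp)))
                 (trans (∑-+ V (λ v → b * b * ρ v + b * b * ρ v) (λ v → ll v + ll v))
                   (cong₂ _+_ (trans (∑-+ V (λ v → b * b * ρ v) (λ v → b * b * ρ v))
                                     (cong₂ _+_ (∑-*ˡ V (b * b) ρ) (∑-*ˡ V (b * b) ρ)))
                              (∑-+ V ll ll)))) ⟩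
        (Φ + (F + F)) + ((b * b * r + b * b * r) + (∑ᵥ ll + ∑ᵥ ll))
          ≤⟨ +-monoʳ-≤ (Φ + (F + F)) (+-monoʳ-≤ (b * b * r + b * b * r) (+-mono-≤ (∑L²≤ e∈) (∑L²≤ e∈))) ⟩
        (Φ + (F + F)) + κ ∎
        where
        open ≤-Reasoning
        xp ll : Fin n → ℚ
        xp v = X v * (b * ρ v - L e v)
        ll v = L e v * L e v
        F = ∑ᵥ xp
        pw : ∀ x b ρ l → (x * x + (x * (b * ρ - l) + x * (b * ρ - l))) + ((b * b * (ρ * ρ) + b * b * (ρ * ρ)) + (l * l + l * l))
           ≡ (x + (b * ρ - l)) * (x + (b * ρ - l)) + (b * ρ + l) * (b * ρ + l)
        pw = solve-∀ ring

      -- Averaged over the `m` edges, the doubled first-order term is at most `2 B Φ / m`, hence at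
      -- most `g Φ`; `κ` bounds the second-order term for each edge separately.
      exists-good : B + B ≤ m * g → E ≢ [] → ∃[ e ] (e ∈ E × W e ≤ (Φ + g * Φ) + κ)
      exists-good 2B≤m*g E≢[] = ∑-exists-≤′ E E≢[] (begin
        ∑ E W ≤⟨ ∑-mono-∈ E W≤ ⟩
        ∑ E (λ e → (Φ + (F e + F e)) + κ)
          ≡⟨ trans (∑-cong E (λ e → split Φ (F e) κ)) (trans (∑-+ E (λ _ → 1ℚ * (Φ + κ)) (λ e → F e + F e))
               (cong₂ _+_ (∑-*ʳ E (Φ + κ) (λ _ → 1ℚ)) (∑-+ E F F))) ⟩
        m * (Φ + κ) + (∑ E F + ∑ E F) ≤⟨ +-monoʳ-≤ (m * (Φ + κ)) (+-mono-≤ average average) ⟩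
        m * (Φ + κ) + (B * Φ + B * Φ) ≡⟨ cong (m * (Φ + κ) +_) (*-distribʳ-+ Φ B B) ⟨
        m * (Φ + κ) + (B + B) * Φ ≤⟨ +-monoʳ-≤ (m * (Φ + κ)) (*-monoʳ (∑-nonneg V (λ v → sq≥0 (X v))) 2B≤m*g) ⟩
        m * (Φ + κ) + m * g * Φ ≡⟨ merge m Φ κ g ⟩
        m * ((Φ + g * Φ) + κ) ≡⟨ ∑-*ʳ E ((Φ + g * Φ) + κ) (λ _ → 1ℚ) ⟨
        ∑ E (λ _ → 1ℚ * ((Φ + g * Φ) + κ)) ≡⟨ ∑-cong E (λ _ → *-identityˡ ((Φ + g * Φ) + κ)) ⟩
        ∑ E (λ _ → (Φ + g * Φ) + κ) ∎)
        where
        open ≤-Reasoning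
        F : Subset n → ℚ
        F e = ∑ᵥ (λ v → X v * (b * ρ v - L e v))
        split : ∀ p f k → (p + (f + f)) + k ≡ 1ℚ * (p + k) + (f + f)
        split = solve-∀ ring
        merge : ∀ m p k g → m * (p + k) + m * g * p ≡ m * ((p + g * p) + k)
        merge = solve-∀ ring

-- The actual effect of removing an edge together with all edges it meets.

module EdgeRemoval where

  open import Data.Fin.Subset using (_─_)
  open import Data.Fin.Subset.Properties using (x∈p∩q⁺)
  open import Data.Nat as ℕ using (ℕ; zero; suc; z≤n; s≤s)
  import Data.Nat.Properties as ℕ
  open import Data.Rational using (ℚ; 0ℚ; 1ℚ; _+_; _*_; -_; _-_; _≤_)
  open import Data.Rational.Properties
  open import Data.Vec using (lookup; here; there) renaming (_∷_ to _∷ᵥ_)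
  open Numbers
  open SetFamilies
  open PotentialDrift

  open Rationals

  private variable n : ℕ

  ⟦∑⟧ : ∀ {X : Set} (xs : List X) (f : X → ℕ) → ⟦ ∑ℕ.∑ xs f ⟧ ≡ ∑ℚ.∑ xs (λ x → ⟦ f x ⟧)
  ⟦∑⟧ []       f = refl
  ⟦∑⟧ (x ∷ xs) f = trans (⟦⟧-+ (f x) (∑ℕ.∑ xs f)) (cong (⟦ f x ⟧ +_) (⟦∑⟧ xs f))

  ⟦1⟧ : ⟦ 1 ⟧ ≡ 1ℚ
  ⟦1⟧ = +-identityʳ 1ℚ

  ⟦ι⟧ : ∀ (S : Subset n) v → ⟦ ∑ℕ.ι S v ⟧ ≡ ∑ℚ.ι S v
  ⟦ι⟧ S v with lookup S v
  ... | true  = ⟦1⟧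
  ... | false = refl

  ⟦∣∣⟧ : ∀ (S : Subset n) → ⟦ ∣ S ∣ ⟧ ≡ ∑ℚ.∑ᵥ (∑ℚ.ι S)
  ⟦∣∣⟧ S = trans (cong ⟦_⟧ (∣∣≡∑ S)) (trans (⟦∑⟧ (allFin _) (∑ℕ.ι S)) (∑ℚ.∑-cong (allFin _) (⟦ι⟧ S)))

  open ∑ℚ

  ιℚ-∉ : ∀ {S : Subset n} {v} → v ∉ₛ S → ι S v ≡ 0ℚ
  ιℚ-∉ {S = S} {v} v∉ = trans (sym (⟦ι⟧ S v)) (cong ⟦_⟧ (ι-∉ v∉))

  disjointFrom : (e : Subset n) → List (Subset n) → List (Subset n)
  disjointFrom e = filter (λ f → ∣ e ∩ f ∣ ℕ.≟ 0)

  ∣∩∣≡0⇒∉ : ∀ {e f : Subset n} → ∣ e ∩ f ∣ ≡ 0 → ∀ {v} → v ∈ₛ e → v ∉ₛ f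
  ∣∩∣≡0⇒∉ {e = e} {f} eq {v} v∈e v∈f = ι-0 {S = e ∩ f} zero-at-v (x∈p∩q⁺ (v∈e , v∈f))
    where
    zero-at-v : ∑ℕ.ι (e ∩ f) v ≡ 0
    zero-at-v = ℕ.n≤0⇒n≡0 (ℕ.≤-trans (∑ℕ.∑-term (allFin _) (λ _ → z≤n) (∈-allFin v))
                                      (ℕ.≤-reflexive (trans (sym (∣∣≡∑ (e ∩ f))) eq)))

  ∈-─⁻ : ∀ {n} (p : Subset n) {q v} → v ∈ₛ p ─ q → v ∈ₛ p × v ∉ₛ q
  ∈-─⁻ (p ∷ᵥ ps) {true ∷ᵥ qs} (there v∈) =
    let (v∈p , v∉q) = ∈-─⁻ ps v∈ in there v∈p , λ { (there v∈q) → v∉q v∈q }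
  ∈-─⁻ (p ∷ᵥ ps) {false ∷ᵥ qs} here = here , λ ()
  ∈-─⁻ (p ∷ᵥ ps) {false ∷ᵥ qs} (there v∈) =
    let (v∈p , v∉q) = ∈-─⁻ ps v∈ in there v∈p , λ { (there v∈q) → v∉q v∈q }

  module Removal (E : List (Subset n)) (R : Subset n) (t : ℕ) (a b B g : ℚ)
    (linear : AlmostDisjoint E) (e : Subset n) (e∈ : e ∈ E) where

    private
      module Old = RemovalStep E (ι R) ⟦ t ⟧ a b B g
      E′ = disjointFrom e E
      R′ = R ─ e
      module New = RemovalStep E′ (ι R′) ⟦ t ⟧ (a - b) b B g

    meet : Subset n → ℚ
    meet f = ∑ᵥ (λ u → ι e u * ι f u)

    meet≡ : ∀ f → meet f ≡ ⟦ ∣ e ∩ f ∣ ⟧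
    meet≡ f = sym (trans (⟦∣∣⟧ (e ∩ f)) (∑-cong (allFin _) (λ u →
      trans (sym (⟦ι⟧ (e ∩ f) u)) (trans (cong ⟦_⟧ (ι-∩ e f u))
        (trans (⟦⟧-* (∑ℕ.ι e u) (∑ℕ.ι f u)) (cong₂ _*_ (⟦ι⟧ e u) (⟦ι⟧ f u)))))))

    private
      -- By almost disjointness `meet f` is 0 or 1 unless `f` equals `e`, and then `f` misses `v`.
      -- So `meet f` serves as the indicator that `f` disappears, and degrees change linearly in it.
      dies-or-stays : ∀ {v} → v ∉ₛ e → ∀ {f} → f ∈ E →
        (if does (∣ e ∩ f ∣ ℕ.≟ 0) then ι f v else 0ℚ) + ι f v * meet f ≡ ι f v
      dies-or-stays {v} v∉e {f} f∈ rewrite meet≡ f with v ∈? f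
      ... | no v∉f rewrite ιℚ-∉ v∉f with does (∣ e ∩ f ∣ ℕ.≟ 0)
      ...   | true  = trans (+-identityˡ (0ℚ * ⟦ ∣ e ∩ f ∣ ⟧)) (*-zeroˡ ⟦ ∣ e ∩ f ∣ ⟧)
      ...   | false = trans (+-identityˡ (0ℚ * ⟦ ∣ e ∩ f ∣ ⟧)) (*-zeroˡ ⟦ ∣ e ∩ f ∣ ⟧)
      dies-or-stays {v} v∉e {f} f∈ | yes v∈f with almostDisjoint-∈ linear e∈ f∈
      ... | inj₁ refl = ⊥-elim (v∉e v∈f)
      ... | inj₂ ≤1 = cases (∣ e ∩ f ∣) ≤1
        where
        cases : ∀ j → j ℕ.≤ 1 → (if does (j ℕ.≟ 0) then ι f v else 0ℚ) + ι f v * ⟦ j ⟧ ≡ ι f v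
        cases zero    _ = trans (cong (ι f v +_) (*-zeroʳ (ι f v))) (+-identityʳ (ι f v))
        cases (suc zero) _ = trans (+-identityˡ (ι f v * ⟦ 1 ⟧))
                                   (trans (cong (ι f v *_) ⟦1⟧) (*-identityʳ (ι f v)))
        cases (suc (suc _)) (s≤s ())

      ι-R′-∈ : ∀ {v} → v ∈ₛ e → ι R′ v ≡ 0ℚ
      ι-R′-∈ {v} v∈e = ιℚ-∉ {S = R′} (λ v∈R′ → proj₂ (∈-─⁻ R v∈R′) v∈e)

      lookup-─ : ∀ {n} (p q : Subset n) {v} → v ∉ₛ q → lookup (p ─ q) v ≡ lookup p v
      lookup-─ (_ ∷ᵥ p) (true ∷ᵥ q) {Fin.zero} v∉q = ⊥-elim (v∉q here)
      lookup-─ (_ ∷ᵥ p) (false ∷ᵥ q) {Fin.zero} v∉q = refl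
      lookup-─ (_ ∷ᵥ p) (true ∷ᵥ q) {Fin.suc v} v∉q = lookup-─ p q (λ v∈ → v∉q (there v∈))
      lookup-─ (_ ∷ᵥ p) (false ∷ᵥ q) {Fin.suc v} v∉q = lookup-─ p q (λ v∈ → v∉q (there v∈))

      X′-∈ : ∀ {v} → v ∈ₛ e → New.X v ≡ 0ℚ
      X′-∈ {v} v∈e = trans (cong₂ (λ p q → p - (a - b) * q) d′≡0 (ι-R′-∈ v∈e)) (lemma (a - b))
        where
        lemma : ∀ p → 0ℚ - p * 0ℚ ≡ 0ℚ
        lemma = solve-∀ ring
        d′≡0 : New.d v ≡ 0ℚ
        d′≡0 = trans (∑-cong-∈ E′ (λ {f} f∈ → ιℚ-∉ (∣∩∣≡0⇒∉ {e = e}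
                 (proj₂ (∈-filter⁻ (λ f → ∣ e ∩ f ∣ ℕ.≟ 0) {xs = E} f∈)) v∈e))) (∑-zero E′)

      module _ (ι-live : ∀ {f} → f ∈ E → ∀ v → ι f v * ι R v ≡ ι f v)
               (L≡ : ∀ v → Old.L e v ≡ Old.hits e v - ι e v * Old.d v) where

        d′+L : ∀ {v} → v ∉ₛ e → New.d v + Old.L e v ≡ Old.d v
        d′+L {v} v∉e = begin
          New.d v + Old.L e v
            ≡⟨ cong₂ _+_ (∑-filter (λ f → ∣ e ∩ f ∣ ℕ.≟ 0) E (λ f → ι f v)) L′ ⟩
          ∑ E (λ f → if does (∣ e ∩ f ∣ ℕ.≟ 0) then ι f v else 0ℚ) + ∑ E (λ f → ι f v * meet f)
            ≡⟨ ∑-+ E (λ f → if does (∣ e ∩ f ∣ ℕ.≟ 0) then ι f v else 0ℚ) (λ f → ι f v * meet f) ⟨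
          ∑ E (λ f → (if does (∣ e ∩ f ∣ ℕ.≟ 0) then ι f v else 0ℚ) + ι f v * meet f)
            ≡⟨ ∑-cong-∈ E (dies-or-stays v∉e) ⟩
          Old.d v ∎
          where
          open ≡-Reasoning
          rot : ∀ x y z → x * (y * z) ≡ z * (x * y)
          rot = solve-∀ ring
          fin : ∀ x y → x - 0ℚ * y ≡ x
          fin = solve-∀ ring
          L′ : Old.L e v ≡ ∑ E (λ f → ι f v * meet f)
          L′ = begin
            Old.L e v ≡⟨ L≡ v ⟩
            Old.hits e v - ι e v * Old.d v
              ≡⟨ cong (λ p → Old.hits e v - p * Old.d v) (ιℚ-∉ v∉e) ⟩
            Old.hits e v - 0ℚ * Old.d v ≡⟨ fin (Old.hits e v) (Old.d v) ⟩
            Old.hits e v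
              ≡⟨ ∑-cong (allFin _) (λ u → sym (∑-*ˡ E (ι e u) (λ f → ι f u * ι f v))) ⟩
            ∑ᵥ (λ u → ∑ E (λ f → ι e u * (ι f u * ι f v)))
              ≡⟨ ∑-swap (allFin _) E (λ u f → ι e u * (ι f u * ι f v)) ⟩
            ∑ E (λ f → ∑ᵥ (λ u → ι e u * (ι f u * ι f v)))
              ≡⟨ ∑-cong E (λ f → trans (∑-cong (allFin _) (λ u → rot (ι e u) (ι f u) (ι f v)))
                                       (∑-*ˡ (allFin _) (ι f v) (λ u → ι e u * ι f u))) ⟩
            ∑ E (λ f → ι f v * meet f) ∎

        X′-∉ : ∀ {v} → v ∉ₛ e → New.X v ≡ Old.X v + (b * ι R v - Old.L e v)
        X′-∉ {v} v∉e = trans (cong (λ s → New.d v - (a - b) * (if s then 1ℚ else 0ℚ)) (lookup-─ R e v∉e))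
          (trans (lemma (New.d v) (Old.L e v) a b (ι R v))
            (cong (λ p → (p - a * ι R v) + (b * ι R v - Old.L e v)) (d′+L v∉e)))
          where
          lemma : ∀ d l a b ρ → d - (a - b) * ρ ≡ ((d + l) - a * ρ) + (b * ρ - l)
          lemma = solve-∀ ring

    -- Outside `e` the new deviation is exactly the predicted one. On `e` it is zero, because these
    -- vertices lose all their edges and leave the uncovered set.
    Φ-removal : (∀ {f} → f ∈ E → ∀ v → ι f v * ι R v ≡ ι f v) →
      (∀ v → Old.L e v ≡ Old.hits e v - ι e v * Old.d v) →
      New.Φ ≤ ∑ᵥ (λ v → (Old.X v + (b * ι R v - Old.L e v)) * (Old.X v + (b * ι R v - Old.L e v)))
    Φ-removal ι-live L≡ = ∑-mono (allFin _) pointwise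
      where
      pointwise : ∀ v → New.X v * New.X v ≤ (Old.X v + (b * ι R v - Old.L e v)) * (Old.X v + (b * ι R v - Old.L e v))
      pointwise v with v ∈? e
      ... | yes v∈e = ≤-trans (≤-reflexive (trans (cong₂ _*_ (X′-∈ v∈e) (X′-∈ v∈e)) (*-zeroˡ 0ℚ)))
                              (sq≥0 (Old.X v + (b * ι R v - Old.L e v)))
      ... | no v∉e  = ≤-reflexive (cong₂ _*_ (X′-∉ ι-live L≡ v∉e) (X′-∉ ι-live L≡ v∉e))

-- Nearly perfect matchings by greedy removal.

module NearPerfectMatching where

  open import Data.Fin.Subset using (_─_; ⊤)
  open import Data.Fin.Subset.Properties using (∈⊤; p─q⊆p; x∈p∧x∉q⇒x∈p─q; ∣⊤∣≡n)
  import Data.List.Relation.Unary.AllPairs.Properties as AllPairs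
  open import Data.Nat as ℕ using (ℕ; zero; suc; z≤n; s≤s)
  import Data.Nat.Properties as ℕ
  open import Data.Rational as ℚ using (ℚ; 0ℚ; 1ℚ; _+_; _*_; -_; _-_; _≤_; _<_; 1/_; NonZero; positive)
  open import Data.Rational.Properties
  open import Data.Vec using (here; there; [])
  open import Data.Vec.Properties using ([]=⇒lookup)
  open Numbers
  open SetFamilies
  open PotentialDrift
  open Powers
  open EdgeRemoval

  open Rationals
  open ∑ℚ

  inverse : ∀ {p} → 0ℚ < p → ∃[ s ] (s * p ≡ 1ℚ × 0ℚ ≤ s)
  inverse {p} 0<p = 1/ p , *-inverseˡ p , <⇒≤ (positive⁻¹ (1/ p) {{1/pos⇒pos p {{positive 0<p}}}})
    where
    instance
      p≢0 : NonZero p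
      p≢0 = pos⇒nonZero p {{positive 0<p}}

  degree : ∀ {n} → List (Subset n) → Fin n → ℕ
  degree E v = ∑ℕ.∑ E (λ f → ∑ℕ.ι f v)

  Disjoint : ∀ {n} → Subset n → Subset n → Set
  Disjoint e f = ∀ {v} → v ∈ₛ e → v ∉ₛ f

  covers-step : ∀ {n} {R e : Subset n} {M} → (∀ v → v ∈ₛ R ⊎ ∃[ f ] (f ∈ M × v ∈ₛ f)) →
                ∀ v → v ∈ₛ R ─ e ⊎ ∃[ f ] (f ∈ e ∷ M × v ∈ₛ f)
  covers-step {e = e} covers v with covers v
  ... | inj₂ (f , f∈ , v∈f) = inj₂ (f , there f∈ , v∈f)
  ... | inj₁ v∈R with v ∈? e
  ...   | yes v∈e = inj₂ (e , here refl , v∈e)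
  ...   | no v∉e  = inj₁ (x∈p∧x∉q⇒x∈p─q v∈R v∉e)

  -- h bounds (1 - t²q/n)⁻ⁿ, and G/n bounds the relative growth of the potential per step.
  module Constants (t q : ℕ) where
    K c h G ζ D₁ : ℕ
    K = 2 ℕ.* t ℕ.+ 1
    c = t ℕ.* t ℕ.* q
    h = 2 ℕ.^ (4 ℕ.* c)
    G = 4 ℕ.* K ℕ.* q ℕ.* t ℕ.* h
    ζ = 2 ℕ.^ (4 ℕ.* G)
    -- Made for `D-large`: `3 D + κ̂` is at most the last bracket times `D`. The other factors are
    -- lost in `four-Φ`: `ζ` through the growth of the potential, `q` through `r ≥ n / q`, and `h`
    -- twice through `a ≥ D / h`.
    D₁ = 4 ℕ.* (h ℕ.* h) ℕ.* ζ ℕ.* q ℕ.* (4 ℕ.+ 2 ℕ.* (t ℕ.* (t ℕ.* (t ℕ.* K))))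

    -- The first summand serves `κ≤κ̂`, the others are the hypotheses `2 c ≤ n` and `2 G ≤ n` of the
    -- bounds on powers.
    n₁ : ℕ → ℕ
    n₁ D = 2 ℕ.* (t ℕ.* t ℕ.* (t ℕ.* t) ℕ.* q ℕ.* (D ℕ.* D)) ℕ.+ (2 ℕ.* c ℕ.+ 2 ℕ.* G)

  module Process (t q D n : ℕ) (1≤t : 1 ℕ.≤ t) (1≤q : 1 ℕ.≤ q) (1≤D : 1 ℕ.≤ D)
    (D₁≤D : Constants.D₁ t q ℕ.≤ D) (n₁≤n : Constants.n₁ t q D ℕ.≤ n)
    (𝒢 : List (Subset n))
    where

    open Constants t q

    T Q N Dq B H : ℚ
    T = ⟦ t ⟧
    Q = ⟦ q ⟧
    N = ⟦ n ⟧
    Dq = ⟦ D ⟧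
    B = ⟦ K ⟧ * Dq
    H = ⟦ h ⟧

    1≤c : 1 ℕ.≤ c
    1≤c = ℕ.*-mono-≤ (ℕ.*-mono-≤ 1≤t 1≤t) 1≤q

    1≤h : 1 ℕ.≤ h
    1≤h = ℕ.m^n>0 2 (4 ℕ.* c)

    1≤G : 1 ℕ.≤ G
    1≤G = ℕ.*-mono-≤ (ℕ.*-mono-≤ (ℕ.*-mono-≤ (ℕ.*-mono-≤ (s≤s {n = 3} z≤n) (ℕ.m≤n+m 1 (2 ℕ.* t))) 1≤q) 1≤t) 1≤h

    2c≤n : 2 ℕ.* c ℕ.≤ n
    2c≤n = ℕ.≤-trans (ℕ.m≤m+n (2 ℕ.* c) (2 ℕ.* G)) (ℕ.≤-trans (ℕ.m≤n+m _ (2 ℕ.* (t ℕ.* t ℕ.* (t ℕ.* t) ℕ.* q ℕ.* (D ℕ.* D)))) n₁≤n)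

    2G≤n : 2 ℕ.* G ℕ.≤ n
    2G≤n = ℕ.≤-trans (ℕ.m≤n+m (2 ℕ.* G) (2 ℕ.* c)) (ℕ.≤-trans (ℕ.m≤n+m _ (2 ℕ.* (t ℕ.* t ℕ.* (t ℕ.* t) ℕ.* q ℕ.* (D ℕ.* D)))) n₁≤n)

    1≤n : 1 ℕ.≤ n
    1≤n = ℕ.≤-trans 1≤c (ℕ.≤-trans (ℕ.m≤m+n c _) 2c≤n)

    0<N : 0ℚ < N
    0<N = ⟦⟧>0 1≤n

    ν : ℚ
    ν = proj₁ (inverse 0<N)
    ν*N : ν * N ≡ 1ℚ
    ν*N = proj₁ (proj₂ (inverse 0<N))
    0≤ν : 0ℚ ≤ ν
    0≤ν = proj₂ (proj₂ (inverse 0<N))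

    g y τ κ̂ : ℚ
    g = ⟦ G ⟧ * ν
    y = 1ℚ - ⟦ c ⟧ * ν
    τ = T * (T * (T * B))
    κ̂ = 1ℚ + (τ + τ)

    -- Upper bound for the potential after `i` removals. The recursion repeats the estimate of
    -- `exists-good` with `κ̂` for `κ`, and the initial value is the one supplied by the family of
    -- copies.
    β : ℕ → ℚ
    β zero    = ⟦ 3 ⟧ * (N * Dq)
    β (suc i) = (β i + g * β i) + κ̂

    0≤T : 0ℚ ≤ T
    0≤T = ⟦⟧≥0 t
    1≤T : 1ℚ ≤ T
    1≤T = ⟦⟧≥1 1≤t
    0≤Q : 0ℚ ≤ Q
    0≤Q = ⟦⟧≥0 q
    0≤N : 0ℚ ≤ N
    0≤N = ⟦⟧≥0 n
    0≤D : 0ℚ ≤ Dq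
    0≤D = ⟦⟧≥0 D
    0<D : 0ℚ < Dq
    0<D = ⟦⟧>0 1≤D
    0≤B : 0ℚ ≤ B
    0≤B = *≥0 (⟦⟧≥0 K) 0≤D
    0≤H : 0ℚ ≤ H
    0≤H = ⟦⟧≥0 h
    0≤g : 0ℚ ≤ g
    0≤g = *≥0 (⟦⟧≥0 G) 0≤ν
    0≤τ : 0ℚ ≤ τ
    0≤τ = *≥0 0≤T (*≥0 0≤T (*≥0 0≤T 0≤B))
    0≤κ̂ : 0ℚ ≤ κ̂
    0≤κ̂ = +≥0 0≤1 (+≥0 0≤τ 0≤τ)
    0≤y : 0ℚ ≤ y
    0≤y = ≤⇒0≤- (c*ν≤1 ν*N 0≤ν 1≤c 2c≤n)

    -- Every additive contribution `κ̂` is treated as if it had been present from the start and had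
    -- grown `i` times.
    β≤ : ∀ i → β i ≤ (1ℚ + g) ^ i * (⟦ 3 ⟧ * (N * Dq) + ⟦ i ⟧ * κ̂)
    β≤ zero    = ≤-reflexive (lemma (⟦ 3 ⟧ * (N * Dq)) κ̂)
      where
      lemma : ∀ p q → p ≡ 1ℚ * (p + 0ℚ * q)
      lemma = solve-∀ ring
    β≤ (suc i) = begin
      (β i + g * β i) + κ̂ ≡⟨ cong (_+ κ̂) (lemma₁ (β i) g) ⟩
      (1ℚ + g) * β i + κ̂ ≤⟨ +-mono-≤ (*-monoˡ 0≤1+g (β≤ i)) κ̂≤ ⟩
      (1ℚ + g) * ((1ℚ + g) ^ i * (⟦ 3 ⟧ * (N * Dq) + ⟦ i ⟧ * κ̂)) + (1ℚ + g) ^ suc i * κ̂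
        ≡⟨ lemma₂ (1ℚ + g) ((1ℚ + g) ^ i) (⟦ 3 ⟧ * (N * Dq)) ⟦ i ⟧ κ̂ ⟩
      (1ℚ + g) ^ suc i * (⟦ 3 ⟧ * (N * Dq) + ⟦ suc i ⟧ * κ̂) ∎
      where
      open ≤-Reasoning
      0≤1+g : 0ℚ ≤ 1ℚ + g
      0≤1+g = +≥0 0≤1 0≤g
      1≤1+g : 1ℚ ≤ 1ℚ + g
      1≤1+g = ≤-by g 0≤g refl
      lemma₁ : ∀ b g → b + g * b ≡ (1ℚ + g) * b
      lemma₁ = solve-∀ ring
      lemma₂ : ∀ z p a i k → z * (p * (a + i * k)) + z * p * k ≡ z * p * (a + (1ℚ + i) * k)
      lemma₂ = solve-∀ ring
      κ̂≤ : κ̂ ≤ (1ℚ + g) ^ suc i * κ̂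
      κ̂≤ = ≤-trans (≤-reflexive (sym (*-identityˡ κ̂))) (*-monoʳ 0≤κ̂ (^-≥1 1≤1+g (suc i)))

    β-bound : ∀ {i} → i ℕ.≤ n → β i ≤ ⟦ ζ ⟧ * (⟦ 3 ⟧ * (N * Dq) + N * κ̂)
    β-bound {i} i≤n = ≤-trans (β≤ i) (*-mono-≥0 (^-≥0 (+≥0 0≤1 0≤g) i)
      (+≥0 (*≥0 (⟦⟧≥0 3) (*≥0 0≤N 0≤D)) (*≥0 (⟦⟧≥0 i) 0≤κ̂))
      (power-upper ν*N 0≤ν 1≤G 2G≤n i≤n)
      (+-monoʳ-≤ (⟦ 3 ⟧ * (N * Dq)) (*-monoʳ 0≤κ̂ (⟦⟧-mono i≤n))))

    D-large : ⟦ 4 ⟧ * (H * H) * ⟦ ζ ⟧ * Q * (⟦ 3 ⟧ * Dq + κ̂) ≤ Dq * Dq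
    D-large = begin
      ⟦ 4 ⟧ * (H * H) * ⟦ ζ ⟧ * Q * (⟦ 3 ⟧ * Dq + κ̂)
        ≤⟨ *-monoˡ 0≤F (+-monoʳ-≤ (⟦ 3 ⟧ * Dq) (+-monoˡ-≤ (τ + τ) (⟦⟧≥1 1≤D))) ⟩
      ⟦ 4 ⟧ * (H * H) * ⟦ ζ ⟧ * Q * (⟦ 3 ⟧ * Dq + (Dq + (τ + τ)))
        ≡⟨ lemma (⟦ 4 ⟧ * (H * H) * ⟦ ζ ⟧ * Q) Dq T ⟦ K ⟧ ⟩
      ⟦ 4 ⟧ * (H * H) * ⟦ ζ ⟧ * Q * (⟦ 4 ⟧ + ⟦ 2 ⟧ * (T * (T * (T * ⟦ K ⟧)))) * Dq
        ≡⟨ cong (_* Dq) cast ⟨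
      ⟦ D₁ ⟧ * Dq ≤⟨ *-monoʳ 0≤D (⟦⟧-mono D₁≤D) ⟩
      Dq * Dq ∎
      where
      open ≤-Reasoning
      0≤F : 0ℚ ≤ ⟦ 4 ⟧ * (H * H) * ⟦ ζ ⟧ * Q
      0≤F = *≥0 (*≥0 (*≥0 (⟦⟧≥0 4) (*≥0 0≤H 0≤H)) (⟦⟧≥0 ζ)) 0≤Q
      lemma : ∀ F D T K → F * ((1ℚ + (1ℚ + (1ℚ + 0ℚ))) * D + (D + (T * (T * (T * (K * D))) + T * (T * (T * (K * D))))))
            ≡ F * ((1ℚ + (1ℚ + (1ℚ + (1ℚ + 0ℚ)))) + (1ℚ + (1ℚ + 0ℚ)) * (T * (T * (T * K)))) * D
      lemma = solve-∀ ring
      cast : ⟦ D₁ ⟧ ≡ ⟦ 4 ⟧ * (H * H) * ⟦ ζ ⟧ * Q * (⟦ 4 ⟧ + ⟦ 2 ⟧ * (T * (T * (T * ⟦ K ⟧))))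
      cast = trans (⟦⟧-* (4 ℕ.* (h ℕ.* h) ℕ.* ζ ℕ.* q) _) (cong₂ _*_
        (trans (⟦⟧-* (4 ℕ.* (h ℕ.* h) ℕ.* ζ) q) (cong (_* Q)
          (trans (⟦⟧-* (4 ℕ.* (h ℕ.* h)) ζ) (cong (_* ⟦ ζ ⟧) (trans (⟦⟧-* 4 (h ℕ.* h)) (cong (⟦ 4 ⟧ *_) (⟦⟧-* h h)))))))
        (trans (⟦⟧-+ 4 (2 ℕ.* (t ℕ.* (t ℕ.* (t ℕ.* K))))) (cong (⟦ 4 ⟧ +_)
          (trans (⟦⟧-* 2 (t ℕ.* (t ℕ.* (t ℕ.* K)))) (cong (⟦ 2 ⟧ *_)
            (trans (⟦⟧-* t (t ℕ.* (t ℕ.* K))) (cong (T *_) (trans (⟦⟧-* t (t ℕ.* K)) (cong (T *_) (⟦⟧-* t K))))))))))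

    -- The situation after `i` removals: `M` is the matching, `R` the uncovered set, `E` the edges
    -- still available. Besides the potential, only the two bounds on the target degree `a` are
    -- tracked; they keep it of order `D` throughout.
    record State (i : ℕ) : Set where
      field
        E M      : List (Subset n)
        R        : Subset n
        a        : ℚ
        E⊆𝒢      : ∀ {f} → f ∈ E → f ∈ 𝒢
        M⊆𝒢      : ∀ {f} → f ∈ M → f ∈ 𝒢
        live     : ∀ {f} → f ∈ E → f ⊆ R
        uniform  : ∀ {f} → f ∈ E → ∣ f ∣ ≡ t
        linear   : AlmostDisjoint E
        bounded  : ∀ v → degree E v ℕ.≤ K ℕ.* D
        disjoint : AllPairs Disjoint M
        removed  : ∀ {f} → f ∈ M → Disjoint f R
        covers   : ∀ v → v ∈ₛ R ⊎ ∃[ f ] (f ∈ M × v ∈ₛ f)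
        size     : ∣ R ∣ ℕ.+ t ℕ.* i ≡ n
        a≤D      : a ≤ Dq
        a≥       : Dq * y ^ i ≤ a
        Φ≤       : ∑ᵥ (λ v → (∑ E (λ f → ι f v) - a * ι R v) * (∑ E (λ f → ι f v) - a * ι R v)) ≤ β i

    module Advance {i : ℕ} (s : State i) (n≤qR : n ℕ.≤ q ℕ.* ∣ State.R s ∣) where
      open State s

      private
        r σ Φ m : ℚ
        r = ∑ᵥ (ι R)
        Φ = ∑ᵥ (λ v → (∑ E (λ f → ι f v) - a * ι R v) * (∑ E (λ f → ι f v) - a * ι R v))
        σ = ∑ᵥ (λ v → ∑ E (λ f → ι f v) - a * ι R v)
        m = ∑ E (λ _ → 1ℚ)

      i≤n : i ℕ.≤ n
      i≤n = begin
        i                   ≡⟨ ℕ.*-identityˡ i ⟨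
        1 ℕ.* i             ≤⟨ ℕ.*-monoˡ-≤ i 1≤t ⟩
        t ℕ.* i             ≤⟨ ℕ.m≤n+m _ ∣ R ∣ ⟩
        ∣ R ∣ ℕ.+ t ℕ.* i   ≡⟨ size ⟩
        n ∎
        where open ℕ.≤-Reasoning

      r≡ : r ≡ ⟦ ∣ R ∣ ⟧
      r≡ = sym (⟦∣∣⟧ R)

      N≤Qr : N ≤ Q * r
      N≤Qr = ≤-trans (⟦⟧-mono n≤qR) (≤-reflexive (trans (⟦⟧-* q ∣ R ∣) (cong (Q *_) (sym r≡))))

      0<r : 0ℚ < r
      0<r = subst (0ℚ <_) (sym r≡) (⟦⟧>0 (R≢∅ (∣ R ∣) n≤qR))
        where
        R≢∅ : ∀ k → n ℕ.≤ q ℕ.* k → 1 ℕ.≤ k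
        R≢∅ zero    n≤q0 = ⊥-elim (ℕ.<⇒≱ 1≤n (ℕ.≤-trans n≤q0 (ℕ.≤-reflexive (ℕ.*-zeroʳ q))))
        R≢∅ (suc k) _    = s≤s z≤n

      0≤r : 0ℚ ≤ r
      0≤r = <⇒≤ 0<r

      0≤a : 0ℚ ≤ a
      0≤a = ≤-trans (*≥0 0≤D (^-≥0 0≤y i)) a≥

      -- Each removal costs `a` at most the factor `y`, and at most `n` removals happen, so
      -- `power-lower` keeps `a` above `D / h`.
      D≤Ha : Dq ≤ H * a
      D≤Ha = begin
        Dq                  ≡⟨ *-identityʳ Dq ⟨
        Dq * 1ℚ             ≤⟨ *-monoˡ 0≤D (power-lower ν*N 0≤ν 1≤c 2c≤n i≤n) ⟩
        Dq * (H * y ^ i)    ≡⟨ rot Dq H (y ^ i) ⟩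
        H * (Dq * y ^ i)    ≤⟨ *-monoˡ 0≤H a≥ ⟩
        H * a ∎
        where
        open ≤-Reasoning
        rot : ∀ x y z → x * (y * z) ≡ y * (x * z)
        rot = solve-∀ ring

      -- The potential is at most a constant times `n D`, whereas `r a²` is at least
      -- `(n / q) (D / h)²`. The additional factor `D` decides once `D ≥ D₁`.
      four-Φ : ⟦ 4 ⟧ * Φ ≤ r * (a * a)
      four-Φ = *-cancelˡ-≤ {H * H * Q} (*>0 (*>0 0<H 0<H) (⟦⟧>0 1≤q)) (begin
        H * H * Q * (⟦ 4 ⟧ * Φ) ≤⟨ *-monoˡ 0≤HHQ (*-monoˡ (⟦⟧≥0 4) (≤-trans Φ≤ (β-bound i≤n))) ⟩
        H * H * Q * (⟦ 4 ⟧ * (⟦ ζ ⟧ * (⟦ 3 ⟧ * (N * Dq) + N * κ̂)))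
          ≡⟨ lemma₁ H Q ⟦ 4 ⟧ ⟦ ζ ⟧ ⟦ 3 ⟧ N Dq κ̂ ⟩
        N * (⟦ 4 ⟧ * (H * H) * ⟦ ζ ⟧ * Q * (⟦ 3 ⟧ * Dq + κ̂)) ≤⟨ *-monoˡ 0≤N D-large ⟩
        N * (Dq * Dq) ≤⟨ *-mono-≥0 0≤N (*≥0 0≤D 0≤D) N≤Qr (*-mono-≥0 0≤D 0≤D D≤Ha D≤Ha) ⟩
        Q * r * (H * a * (H * a)) ≡⟨ lemma₂ Q r H a ⟩
        H * H * Q * (r * (a * a)) ∎)
        where
        open ≤-Reasoning
        0<H : 0ℚ < H
        0<H = ⟦⟧>0 1≤h
        0≤HHQ : 0ℚ ≤ H * H * Q
        0≤HHQ = *≥0 (*≥0 0≤H 0≤H) 0≤Q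
        lemma₁ : ∀ H Q f z u N D k → H * H * Q * (f * (z * (u * (N * D) + N * k))) ≡ N * (f * (H * H) * z * Q * (u * D + k))
        lemma₁ = solve-∀ ring
        lemma₂ : ∀ Q r H a → Q * r * (H * a * (H * a)) ≡ H * H * Q * (r * (a * a))
        lemma₂ = solve-∀ ring

      b-exists : ∃[ s ] (s * r ≡ 1ℚ × 0ℚ ≤ s)
      b-exists = inverse 0<r

      private
        rinv b : ℚ
        rinv = proj₁ b-exists
        b = T * (T - 1ℚ) * a * rinv

      0≤b : 0ℚ ≤ b
      0≤b = *≥0 (*≥0 (*≥0 0≤T (≤⇒0≤- 1≤T)) 0≤a) (proj₂ (proj₂ b-exists))

      b*r : b * r ≡ T * (T - 1ℚ) * a
      b*r = trans (*-assoc (T * (T - 1ℚ) * a) rinv r)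
        (trans (cong (T * (T - 1ℚ) * a *_) (proj₁ (proj₂ b-exists))) (*-identityʳ (T * (T - 1ℚ) * a)))

      ι-live : ∀ {f} → f ∈ E → ∀ v → ι f v * ι R v ≡ ι f v
      ι-live {f} f∈ v with v ∈? f
      ... | yes v∈f rewrite []=⇒lookup v∈f | []=⇒lookup (live f∈ v∈f) = *-identityˡ 1ℚ
      ... | no v∉f  rewrite ιℚ-∉ v∉f = *-zeroˡ (ι R v)

      uniform′ : ∀ {f} → f ∈ E → ∑ᵥ (ι f) ≡ T
      uniform′ {f} f∈ = trans (sym (⟦∣∣⟧ f)) (cong ⟦_⟧ (uniform f∈))

      cod≤1 : ∀ {u v} → u ≢ v → ∑ E (λ f → ι f u * ι f v) ≤ 1ℚ
      cod≤1 {u} {v} u≢v = subst₂ _≤_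
        (trans (⟦∑⟧ E (λ f → ∑ℕ.ι f u ℕ.* ∑ℕ.ι f v))
          (∑-cong E (λ f → trans (⟦⟧-* (∑ℕ.ι f u) (∑ℕ.ι f v)) (cong₂ _*_ (⟦ι⟧ f u) (⟦ι⟧ f v)))))
        ⟦1⟧ (⟦⟧-mono (codegree≤1 linear u≢v))

      d≤B : ∀ v → ∑ E (λ f → ι f v) ≤ B
      d≤B v = subst₂ _≤_ (trans (⟦∑⟧ E (λ f → ∑ℕ.ι f v)) (∑-cong E (λ f → ⟦ι⟧ f v)))
        (⟦⟧-* K D) (⟦⟧-mono (bounded v))

      module Rm = RemovalStep E (ι R) T a b B g
      open Rm.Bounds ι-live (λ v → ι-idem R v) uniform′ cod≤1 d≤B b*r 0<r 0≤a 1≤T 0≤B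
        using (exists-good; cauchy-schwarz; m*t; L≡; κ)

      -- By Cauchy-Schwarz, a small potential keeps σ ≥ - r a / 2.
      ra≤2mT : r * a ≤ m * T + m * T
      ra≤2mT with 0ℚ ≤? σ + σ + r * a
      ... | yes p = ≤-by (σ + σ + r * a) p (trans (cong₂ _+_ m*t m*t) (lemma r a σ))
        where
        lemma : ∀ r a σ → (σ + a * r) + (σ + a * r) ≡ r * a + (σ + σ + r * a)
        lemma = solve-∀ ring
      ... | no ¬p = ⊥-elim (<-irrefl refl (<-≤-trans (*>0 0<w 0<w) w²≤0))
        where
        w : ℚ
        w = - (σ + σ + r * a)
        0<w : 0ℚ < w
        0<w = neg-antimono-< (≰⇒> ¬p)
        final : ∀ r Φ a σ → let w = - (σ + σ + r * a); f = 1ℚ + (1ℚ + (1ℚ + (1ℚ + 0ℚ))) in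
          0ℚ ≡ w * w + ((r * (r * (a * a) - f * Φ) + f * (r * Φ - σ * σ)) + (w * (r * a) + w * (r * a)))
        final = solve-∀ ring
        w²≤0 : w * w ≤ 0ℚ
        w²≤0 = ≤-by ((r * (r * (a * a) - ⟦ 4 ⟧ * Φ) + ⟦ 4 ⟧ * (r * Φ - σ * σ)) + (w * (r * a) + w * (r * a)))
          (+≥0 (+≥0 (*≥0 0≤r (≤⇒0≤- four-Φ)) (*≥0 (⟦⟧≥0 4) (≤⇒0≤- cauchy-schwarz)))
               (+≥0 (*≥0 (<⇒≤ 0<w) (*≥0 0≤r 0≤a)) (*≥0 (<⇒≤ 0<w) (*≥0 0≤r 0≤a))))
          (final r Φ a σ)

      ND≤ : N * Dq ≤ Q * H * (m * T + m * T)
      ND≤ = begin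
        N * Dq              ≤⟨ *-mono-≥0 0≤N 0≤D N≤Qr D≤Ha ⟩
        Q * r * (H * a)     ≡⟨ lemma Q r H a ⟩
        Q * H * (r * a)     ≤⟨ *-monoˡ (*≥0 0≤Q 0≤H) ra≤2mT ⟩
        Q * H * (m * T + m * T) ∎
        where
        open ≤-Reasoning
        lemma : ∀ Q r H a → Q * r * (H * a) ≡ Q * H * (r * a)
        lemma = solve-∀ ring

      -- By `ND≤` at least `N D / (2 Q H T)` edges survive; `G` is what results on dividing `2 K D`
      -- by this number and multiplying by `n`.
      2B≤m*g : B + B ≤ m * g
      2B≤m*g = begin
        B + B ≡⟨ trans (lemma₁ ⟦ K ⟧ Dq) (trans (cong (λ p → (⟦ K ⟧ + ⟦ K ⟧) * Dq * p) (sym ν*N)) (lemma₂ ⟦ K ⟧ Dq ν N)) ⟩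
        (⟦ K ⟧ + ⟦ K ⟧) * ν * (N * Dq) ≤⟨ *-monoˡ (*≥0 (+≥0 (⟦⟧≥0 K) (⟦⟧≥0 K)) 0≤ν) ND≤ ⟩
        (⟦ K ⟧ + ⟦ K ⟧) * ν * (Q * H * (m * T + m * T)) ≡⟨ lemma₃ ⟦ K ⟧ ν Q H m T ⟩
        m * (⟦ 4 ⟧ * ⟦ K ⟧ * Q * T * H * ν) ≡⟨ cong (λ p → m * (p * ν)) cast ⟨
        m * g ∎
        where
        open ≤-Reasoning
        lemma₁ : ∀ K D → K * D + K * D ≡ (K + K) * D * 1ℚ
        lemma₁ = solve-∀ ring
        lemma₂ : ∀ K D ν N → (K + K) * D * (ν * N) ≡ (K + K) * ν * (N * D)
        lemma₂ = solve-∀ ring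
        lemma₃ : ∀ K ν Q H m T → (K + K) * ν * (Q * H * (m * T + m * T)) ≡ m * ((1ℚ + (1ℚ + (1ℚ + (1ℚ + 0ℚ)))) * K * Q * T * H * ν)
        lemma₃ = solve-∀ ring
        cast : ⟦ G ⟧ ≡ ⟦ 4 ⟧ * ⟦ K ⟧ * Q * T * H
        cast = trans (⟦⟧-* (4 ℕ.* K ℕ.* q ℕ.* t) h) (cong (_* H) (trans (⟦⟧-* (4 ℕ.* K ℕ.* q) t) (cong (_* T)
                 (trans (⟦⟧-* (4 ℕ.* K) q) (cong (_* Q) (⟦⟧-* 4 K))))))

      E≢[] : E ≢ []
      E≢[] E≡[] = <-irrefl refl (<-≤-trans (*>0 0<N 0<D) (≤-trans ND≤ (≤-reflexive
        (trans (cong (λ p → Q * H * (p * T + p * T)) (cong (λ l → ∑ l (λ _ → 1ℚ)) E≡[])) (lemma Q H T)))))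
        where
        lemma : ∀ Q H T → Q * H * (0ℚ * T + 0ℚ * T) ≡ 0ℚ
        lemma = solve-∀ ring

      -- While `r ≥ n / q`, the decrement `t (t - 1) a / r` is at most `t² q a / n`; this is the
      -- origin of `c` and of the factor `y`.
      b≤ : b ≤ a * (⟦ c ⟧ * ν)
      b≤ = *-cancelˡ-≤ 0<r (begin
        r * b ≡⟨ trans (*-comm r b) b*r ⟩
        T * (T - 1ℚ) * a ≤⟨ ≤-by (T * a) (*≥0 0≤T 0≤a) (lemma₁ T a) ⟩
        T * T * a * 1ℚ ≤⟨ *-monoˡ (*≥0 (*≥0 0≤T 0≤T) 0≤a) 1≤ ⟩
        T * T * a * (Q * r * ν) ≡⟨ lemma₂ T a Q r ν ⟩
        r * (a * (T * T * Q * ν)) ≡⟨ cong (λ p → r * (a * (p * ν))) (sym (trans (⟦⟧-* (t ℕ.* t) q) (cong (_* Q) (⟦⟧-* t t)))) ⟩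
        r * (a * (⟦ c ⟧ * ν)) ∎)
        where
        open ≤-Reasoning
        lemma₁ : ∀ T a → T * T * a * 1ℚ ≡ T * (T - 1ℚ) * a + T * a
        lemma₁ = solve-∀ ring
        lemma₂ : ∀ T a Q r ν → T * T * a * (Q * r * ν) ≡ r * (a * (T * T * Q * ν))
        lemma₂ = solve-∀ ring
        1≤ : 1ℚ ≤ Q * r * ν
        1≤ = ≤-trans (≤-reflexive (trans (sym ν*N) (*-comm ν N))) (*-monoʳ 0≤ν N≤Qr)

      -- Here `b r ≤ t² D` and `b ≤ D c / n`, so `2 b² r` is at most a multiple of `D² / n`, which
      -- `n₁` makes at most one. The contribution of `L` is the same on both sides.
      κ≤κ̂ : κ ≤ κ̂
      κ≤κ̂ = +-monoˡ-≤ (τ + τ) (begin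
        b * b * r + b * b * r ≡⟨ cong₂ _+_ bbr bbr ⟩
        b * (T * (T - 1ℚ) * a) + b * (T * (T - 1ℚ) * a) ≤⟨ +-mono-≤ bbr≤ bbr≤ ⟩
        Dq * (⟦ c ⟧ * ν) * (T * T * Dq) + Dq * (⟦ c ⟧ * ν) * (T * T * Dq)
          ≡⟨ trans (cong (λ p → Dq * (p * ν) * (T * T * Dq) + Dq * (p * ν) * (T * T * Dq)) c≡) (lemma Dq T Q ν) ⟩
        ν * (⟦ 2 ⟧ * (T * T * (T * T) * Q * (Dq * Dq))) ≡⟨ cong (ν *_) cast ⟨
        ν * ⟦ 2 ℕ.* (t ℕ.* t ℕ.* (t ℕ.* t) ℕ.* q ℕ.* (D ℕ.* D)) ⟧
          ≤⟨ *-monoˡ 0≤ν (⟦⟧-mono (ℕ.≤-trans (ℕ.m≤m+n (2 ℕ.* (t ℕ.* t ℕ.* (t ℕ.* t) ℕ.* q ℕ.* (D ℕ.* D))) (2 ℕ.* c ℕ.+ 2 ℕ.* G)) n₁≤n)) ⟩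
        ν * N ≡⟨ ν*N ⟩
        1ℚ ∎)
        where
        open ≤-Reasoning
        c≡ : ⟦ c ⟧ ≡ T * T * Q
        c≡ = trans (⟦⟧-* (t ℕ.* t) q) (cong (_* Q) (⟦⟧-* t t))
        bbr : b * b * r ≡ b * (T * (T - 1ℚ) * a)
        bbr = trans (*-assoc b b r) (cong (b *_) b*r)
        bbr≤ : b * (T * (T - 1ℚ) * a) ≤ Dq * (⟦ c ⟧ * ν) * (T * T * Dq)
        bbr≤ = *-mono-≥0 0≤b (*≥0 (*≥0 0≤T (≤⇒0≤- 1≤T)) 0≤a)
          (≤-trans b≤ (*-monoʳ (*≥0 (⟦⟧≥0 c) 0≤ν) a≤D))
          (≤-trans (≤-by (T * a) (*≥0 0≤T 0≤a) (lemma₁ T a)) (*-monoˡ (*≥0 0≤T 0≤T) a≤D))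
          where
          lemma₁ : ∀ T a → T * T * a ≡ T * (T - 1ℚ) * a + T * a
          lemma₁ = solve-∀ ring
        lemma : ∀ D T Q ν → D * (T * T * Q * ν) * (T * T * D) + D * (T * T * Q * ν) * (T * T * D)
              ≡ ν * ((1ℚ + (1ℚ + 0ℚ)) * (T * T * (T * T) * Q * (D * D)))
        lemma = solve-∀ ring
        cast : ⟦ 2 ℕ.* (t ℕ.* t ℕ.* (t ℕ.* t) ℕ.* q ℕ.* (D ℕ.* D)) ⟧ ≡ ⟦ 2 ⟧ * (T * T * (T * T) * Q * (Dq * Dq))
        cast = trans (⟦⟧-* 2 (t ℕ.* t ℕ.* (t ℕ.* t) ℕ.* q ℕ.* (D ℕ.* D))) (cong (⟦ 2 ⟧ *_)
          (trans (⟦⟧-* (t ℕ.* t ℕ.* (t ℕ.* t) ℕ.* q) (D ℕ.* D)) (cong₂ _*_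
            (trans (⟦⟧-* (t ℕ.* t ℕ.* (t ℕ.* t)) q) (cong (_* Q)
              (trans (⟦⟧-* (t ℕ.* t) (t ℕ.* t)) (cong₂ _*_ (⟦⟧-* t t) (⟦⟧-* t t)))))
            (⟦⟧-* D D))))

      advance-by : ∀ e → e ∈ E → Rm.Bounds.W ι-live (λ v → ι-idem R v) uniform′ cod≤1 d≤B b*r 0<r 0≤a 1≤T 0≤B e ≤ (Φ + g * Φ) + κ → State (suc i)
      advance-by e e∈ W≤ = record
        { E = E′
        ; M = e ∷ M
        ; R = R ─ e
        ; a = a - b
        ; E⊆𝒢 = λ f∈ → E⊆𝒢 (proj₁ (∈E′ f∈))
        ; M⊆𝒢 = λ { (here refl) → E⊆𝒢 e∈ ; (there f∈) → M⊆𝒢 f∈ }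
        ; live = λ f∈ {v} v∈f → x∈p∧x∉q⇒x∈p─q (live (proj₁ (∈E′ f∈)) v∈f)
                   (λ v∈e → ∣∩∣≡0⇒∉ {e = e} (proj₂ (∈E′ f∈)) v∈e v∈f)
        ; uniform = λ f∈ → uniform (proj₁ (∈E′ f∈))
        ; linear = AllPairs.filter⁺ P? linear
        ; bounded = λ v → ℕ.≤-trans (∑ℕ.∑-filter-≤ P? E (λ _ → z≤n)) (bounded v)
        ; disjoint = All.tabulate (λ {f} f∈ v∈e v∈f → removed f∈ v∈f (live e∈ v∈e)) ∷ disjoint
        ; removed = λ { (here refl) v∈e v∈R′ → proj₂ (∈-─⁻ R v∈R′) v∈e
                      ; (there f∈) v∈f v∈R′ → removed f∈ v∈f (p─q⊆p R e v∈R′) }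
        ; covers = covers-step covers
        ; size = trans (cong (∣ R ─ e ∣ ℕ.+_) (ℕ.*-suc t i)) (trans (sym (ℕ.+-assoc ∣ R ─ e ∣ t (t ℕ.* i)))
                   (trans (cong (ℕ._+ t ℕ.* i) (trans (cong (∣ R ─ e ∣ ℕ.+_) (sym (uniform e∈)))
                      (∣p─q∣+∣q∣ R e (live e∈)))) size))
        ; a≤D = ≤-trans (≤-by b 0≤b (minus a b)) a≤D
        ; a≥ = begin
            Dq * (y * y ^ i) ≡⟨ rot Dq y (y ^ i) ⟩
            Dq * y ^ i * y ≤⟨ *-monoʳ 0≤y a≥ ⟩
            a * y ≤⟨ ≤-by (a * (⟦ c ⟧ * ν) - b) (≤⇒0≤- b≤) (expand a b (⟦ c ⟧ * ν)) ⟩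
            a - b ∎
        ; Φ≤ = ≤-trans (Removal.Φ-removal E R t a b B g linear e e∈ ι-live (L≡ e))
                 (≤-trans W≤ (+-mono-≤ (+-mono-≤ Φ≤ (*-monoˡ 0≤g Φ≤)) κ≤κ̂))
        }
        where
        open ≤-Reasoning
        P? : ∀ f → Dec (∣ e ∩ f ∣ ≡ 0)
        P? f = ∣ e ∩ f ∣ ℕ.≟ 0
        E′ : List (Subset n)
        E′ = disjointFrom e E
        ∈E′ : ∀ {f} → f ∈ E′ → f ∈ E × ∣ e ∩ f ∣ ≡ 0
        ∈E′ = ∈-filter⁻ P? {xs = E}
        minus : ∀ a b → a ≡ (a - b) + b
        minus = solve-∀ ring
        rot : ∀ x y z → x * (y * z) ≡ x * z * y
        rot = solve-∀ ring
        expand : ∀ a b x → a - b ≡ a * (1ℚ - x) + (a * x - b)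
        expand = solve-∀ ring

      advance : State (suc i)
      advance = let (e , e∈ , W≤) = exists-good 2B≤m*g E≢[] in advance-by e e∈ W≤

    open State

    -- `j` is fuel. Each removal covers `t ≥ 1` further vertices, so `suc n` removals are impossible
    -- and the process can only stop because few vertices are left.
    run : ∀ j i → i ℕ.+ j ≡ suc n → State i →
          ∃[ M ] ∃[ R ] ((∀ {f} → f ∈ M → f ∈ 𝒢) × AllPairs Disjoint M ×
                         (∀ v → v ∈ₛ R ⊎ ∃[ f ] (f ∈ M × v ∈ₛ f)) × q ℕ.* ∣ R ∣ ℕ.< n)
    run zero i i≡ s = ⊥-elim (ℕ.<⇒≱ (ℕ.n<1+n n) (begin
      suc n ≡⟨ trans (sym i≡) (ℕ.+-identityʳ i) ⟩
      i ≡⟨ ℕ.*-identityˡ i ⟨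
      1 ℕ.* i ≤⟨ ℕ.*-monoˡ-≤ i 1≤t ⟩
      t ℕ.* i ≤⟨ ℕ.m≤n+m _ ∣ R s ∣ ⟩
      ∣ R s ∣ ℕ.+ t ℕ.* i ≡⟨ size s ⟩
      n ∎))
      where open ℕ.≤-Reasoning
    run (suc j) i i≡ s with n ℕ.≤? q ℕ.* ∣ R s ∣
    ... | yes n≤qR = run j (suc i) (trans (sym (ℕ.+-suc i j)) i≡) (Advance.advance s n≤qR)
    ... | no ¬p    = M s , R s , M⊆𝒢 s , disjoint s , covers s , ℕ.≰⇒> ¬p

    module _ (uniform : ∀ {f} → f ∈ 𝒢 → ∣ f ∣ ≡ t) (linear : AlmostDisjoint 𝒢)
             (bounded : ∀ v → degree 𝒢 v ℕ.≤ K ℕ.* D)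
             (degree-sum : ∑ℕ.∑ᵥ (degree 𝒢) ≡ n ℕ.* D)
             (square-sum : ∑ℕ.∑ᵥ (λ v → degree 𝒢 v ℕ.* degree 𝒢 v) ℕ.≤ n ℕ.* (D ℕ.* D) ℕ.+ 3 ℕ.* (n ℕ.* D))
      where

      private
        dq : Fin n → ℚ
        dq v = ∑ 𝒢 (λ f → ι f v)
        dq≡ : ∀ v → ⟦ degree 𝒢 v ⟧ ≡ dq v
        dq≡ v = trans (⟦∑⟧ 𝒢 (λ f → ∑ℕ.ι f v)) (∑-cong 𝒢 (λ f → ⟦ι⟧ f v))
        V = allFin n

      -- The degree sum is exactly `n D`, so expanding the square subtracts `n D²` in all from the
      -- sum of squared degrees, and `3 n D` remains.
      initial-Φ : ∑ᵥ (λ v → (dq v - Dq * ι (⊤ {n}) v) * (dq v - Dq * ι (⊤ {n}) v)) ≤ β 0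
      initial-Φ = begin
        _ ≡⟨ ∑-cong V (λ v → trans (cong (λ p → (dq v - Dq * p) * (dq v - Dq * p)) (ι⊤ v)) (pw (dq v) Dq)) ⟩
        ∑ᵥ (λ v → (dq v * dq v + (- (Dq + Dq)) * dq v) + 1ℚ * (Dq * Dq))
          ≡⟨ trans (∑-+ V (λ v → dq v * dq v + (- (Dq + Dq)) * dq v) (λ v → 1ℚ * (Dq * Dq)))
               (cong₂ _+_ (trans (∑-+ V (λ v → dq v * dq v) (λ v → (- (Dq + Dq)) * dq v))
                                 (cong (∑ᵥ (λ v → dq v * dq v) +_) (trans (∑-*ˡ V (- (Dq + Dq)) dq) (cong ((- (Dq + Dq)) *_) sum≡))))
                          (trans (∑-*ʳ V (Dq * Dq) (λ _ → 1ℚ)) (cong (_* (Dq * Dq)) ones))) ⟩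
        (∑ᵥ (λ v → dq v * dq v) + (- (Dq + Dq)) * (N * Dq)) + N * (Dq * Dq)
          ≤⟨ +-monoˡ-≤ (N * (Dq * Dq)) (+-monoˡ-≤ ((- (Dq + Dq)) * (N * Dq)) sq≤) ⟩
        ((N * (Dq * Dq) + ⟦ 3 ⟧ * (N * Dq)) + (- (Dq + Dq)) * (N * Dq)) + N * (Dq * Dq)
          ≡⟨ fin N Dq ⟦ 3 ⟧ ⟩
        β 0 ∎
        where
        open ≤-Reasoning
        ι⊤ : ∀ v → ι (⊤ {n}) v ≡ 1ℚ
        ι⊤ v rewrite []=⇒lookup (∈⊤ {x = v}) = refl
        pw : ∀ x D → (x - D * 1ℚ) * (x - D * 1ℚ) ≡ (x * x + (- (D + D)) * x) + 1ℚ * (D * D)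
        pw = solve-∀ ring
        fin : ∀ N D u → ((N * (D * D) + u * (N * D)) + (- (D + D)) * (N * D)) + N * (D * D) ≡ u * (N * D)
        fin = solve-∀ ring
        ones : ∑ᵥ (λ (v : Fin n) → 1ℚ) ≡ N
        ones = trans (∑-cong V (λ v → sym (ι⊤ v))) (trans (sym (⟦∣∣⟧ (⊤ {n}))) (cong ⟦_⟧ (∣⊤∣≡n n)))
        sum≡ : ∑ᵥ dq ≡ N * Dq
        sum≡ = trans (∑-cong V (λ v → sym (dq≡ v))) (trans (sym (⟦∑⟧ V (degree 𝒢))) (trans (cong ⟦_⟧ degree-sum) (⟦⟧-* n D)))
        sq≤ : ∑ᵥ (λ v → dq v * dq v) ≤ N * (Dq * Dq) + ⟦ 3 ⟧ * (N * Dq)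
        sq≤ = subst₂ _≤_
          (trans (⟦∑⟧ V (λ v → degree 𝒢 v ℕ.* degree 𝒢 v))
            (∑-cong V (λ v → trans (⟦⟧-* (degree 𝒢 v) (degree 𝒢 v)) (cong₂ _*_ (dq≡ v) (dq≡ v)))))
          (trans (⟦⟧-+ (n ℕ.* (D ℕ.* D)) (3 ℕ.* (n ℕ.* D))) (cong₂ _+_
            (trans (⟦⟧-* n (D ℕ.* D)) (cong (N *_) (⟦⟧-* D D)))
            (trans (⟦⟧-* 3 (n ℕ.* D)) (cong (⟦ 3 ⟧ *_) (⟦⟧-* n D)))))
          (⟦⟧-mono square-sum)

      near-perfect-matching :
        ∃[ M ] ∃[ R ] ((∀ {f} → f ∈ M → f ∈ 𝒢) × AllPairs Disjoint M ×
                       (∀ v → v ∈ₛ R ⊎ ∃[ f ] (f ∈ M × v ∈ₛ f)) × q ℕ.* ∣ R ∣ ℕ.< n)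
      near-perfect-matching = run (suc n) 0 refl record
        { E = 𝒢 ; M = [] ; R = ⊤ ; a = Dq
        ; E⊆𝒢 = λ f∈ → f∈ ; M⊆𝒢 = λ () ; live = λ _ _ → ∈⊤
        ; uniform = uniform ; linear = linear ; bounded = bounded
        ; disjoint = [] ; removed = λ () ; covers = λ v → inj₁ ∈⊤
        ; size = trans (cong₂ ℕ._+_ (∣⊤∣≡n n) (ℕ.*-zeroʳ t)) (ℕ.+-identityʳ n)
        ; a≤D = ≤-refl ; a≥ = ≤-reflexive (*-identityʳ Dq)
        ; Φ≤ = initial-Φ
        }

-- Building a linear hypertree edge by edge.

module HypertreeGrowth where

  open import Data.Fin using (inject₁; fromℕ; toℕ; fromℕ<)
  open import Data.Fin.Induction using (<-weakInduction)
  open import Data.Fin.Subset using (_∪_; _-_; ⁅_⁆; ⊤)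
  open import Data.Fin.Subset.Properties using (∣⁅x⁆∣≡1; ⊆-antisym; x∈⁅x⁆; x∈⁅y⁆⇒x≡y; x∈p∪q⁺; x∈p∪q⁻;
    p⊂q⇒∣p∣<∣q∣; p⊆p∪q; ∣p∣≤n; ∈⊤; x∈p∧x≢y⇒x∈p-y)
  open import Data.List using (_++_)
  open import Data.List.Membership.Propositional.Properties using (∈-++⁻)
  open import Data.Nat using (ℕ; zero; suc; _∸_; _≤_; _+_; s≤s)
  import Data.Nat.Properties as ℕ
  open import Function.Bundles using (_⇔_; mk⇔; Equivalence)
  open import Relation.Nullary.Decidable using (decidable-stable)
  open SetFamilies
  open EdgeRemoval using (∈-─⁻)
  open import Defs renaming (x to px; y to py) hiding (degree; incidence)

  open KGraph
  open SubHypergraph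
  open _≅_
  open Enumeration
  open Equivalence using (to; from)

  ∣p-x∣ : ∀ {n} {p : Subset n} {v} → v ∈ₛ p → ∣ p - v ∣ ≡ ∣ p ∣ ∸ 1
  ∣p-x∣ {p = p} {v} v∈p = sym (cong (_∸ 1) (trans (sym (∣p─q∣+∣q∣ p ⁅ v ⁆ ⁅v⁆⊆p))
      (trans (cong (∣ p - v ∣ +_) (∣⁅x⁆∣≡1 v)) (ℕ.+-comm ∣ p - v ∣ 1))))
    where
    ⁅v⁆⊆p : ⁅ v ⁆ ⊆ p
    ⁅v⁆⊆p w∈ = subst (_∈ₛ p) (sym (x∈⁅y⁆⇒x≡y v w∈)) v∈p

  ∈-minus⁻ : ∀ {n} (p : Subset n) {u v} → v ∈ₛ p - u → v ∈ₛ p × v ≢ u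
  ∈-minus⁻ p {u} v∈ = proj₁ (∈-─⁻ p v∈) , λ v≡u → proj₂ (∈-─⁻ p v∈) (subst (_∈ₛ ⁅ u ⁆) (sym v≡u) (x∈⁅x⁆ u))

  module Paths {k t : ℕ} (T : KGraph k t) where

    Edge : Set
    Edge = Fin (size T)

    -- Linear paths given by their edges and junction vertices: in `cons` the first edge may meet
    -- the later ones only in the next junction. Unlike the labelled `linearPath`, to which
    -- `realize` leads, these are easily prolonged at both ends.
    data Path : Fin t → Fin t → List Edge → Set where
      nil  : ∀ {v} → Path v v []
      cons : ∀ {u v w e es} → u ∈ₛ edge T e → w ∈ₛ edge T e → u ≢ w →
             (∀ {z f} → z ∈ₛ edge T e → f ∈ es → z ∈ₛ edge T f → z ≡ w) →
             Path w v es → Path u v (e ∷ es)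

    end-on : ∀ {u v es} → Path u v es → u ≡ v ⊎ ∃[ e ] (e ∈ es × v ∈ₛ edge T e)
    end-on nil = inj₁ refl
    end-on (cons _ w∈e _ _ p) with end-on p
    ... | inj₁ refl           = inj₂ (_ , here refl , w∈e)
    ... | inj₂ (f , f∈ , v∈f) = inj₂ (f , there f∈ , v∈f)

    snoc : ∀ {u v w es e} → Path u v es → v ∈ₛ edge T e → w ∈ₛ edge T e → v ≢ w →
           (∀ {z f} → z ∈ₛ edge T e → f ∈ es → z ∈ₛ edge T f → z ≡ v) → Path u w (es ++ e ∷ [])
    snoc nil v∈e w∈e v≢w _ = cons v∈e w∈e v≢w (λ _ ()) nil
    snoc {v = v} {e = e} (cons {w = w′} {e₀} {es} u∈ w∈ u≢w meet p) v∈e w∈e v≢w meet′ =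
      cons u∈ w∈ u≢w meet″ (snoc p v∈e w∈e v≢w (λ z∈e f∈ → meet′ z∈e (there f∈)))
      where
      meet″ : ∀ {z f} → z ∈ₛ edge T e₀ → f ∈ es ++ e ∷ [] → z ∈ₛ edge T f → z ≡ w′
      meet″ z∈e₀ f∈ z∈f with ∈-++⁻ es f∈
      ... | inj₁ f∈es = meet z∈e₀ f∈es z∈f
      -- A vertex common to `e₀` and the new edge is `v`. As the end of the old path, `v` is either
      -- the junction `w′` or lies on a later edge, where `meet` applies.
      ... | inj₂ (here refl) with meet′ z∈f (here refl) z∈e₀ | end-on p
      ...   | refl | inj₁ refl            = refl
      ...   | refl | inj₂ (g , g∈ , v∈g)  = meet z∈e₀ g∈ v∈g

    record Realization (u v : Fin t) (es : List Edge) (ℓ : ℕ) : Set where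
      field
        onV       : PathVertex k ℓ → Fin t
        injective : ∀ {a b} → onV a ≡ onV b → a ≡ b
        onE       : Fin ℓ → Edge
        incidence : ∀ b z → z ∈ₛ edge T (onE b) ⇔ (∃[ a ] (PathOn a b × onV a ≡ z))
        start     : onV (px zero) ≡ u
        end       : onV (px (fromℕ ℓ)) ≡ v
        edges⊆    : ∀ b → onE b ∈ es

    on-some-edge : ∀ {ℓ} (a : PathVertex k (suc ℓ)) → ∃[ b ] PathOn a b
    on-some-edge (px zero)    = zero , left zero
    on-some-edge (px (suc i)) = i , right i
    on-some-edge (py i j)     = i , inner i j

    open Realization

    on-list : ∀ {u v es ℓ} (ρ : Realization u v es ℓ) a →
              onV ρ a ≡ u ⊎ ∃[ e ] (e ∈ es × onV ρ a ∈ₛ edge T e)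
    on-list {ℓ = zero}  ρ (px zero) = inj₁ (start ρ)
    on-list {ℓ = suc ℓ} ρ a with on-some-edge a
    ... | b , a∈b = inj₂ (onE ρ b , edges⊆ ρ b , from (incidence ρ b (onV ρ a)) (a , a∈b , refl))

    realize : ∀ {u v es} → Path u v es → ∃[ ℓ ] Realization u v es ℓ
    realize {v = v} nil = 0 , record
      { onV = λ _ → v ; injective = λ { {px zero} {px zero} _ → refl } ; onE = λ () ; incidence = λ ()
      ; start = refl ; end = refl ; edges⊆ = λ () }
    realize {u} {v} {e ∷ es} (cons {w = w} u∈e w∈e u≢w meet p) with realize p
    ... | ℓ , ρ = suc ℓ , record
      { onV = onV′ ; injective = inj ; onE = onE′ ; incidence = inc
      ; start = refl ; end = end ρ ; edges⊆ = λ { zero → here refl ; (suc b) → there (edges⊆ ρ b) } }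
      where
      rest : Subset t
      rest = (edge T e - u) - w
      en : Enumeration rest (k ∸ 2)
      -- The `k - 2` inner labels of the first edge go to its vertices other than the junctions `u`
      -- and `w`.
      en = subst (Enumeration rest) eq (enumerate rest)
        where
        eq : ∣ rest ∣ ≡ k ∸ 2
        eq = trans (∣p-x∣ (x∈p∧x≢y⇒x∈p-y w∈e (≢-sym u≢w)))
               (trans (cong (_∸ 1) (trans (∣p-x∣ u∈e) (cong (_∸ 1) (uniform T e)))) (ℕ.∸-+-assoc k 1 1))
      en-e : ∀ j → at en j ∈ₛ edge T e × at en j ≢ u × at en j ≢ w
      en-e j = let (p , ≢w) = ∈-minus⁻ (edge T e - u) (at-∈ en j)
                   (q , ≢u) = ∈-minus⁻ (edge T e) p in q , ≢u , ≢w
      onV′ : PathVertex k (suc ℓ) → Fin t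
      onV′ (px zero)       = u
      onV′ (px (suc i))    = onV ρ (px i)
      onV′ (py zero j)     = at en j
      onV′ (py (suc i) j)  = onV ρ (py i j)
      onE′ : Fin (suc ℓ) → Edge
      onE′ zero    = e
      onE′ (suc b) = onE ρ b
      meets-at-w : ∀ a → onV ρ a ∈ₛ edge T e → onV ρ a ≡ w
      meets-at-w a a∈e with on-list ρ a
      ... | inj₁ eq              = eq
      ... | inj₂ (f , f∈ , a∈f) = meet a∈e f∈ a∈f
      u≢ : ∀ a → u ≢ onV ρ a
      u≢ a eq = u≢w (trans eq (meets-at-w a (subst (_∈ₛ edge T e) eq u∈e)))
      en≢ : ∀ j a → at en j ≢ onV ρ a
      en≢ j a eq = proj₂ (proj₂ (en-e j)) (trans eq (meets-at-w a (subst (_∈ₛ edge T e) eq (proj₁ (en-e j)))))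
      inj : ∀ {a b} → onV′ a ≡ onV′ b → a ≡ b
      inj {px zero}     {px zero}     eq = refl
      inj {px zero}     {px (suc i)}  eq = ⊥-elim (u≢ _ eq)
      inj {px zero}     {py zero j}   eq = ⊥-elim (proj₁ (proj₂ (en-e j)) (sym eq))
      inj {px zero}     {py (suc i) j} eq = ⊥-elim (u≢ _ eq)
      inj {px (suc i)}  {px zero}     eq = ⊥-elim (u≢ _ (sym eq))
      inj {px (suc i)}  {px (suc j)}  eq with injective ρ eq
      ... | refl = refl
      inj {px (suc i)}  {py zero j}   eq = ⊥-elim (en≢ j _ (sym eq))
      inj {px (suc i)}  {py (suc _) j} eq with injective ρ eq
      ... | ()
      inj {py zero j}   {px zero}     eq = ⊥-elim (proj₁ (proj₂ (en-e j)) eq)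
      inj {py zero j}   {px (suc i)}  eq = ⊥-elim (en≢ j _ eq)
      inj {py zero j}   {py zero j′}  eq = cong (py zero) (at-injective en eq)
      inj {py zero j}   {py (suc i) _} eq = ⊥-elim (en≢ j _ eq)
      inj {py (suc i) j} {px zero}    eq = ⊥-elim (u≢ _ (sym eq))
      inj {py (suc i) j} {px (suc _)} eq with injective ρ eq
      ... | ()
      inj {py (suc i) j} {py zero j′} eq = ⊥-elim (en≢ j′ _ (sym eq))
      inj {py (suc i) j} {py (suc i′) j′} eq with injective ρ eq
      ... | refl = refl
      inc : ∀ b z → z ∈ₛ edge T (onE′ b) ⇔ (∃[ a ] (PathOn a b × onV′ a ≡ z))
      inc zero z = mk⇔ forth back
        where
        forth : z ∈ₛ edge T e → ∃[ a ] (PathOn a zero × onV′ a ≡ z)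
        forth z∈e with z Fin.≟ u | z Fin.≟ w
        ... | yes refl | _        = px zero , left zero , refl
        ... | no _     | yes refl = px (suc zero) , right zero , start ρ
        ... | no z≢u   | no z≢w   =
          let (j , eq) = index en (x∈p∧x≢y⇒x∈p-y (x∈p∧x≢y⇒x∈p-y z∈e z≢u) z≢w) in py zero j , inner zero j , eq
        back : ∃[ a ] (PathOn a zero × onV′ a ≡ z) → z ∈ₛ edge T e
        back (_ , left .zero    , refl) = u∈e
        back (_ , inner .zero j , refl) = proj₁ (en-e j)
        back (_ , right .zero   , refl) = subst (_∈ₛ edge T e) (sym (start ρ)) w∈e
      inc (suc b) z = mk⇔ (λ z∈ → shift (to (incidence ρ b z) z∈)) (λ q → from (incidence ρ b z) (unshift q))
        where
        shift : ∃[ a ] (PathOn a b × onV ρ a ≡ z) → ∃[ a ] (PathOn a (suc b) × onV′ a ≡ z)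
        shift (_ , left i    , eq) = _ , left (suc i) , eq
        shift (_ , inner i j , eq) = _ , inner (suc i) j , eq
        shift (_ , right i   , eq) = _ , right (suc i) , eq
        unshift : ∃[ a ] (PathOn a (suc b) × onV′ a ≡ z) → ∃[ a ] (PathOn a b × onV ρ a ≡ z)
        unshift (_ , left .(suc b)    , eq) = _ , left b , eq
        unshift (_ , inner .(suc b) j , eq) = _ , inner b j , eq
        unshift (_ , right .(suc b)   , eq) = _ , right b , eq

    module _ {u v es ℓ} (ρ : Realization u v es (suc ℓ)) where
      private
        module CV = Comprehension (λ z → Fin.any? (λ b → z ∈? edge T (onE ρ b)))
        module CE = Comprehension (λ e → Fin.any? (λ b → onE ρ b Fin.≟ e))

      pathSubgraph : SubHypergraph T
      pathSubgraph = record
        { vertices = CV.⟪⟫ ; edges = CE.⟪⟫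
        ; closed = λ e e∈ z∈e → let (b , eq) = CE.∈⟪⟫⁻ e∈ in
            CV.∈⟪⟫⁺ (b , subst (λ f → _ ∈ₛ edge T f) (sym eq) z∈e) }

      path-iso : linearPath k (suc ℓ) ≅ pathSubgraph
      path-iso = record
        { onVertices = onV ρ
        ; vertex-injective = injective ρ
        ; vertex-image = λ z → mk⇔
            (λ z∈ → let (b , z∈b) = CV.∈⟪⟫⁻ z∈ ; (a , _ , eq) = to (incidence ρ b z) z∈b in a , eq)
            (λ { (a , refl) → let (b , a∈b) = on-some-edge a in
                 CV.∈⟪⟫⁺ (b , from (incidence ρ b (onV ρ a)) (a , a∈b , refl)) })
        ; onEdges = onE ρ
        ; edge-image = λ e → mk⇔ CE.∈⟪⟫⁻ CE.∈⟪⟫⁺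
        ; incident = incidence ρ
        }

      edges-listed : ∀ {e} → e ∈ₛ edges pathSubgraph → e ∈ es
      edges-listed e∈ = let (b , eq) = CE.∈⟪⟫⁻ e∈ in subst (_∈ es) eq (edges⊆ ρ b)

    -- That all edges of `S` occur in `es` is kept, because `spanned-edge` compares two paths by
    -- their edges. A path without edges is excluded by `u ≢ v`.
    path⇒linearPath : ∀ {u v es} → u ≢ v → Path u v es →
                      ∃[ S ] (IsLinearPath {H = T} u v S × (∀ {e} → e ∈ₛ edges S → e ∈ es))
    path⇒linearPath u≢v p with realize p
    ... | zero , ρ = ⊥-elim (u≢v (trans (sym (start ρ)) (end ρ)))
    ... | suc zero , ρ = pathSubgraph ρ , length-one (path-iso ρ)
          (from (vertex-image (path-iso ρ) _) (_ , start ρ)) (from (vertex-image (path-iso ρ) _) (_ , end ρ)) , edges-listed ρ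
    ... | suc (suc ℓ) , ρ = pathSubgraph ρ , length-≥2 (path-iso ρ)
          (inj₁ ((_ , x₁ , start ρ) , (_ , x-last , end ρ))) , edges-listed ρ

    -- `X` absorbs every edge that it meets, so membership travels from junction to junction, first
    -- to the start of the path and from there to any vertex.
    monochromatic : ∀ {S : SubHypergraph T} {ℓ} (φ : linearPath k (suc ℓ) ≅ S) (X : Subset t) →
      (∀ e {p z} → p ∈ₛ edge T e → z ∈ₛ edge T e → p ∈ₛ X → z ∈ₛ X) →
      ∀ a a′ → onVertices φ a ∈ₛ X → onVertices φ a′ ∈ₛ X
    monochromatic {ℓ = ℓ} φ X mono a a′ a∈ = from-start a′ (to-start a a∈)
      where
      V : PathVertex k (suc ℓ) → Fin t
      V = onVertices φ
      same : ∀ {b a a′} → PathOn a b → PathOn a′ b → V a ∈ₛ X → V a′ ∈ₛ X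
      same {b} p q = mono (onEdges φ b) (from (incident φ b _) (_ , p , refl)) (from (incident φ b _) (_ , q , refl))
      x-to-start : ∀ i → V (px i) ∈ₛ X → V (px zero) ∈ₛ X
      x-to-start = <-weakInduction (λ i → V (px i) ∈ₛ X → V (px zero) ∈ₛ X) (λ p → p)
        (λ i ih p → ih (same (right i) (left i) p))
      start-to-x : ∀ i → V (px zero) ∈ₛ X → V (px i) ∈ₛ X
      start-to-x = <-weakInduction (λ i → V (px zero) ∈ₛ X → V (px i) ∈ₛ X) (λ p → p)
        (λ i ih p → same (left i) (right i) (ih p))
      to-start : ∀ a → V a ∈ₛ X → V (px zero) ∈ₛ X
      to-start a p = let (b , a∈b) = on-some-edge a in x-to-start (inject₁ b) (same a∈b (left b) p)
      from-start : ∀ a → V (px zero) ∈ₛ X → V a ∈ₛ X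
      from-start a p = let (b , a∈b) = on-some-edge a in same (left b) a∈b (start-to-x (inject₁ b) p)

    linearPath-monochromatic : ∀ {u v S} → IsLinearPath {H = T} u v S → (X : Subset t) →
      (∀ e {p z} → p ∈ₛ edge T e → z ∈ₛ edge T e → p ∈ₛ X → z ∈ₛ X) → u ∈ₛ X → v ∈ₛ X
    linearPath-monochromatic (length-one φ u∈ v∈) X mono u∈X
      with to (vertex-image φ _) u∈ | to (vertex-image φ _) v∈
    ... | a , refl | a′ , refl = monochromatic φ X mono a a′ u∈X
    linearPath-monochromatic (length-≥2 φ (inj₁ ((a , _ , refl) , (a′ , _ , refl)))) X mono = monochromatic φ X mono a a′
    linearPath-monochromatic (length-≥2 φ (inj₂ ((a , _ , refl) , (a′ , _ , refl)))) X mono = monochromatic φ X mono a a′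

    -- Each new edge meets the part built so far in exactly one vertex. Both the colouring and the
    -- embedding of the hypertree are defined by recursion on such a construction.
    data Growth : Subset t → List Edge → Set where
      root : ∀ v → Growth ⁅ v ⁆ []
      grow : ∀ {X F v e} → Growth X F → v ∈ₛ X → v ∈ₛ edge T e →
             (∀ {z} → z ∈ₛ edge T e → z ∈ₛ X → z ≡ v) → Growth (X ∪ edge T e) (e ∷ F)

    growth-nonempty : ∀ {X F} → Growth X F → ∃[ v ] v ∈ₛ X
    growth-nonempty (root v) = v , x∈⁅x⁆ v
    growth-nonempty (grow _ v∈X _ _) = _ , x∈p∪q⁺ (inj₁ v∈X)

    growth-closed : ∀ {X F} → Growth X F → ∀ {f z} → f ∈ F → z ∈ₛ edge T f → z ∈ₛ X
    growth-closed (grow γ _ _ _) (here refl) z∈f = x∈p∪q⁺ (inj₂ z∈f)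
    growth-closed (grow γ _ _ _) (there f∈)  z∈f = x∈p∪q⁺ (inj₁ (growth-closed γ f∈ z∈f))

    -- A new vertex is reached from the old part through the attaching vertex `v`, so a path inside
    -- the old part is prolonged by `e` at one end; two new vertices are joined by `e` alone.
    connected : ∀ {X F} → Growth X F → ∀ {u w} → u ∈ₛ X → w ∈ₛ X →
                ∃[ es ] (Path u w es × (∀ {f} → f ∈ es → f ∈ F))
    connected (root v) u∈ w∈ with x∈⁅y⁆⇒x≡y v u∈ | x∈⁅y⁆⇒x≡y v w∈
    ... | refl | refl = [] , nil , λ ()
    connected {F = e ∷ F} (grow {X} {v = v} γ v∈X v∈e meet) {u} {w} u∈ w∈ with u ∈? X | w ∈? X
    ... | yes u∈X | yes w∈X = let (es , p , ⊆F) = connected γ u∈X w∈X in es , p , λ f∈ → there (⊆F f∈)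
    ... | yes u∈X | no w∉X =
      let (es , p , ⊆F) = connected γ u∈X v∈X in
      es ++ e ∷ [] , snoc p v∈e (in-e w∉X w∈) (λ { refl → w∉X v∈X })
                       (λ z∈e f∈ z∈f → meet z∈e (growth-closed γ (⊆F f∈) z∈f))
      , λ f∈ → ++-case es ⊆F f∈
      where
      in-e : ∀ {z} → z ∉ₛ X → z ∈ₛ X ∪ edge T e → z ∈ₛ edge T e
      in-e z∉X z∈ with x∈p∪q⁻ X (edge T e) z∈
      ... | inj₁ z∈X = ⊥-elim (z∉X z∈X)
      ... | inj₂ z∈e = z∈e
      ++-case : ∀ es → (∀ {f} → f ∈ es → f ∈ F) → ∀ {f} → f ∈ es ++ e ∷ [] → f ∈ e ∷ F
      ++-case es ⊆F f∈ with ∈-++⁻ es f∈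
      ... | inj₁ p           = there (⊆F p)
      ... | inj₂ (here refl) = here refl
    ... | no u∉X | yes w∈X with x∈p∪q⁻ X (edge T e) u∈
    ...   | inj₁ u∈X = ⊥-elim (u∉X u∈X)
    ...   | inj₂ u∈e =
      let (es , p , ⊆F) = connected γ v∈X w∈X in
      e ∷ es , cons u∈e v∈e (λ { refl → u∉X v∈X }) (λ z∈e f∈ z∈f → meet z∈e (growth-closed γ (⊆F f∈) z∈f)) p
      , λ { (here refl) → here refl ; (there f∈) → there (⊆F f∈) }
    connected {F = e ∷ F} (grow {X} {v = v} γ v∈X v∈e meet) {u} {w} u∈ w∈ | no u∉X | no w∉X
      with x∈p∪q⁻ X (edge T e) u∈ | x∈p∪q⁻ X (edge T e) w∈ | u Fin.≟ w
    ... | inj₁ u∈X | _        | _ = ⊥-elim (u∉X u∈X)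
    ... | _        | inj₁ w∈X | _ = ⊥-elim (w∉X w∈X)
    ... | inj₂ _   | inj₂ _   | yes refl = [] , nil , λ ()
    ... | inj₂ u∈e | inj₂ w∈e | no u≢w =
      e ∷ [] , cons u∈e w∈e u≢w (λ _ ()) nil , λ { (here refl) → here refl }

    module Tree (tree : IsLinearHypertree T) (2≤k : 2 ≤ k) where
      open IsLinearHypertree tree

      -- An edge spanned by two vertices of a growth is one of its edges: otherwise the
      -- edge and the path inside the growth would be two linear paths.
      spanned-edge : ∀ {X F} → Growth X F → ∀ {e p z} → p ≢ z → p ∈ₛ X → z ∈ₛ X →
                     p ∈ₛ edge T e → z ∈ₛ edge T e → e ∈ F
      spanned-edge γ {e} {p} {z} p≢z p∈X z∈X p∈e z∈e
        with connected γ p∈X z∈X | path⇒linearPath p≢z (cons p∈e z∈e p≢z (λ _ ()) nil)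
      ... | es , π , es⊆F | S₁ , lp₁ , S₁⊆ with path⇒linearPath p≢z π | uniquePath p z p≢z
      ... | S₂ , lp₂ , S₂⊆ | S , _ , unique with edge-of S₁ lp₁
        where
        edge-of : ∀ S → IsLinearPath {H = T} p z S → ∃[ f ] f ∈ₛ edges S
        edge-of S (length-one φ _ _) = onEdges φ zero , from (edge-image φ _) (zero , refl)
        edge-of S (length-≥2 φ _)    = onEdges φ zero , from (edge-image φ _) (zero , refl)
      ... | f , f∈S₁ with S₁⊆ f∈S₁
      ... | here refl = es⊆F (S₂⊆ (subst (f ∈ₛ_) (trans (sym (proj₂ (unique lp₁))) (proj₂ (unique lp₂))) f∈S₁))

      -- Otherwise every edge that meets `X` would lie in `X`, and the linear path from `u` to `v`
      -- could not leave `X`.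
      crossing-edge : ∀ {X u v} → u ∈ₛ X → v ∉ₛ X →
        ∃[ e ] ((∃[ p ] (p ∈ₛ edge T e × p ∈ₛ X)) × (∃[ z ] (z ∈ₛ edge T e × z ∉ₛ X)))
      crossing-edge {X} {u} {v} u∈X v∉X with Fin.any? (λ e →
          Fin.any? (λ p → p ∈? edge T e ×-dec p ∈? X) ×-dec Fin.any? (λ z → z ∈? edge T e ×-dec ¬? (z ∈? X)))
      ... | yes found = found
      ... | no none with uniquePath u v (λ { refl → v∉X u∈X })
      ...   | S , lp , _ = ⊥-elim (v∉X (linearPath-monochromatic lp X mono u∈X))
        where
        mono : ∀ e {p z} → p ∈ₛ edge T e → z ∈ₛ edge T e → p ∈ₛ X → z ∈ₛ X
        mono e {p} {z} p∈e z∈e p∈X with z ∈? X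
        ... | yes z∈X = z∈X
        ... | no z∉X  = ⊥-elim (none (e , (p , p∈e , p∈X) , (z , z∈e , z∉X)))

      -- A crossing edge meets `X` in one vertex only: with two, `spanned-edge` would list it in `F`
      -- and so put it inside `X`. The fuel `j` bounds the number of missing vertices.
      grow-fully : ∀ j {X F} → Growth X F → t ≤ ∣ X ∣ + j → ∃[ F′ ] Growth ⊤ F′
      grow-fully j {X} {F} γ bound with Fin.all? (λ v → v ∈? X)
      ... | yes all = F , subst (λ Y → Growth Y F) (⊤-unique X all) γ
        where
        ⊤-unique : ∀ X → (∀ v → v ∈ₛ X) → X ≡ ⊤
        ⊤-unique X all = ⊆-antisym (λ _ → ∈⊤) (λ {v} _ → all v)
      ... | no ¬all with Fin.any? (λ v → ¬? (v ∈? X))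
      ...   | no none = ⊥-elim (¬all (λ v → decidable-stable (v ∈? X) (λ v∉ → none (v , v∉))))
      ...   | yes (v , v∉X) with crossing-edge (proj₂ (growth-nonempty γ)) v∉X
      ...     | e , (p , p∈e , p∈X) , (z , z∈e , z∉X) = step j bound
        where
        meet : ∀ {x} → x ∈ₛ edge T e → x ∈ₛ X → x ≡ p
        meet {x} x∈e x∈X with x Fin.≟ p
        ... | yes eq = eq
        ... | no x≢p = ⊥-elim (z∉X (growth-closed γ (spanned-edge γ x≢p x∈X p∈X x∈e p∈e) z∈e))
        larger : suc ∣ X ∣ ≤ ∣ X ∪ edge T e ∣
        larger = p⊂q⇒∣p∣<∣q∣ (p⊆p∪q (edge T e) , z , x∈p∪q⁺ (inj₂ z∈e) , z∉X)
        step : ∀ j → t ≤ ∣ X ∣ + j → ∃[ F′ ] Growth ⊤ F′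
        step zero b = ⊥-elim (ℕ.<⇒≱ (ℕ.≤-trans larger (∣p∣≤n (X ∪ edge T e))) (ℕ.≤-trans b (ℕ.≤-reflexive (ℕ.+-identityʳ _))))
        step (suc j) b = grow-fully j (grow γ p∈X p∈e meet)
          (ℕ.≤-trans b (ℕ.≤-trans (ℕ.≤-reflexive (ℕ.+-suc ∣ X ∣ j)) (ℕ.+-monoˡ-≤ j larger)))

      -- Once all vertices are reached, every edge is spanned by two of its own vertices, which
      -- exist because `k ≥ 2`; so no edge is left out.
      growth-order : ∃[ F ] (Growth ⊤ F × (∀ e → e ∈ F))
      growth-order with grow-fully t (root (some-vertex nonempty)) (ℕ.m≤n+m t _)
        where
        some-vertex : ∀ {t} → 1 ≤ t → Fin t
        some-vertex (s≤s _) = zero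
      ... | F , γ = F , γ , all-edges
        where
        all-edges : ∀ e → e ∈ F
        all-edges e = spanned-edge γ {e} (λ eq → 0≢1 (at-injective en eq)) ∈⊤ ∈⊤ (at-∈ en i₀) (at-∈ en i₁)
          where
          2≤∣e∣ : 2 ≤ ∣ edge T e ∣
          2≤∣e∣ = subst (2 ≤_) (sym (uniform T e)) 2≤k
          en = enumerate (edge T e)
          i₀ i₁ : Fin ∣ edge T e ∣
          i₀ = fromℕ< (ℕ.<⇒≤ 2≤∣e∣)
          i₁ = fromℕ< 2≤∣e∣
          0≢1 : i₀ ≢ i₁
          0≢1 eq with trans (sym (Fin.toℕ-fromℕ< (ℕ.<⇒≤ 2≤∣e∣))) (trans (cong toℕ eq) (Fin.toℕ-fromℕ< 2≤∣e∣))
          ... | ()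

-- Rainbow colourings with k colours and their rotations.

module RainbowColoring where

  open import Data.Fin using (toℕ; fromℕ<)
  open import Data.Fin.Permutation.Components using (transpose; transpose-inverse)
  open import Data.Nat
  open import Data.Nat.DivMod
  open import Data.Nat.Properties
  open import Relation.Nullary.Decidable using (dec-true)
  open Numbers
  open SetFamilies
  open HypertreeGrowth
  open import Defs hiding (x; y; degree; incidence)

  open Enumeration
  open KGraph
  open ∑ℕ

  transpose-left : ∀ {n} (i j : Fin n) → transpose i j i ≡ j
  transpose-left i j rewrite dec-true (i Fin.≟ i) refl = refl

  module Colorings {k t : ℕ} (T : KGraph k t) where
    open Paths T

    record Rainbow (χ : Fin t → Fin k) (f : Edge) : Set where
      field
        injective  : ∀ {u w} → u ∈ₛ edge T f → w ∈ₛ edge T f → χ u ≡ χ w → u ≡ w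
        surjective : ∀ i → ∃[ u ] (u ∈ₛ edge T f × χ u ≡ i)

    open Rainbow

    -- A new edge has only one coloured vertex, so its other vertices can receive the remaining
    -- colours bijectively without disturbing earlier edges.
    growth-coloring : Fin k → ∀ {X F} → Growth X F → ∃[ χ ] (∀ {f} → f ∈ F → Rainbow χ f)
    growth-coloring c₀ (root v) = (λ _ → c₀) , λ ()
    growth-coloring c₀ {F = e ∷ F} (grow {X} {v = v} γ v∈X v∈e meet) with growth-coloring c₀ γ
    ... | χ , rainbow = χ′ , rainbow′
      where
      en : Enumeration (edge T e) k
      en = subst (Enumeration (edge T e)) (uniform T e) (enumerate (edge T e))
      a : Fin k
      a = proj₁ (index en v∈e)
      χ′ : Fin t → Fin k
      χ′ u with u ∈? X | u ∈? edge T e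
      ... | yes _ | _       = χ u
      -- Colours are positions in `e`, up to a transposition that gives the attaching vertex the
      -- colour it already has.
      ... | no _  | yes u∈e = transpose a (χ v) (proj₁ (index en u∈e))
      ... | no _  | no _    = c₀
      index-at : ∀ {u} (u∈e u∈e′ : u ∈ₛ edge T e) → proj₁ (index en u∈e) ≡ proj₁ (index en u∈e′)
      index-at p q = at-injective en (trans (proj₂ (index en p)) (sym (proj₂ (index en q))))
      on-e : ∀ {u} (u∈e : u ∈ₛ edge T e) → χ′ u ≡ transpose a (χ v) (proj₁ (index en u∈e))
      on-e {u} u∈e with u ∈? X | u ∈? edge T e
      ... | no _    | yes p  = cong (transpose a (χ v)) (index-at p u∈e)
      ... | no _    | no u∉e = ⊥-elim (u∉e u∈e)
      ... | yes u∈X | _ with meet u∈e u∈X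
      ...   | refl = sym (trans (cong (transpose a (χ v)) (index-at u∈e v∈e)) (transpose-left a (χ v)))
      on-X : ∀ {u} → u ∈ₛ X → χ′ u ≡ χ u
      on-X {u} u∈X with u ∈? X
      ... | yes _  = refl
      ... | no u∉X = ⊥-elim (u∉X u∈X)
      rainbow′ : ∀ {f} → f ∈ e ∷ F → Rainbow χ′ f
      rainbow′ (here refl) = record
        { injective = λ {u} {w} u∈ w∈ eq → trans (sym (proj₂ (index en u∈)))
            (trans (cong (at en) (trans (sym (transpose-inverse (χ v) a))
              (trans (cong (transpose (χ v) a) (trans (sym (on-e u∈)) (trans eq (on-e w∈)))) (transpose-inverse (χ v) a))))
            (proj₂ (index en w∈)))
        ; surjective = λ i → let u∈ = at-∈ en (transpose (χ v) a i) in
            at en (transpose (χ v) a i) , u∈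
            , trans (on-e u∈) (trans (cong (transpose a (χ v)) (at-injective en (proj₂ (index en u∈)))) (transpose-inverse a (χ v)))
        }
      rainbow′ (there f∈) = record
        { injective = λ u∈ w∈ eq → injective (rainbow f∈) u∈ w∈
            (trans (sym (on-X (growth-closed γ f∈ u∈))) (trans eq (on-X (growth-closed γ f∈ w∈))))
        ; surjective = λ i → let (u , u∈ , eq) = surjective (rainbow f∈) i in u , u∈ , trans (on-X (growth-closed γ f∈ u∈)) eq
        }

    module Rotation .{{_ : NonZero k}} where

      rotate unrotate : Fin k → Fin k → Fin k
      rotate r i   = fromℕ< (m%n<n (toℕ r + toℕ i) k)
      unrotate r i = fromℕ< (m%n<n (toℕ i + (k ∸ toℕ r)) k)

      private
        full-turn : ∀ r i j → r + j ≡ k → i < k → ((r + i) % k + j) % k ≡ i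
        full-turn r i j r+j≡k i<k = begin
          ((r + i) % k + j) % k           ≡⟨ %-distribˡ-+ ((r + i) % k) j k ⟩
          ((r + i) % k % k + j % k) % k   ≡⟨ cong (λ x → (x + j % k) % k) (m%n%n≡m%n (r + i) k) ⟩
          ((r + i) % k + j % k) % k       ≡⟨ %-distribˡ-+ (r + i) j k ⟨
          (r + i + j) % k                 ≡⟨ cong (_% k) (trans (cong (_+ j) (+-comm r i)) (trans (+-assoc i r j) (cong (i +_) r+j≡k))) ⟩
          (i + k) % k                     ≡⟨ [m+n]%n≡m%n i k ⟩
          i % k                           ≡⟨ m<n⇒m%n≡m i<k ⟩
          i ∎
          where open ≡-Reasoning

        r+[k∸r] : ∀ (r : Fin k) → toℕ r + (k ∸ toℕ r) ≡ k
        r+[k∸r] r = m+[n∸m]≡n (<⇒≤ (Fin.toℕ<n r))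

      unrotate-rotate : ∀ r i → unrotate r (rotate r i) ≡ i
      unrotate-rotate r i = Fin.toℕ-injective (trans (Fin.toℕ-fromℕ< _)
        (trans (cong (λ x → (x + (k ∸ toℕ r)) % k) (Fin.toℕ-fromℕ< (m%n<n (toℕ r + toℕ i) k)))
          (full-turn (toℕ r) (toℕ i) (k ∸ toℕ r) (r+[k∸r] r) (Fin.toℕ<n i))))

      rotate-unrotate : ∀ r i → rotate r (unrotate r i) ≡ i
      rotate-unrotate r i = Fin.toℕ-injective (trans (Fin.toℕ-fromℕ< _)
        (trans (cong (_% k) (trans (cong (toℕ r +_) (trans (Fin.toℕ-fromℕ< _) (cong (_% k) (+-comm (toℕ i) _)))) (+-comm (toℕ r) _)))
          (full-turn (k ∸ toℕ r) (toℕ i) (toℕ r) (trans (+-comm (k ∸ toℕ r) _) (r+[k∸r] r)) (Fin.toℕ<n i))))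

      rotate-comm : ∀ r i → rotate r i ≡ rotate i r
      rotate-comm r i = Fin.toℕ-injective (trans (Fin.toℕ-fromℕ< _)
        (trans (cong (_% k) (+-comm (toℕ r) (toℕ i))) (sym (Fin.toℕ-fromℕ< _))))

      rotate-rainbow : ∀ r {χ f} → Rainbow χ f → Rainbow (rotate r ∘ χ) f
      rotate-rainbow r ρ = record
        { injective = λ u∈ w∈ eq → injective ρ u∈ w∈
            (trans (sym (unrotate-rotate r _)) (trans (cong (unrotate r) eq) (unrotate-rotate r _)))
        ; surjective = λ i → let (u , u∈ , eq) = surjective ρ (unrotate r i) in
            u , u∈ , trans (cong (rotate r) eq) (rotate-unrotate r i)
        }

      ∑-injective : ∀ (f : Fin k → Fin k) → (∀ {i j} → f i ≡ f j → i ≡ j) → ∀ (l : Fin k → ℕ) →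
                    ∑ᵥ (λ i → l (f i)) ≤ ∑ᵥ l
      ∑-injective f inj l = begin
        ∑ᵥ (λ i → l (f i))                    ≡⟨ ∑-cong (allFin k) (λ i → sym (∑-δ (f i) l)) ⟩
        ∑ᵥ (λ i → ∑ᵥ (λ j → δ (f i) j * l j)) ≡⟨ ∑-swap (allFin k) (allFin k) (λ i j → δ (f i) j * l j) ⟩
        ∑ᵥ (λ j → ∑ᵥ (λ i → δ (f i) j * l j)) ≡⟨ ∑-cong (allFin k) (λ j → ∑-*ʳ (allFin k) (l j) (λ i → δ (f i) j)) ⟩
        ∑ᵥ (λ j → ∑ᵥ (λ i → δ (f i) j) * l j) ≤⟨ ∑-mono (allFin k) (λ j → *-monoˡ-≤ (l j) (fibre j)) ⟩
        ∑ᵥ (λ j → 1 * l j)                    ≡⟨ ∑-cong (allFin k) (λ j → *-identityˡ (l j)) ⟩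
        ∑ᵥ l ∎
        where
        open ≤-Reasoning
        fibre : ∀ j → ∑ᵥ (λ i → δ (f i) j) ≤ 1
        fibre j with Fin.any? (λ i → f i Fin.≟ j)
        ... | yes (i , refl) = ≤-trans (∑-mono (allFin k) bound) (≤-reflexive (∑-δ i (λ _ → 1)))
          where
          bound : ∀ i′ → δ (f i′) (f i) ≤ δ i i′ * 1
          bound i′ with f i′ Fin.≟ f i
          ... | no _   = z≤n
          ... | yes eq rewrite inj eq = ≤-reflexive (sym (trans (*-identityʳ _) (δ-refl i)))
        ... | no none = ≤-trans (≤-reflexive (trans (∑-cong (allFin k) (λ i → δ-≢ (λ eq → none (i , eq)))) (∑-zero (allFin k)))) z≤n

      -- Over all rotations a fixed vertex of the hypertree takes each colour once, so the mean cost
      -- of the `t` vertices is `t / k` times the sum of `l`, whatever the sizes of the colour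
      -- classes.
      cheap-rotation : ∀ (χ : Fin t → Fin k) (l : Fin k → ℕ) →
                       ∃[ r ] k * ∑ᵥ (λ u → l (rotate r (χ u))) ≤ t * ∑ᵥ l
      cheap-rotation χ l = let (r , _ , le) = ∑-exists-≤′ (allFin k) nonempty total in r , le
        where
        nonempty : allFin k ≢ []
        nonempty eq = ≢-nonZero⁻¹ k (trans (sym (length-allFin k)) (cong length eq))
        open ≤-Reasoning
        total : ∑ᵥ (λ r → k * ∑ᵥ (λ u → l (rotate r (χ u)))) ≤ ∑ᵥ (λ (r : Fin k) → t * ∑ᵥ l)
        total = begin
          ∑ᵥ (λ r → k * ∑ᵥ (λ u → l (rotate r (χ u))))
            ≡⟨ ∑-*ˡ (allFin k) k (λ r → ∑ᵥ (λ u → l (rotate r (χ u)))) ⟩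
          k * ∑ᵥ (λ r → ∑ᵥ (λ u → l (rotate r (χ u))))
            ≡⟨ cong (k *_) (∑-swap (allFin k) (allFin t) (λ r u → l (rotate r (χ u)))) ⟩
          k * ∑ᵥ (λ u → ∑ᵥ (λ r → l (rotate r (χ u))))
            ≤⟨ *-monoʳ-≤ k (∑-mono (allFin t) (λ u → ∑-injective (λ r → rotate r (χ u)) (rotate-injˡ (χ u)) l)) ⟩
          k * ∑ᵥ (λ (u : Fin t) → ∑ᵥ l)
            ≡⟨ cong (k *_) (trans (∑-const (allFin t) (∑ᵥ l)) (cong (_* ∑ᵥ l) (length-allFin t))) ⟩
          k * (t * ∑ᵥ l)
            ≡⟨ trans (∑-const (allFin k) (t * ∑ᵥ l)) (cong (_* (t * ∑ᵥ l)) (length-allFin k)) ⟨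
          ∑ᵥ (λ (r : Fin k) → t * ∑ᵥ l) ∎
          where
          rotate-injˡ : ∀ i {r r′} → rotate r i ≡ rotate r′ i → r ≡ r′
          rotate-injˡ i {r} {r′} eq = trans (sym (unrotate-rotate i r))
            (trans (cong (unrotate i) (trans (rotate-comm i r) (trans eq (rotate-comm r′ i)))) (unrotate-rotate i r′))

-- Greedy embedding of the hypertree into a slotted set of edges.

module TreeEmbedding where

  open import Data.Fin.Subset using (_∪_; ⊤)
  open import Data.Fin.Subset.Properties using (x∈⁅y⁆⇒x≡y; x∈p∪q⁻; ∈⊤)
  open import Data.List using (map; concatMap)
  open import Data.List.Membership.Propositional using (_∉_; find; lose)
  open import Data.List.Membership.Propositional.Properties using (∈-concatMap⁺)
  import Data.List.Properties as List
  import Data.List.Relation.Unary.Any as Any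
  import Data.List.Relation.Unary.AllPairs as AllPairs
  import Data.List.Relation.Unary.AllPairs.Properties as AllPairs
  open import Data.List.Relation.Unary.Unique.Propositional.Properties using (filter⁺)
  open import Data.Nat
  open import Data.Nat.Properties
  open import Function.Bundles using (mk⇔)
  open Numbers
  open SetFamilies
  open HypertreeGrowth
  open RainbowColoring
  open import Defs hiding (x; y; degree; incidence)

  open Enumeration
  open KGraph
  open ∑ℕ

  module EdgeFamily {k n : ℕ} (H : KGraph k n) (linear : Linear H) where

    Edges : Set
    Edges = List (Fin (size H))

    ιᴱ : Fin (size H) → Fin n → ℕ
    ιᴱ e = ι (edge H e)

    edges-almostDisjoint : ∀ {es : Edges} → Unique es → AlmostDisjoint (map (edge H) es)
    edges-almostDisjoint u = AllPairs.map⁺ (AllPairs.map (λ {e} {f} e≢f → linear e f e≢f) u)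

    codegree-edges≤1 : ∀ {es : Edges} → Unique es → ∀ {u v} → u ≢ v →
                       ∑ es (λ e → ιᴱ e u * ιᴱ e v) ≤ 1
    codegree-edges≤1 {es} uniq {u} {v} u≢v =
      subst (_≤ 1) (∑-map (edge H) es (λ S → ι S u * ι S v)) (codegree≤1 (edges-almostDisjoint uniq) u≢v)

    -- Distinct edges through p are disjoint outside p, so each forbidden vertex spoils at most one of them.
    avoid : ∀ {es : Edges} → Unique es → ∀ {p} → (∀ {e} → e ∈ es → p ∈ₛ edge H e) →
            ∀ (B : List (Fin n)) → length B < length es →
            ∃[ e ] (e ∈ es × (∀ {v} → v ∈ₛ edge H e → v ≢ p → v ∉ B))
    avoid {es} uniq {p} p∈ B short with Any.any? (λ e → All.all? (λ v → ¬? (v ∈? edge H e ×-dec ¬? (v Fin.≟ p))) B) es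
    ... | yes found with find found
    ...   | e , e∈ , ok = e , e∈ , λ v∈e v≢p v∈B → All.lookup ok v∈B (v∈e , v≢p)
    avoid {es} uniq {p} p∈ B short | no none = ⊥-elim (<⇒≱ short (begin
      length es                                        ≡⟨ length≡∑ es ⟩
      ∑ es (λ _ → 1)                                   ≤⟨ ∑-mono-∈ es hit ⟩
      ∑ es (λ e → ∑ B (λ v → spoils v * (ιᴱ e p * ιᴱ e v)))
        ≡⟨ ∑-swap es B (λ e v → spoils v * (ιᴱ e p * ιᴱ e v)) ⟩
      ∑ B (λ v → ∑ es (λ e → spoils v * (ιᴱ e p * ιᴱ e v)))
        ≤⟨ ∑-mono B once ⟩
      ∑ B (λ _ → 1)                                    ≡⟨ length≡∑ B ⟨
      length B ∎))
      where
      open ≤-Reasoning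
      spoils : Fin n → ℕ
      spoils v = if does (v Fin.≟ p) then 0 else 1
      spoils-≢ : ∀ {v} → v ≢ p → spoils v ≡ 1
      spoils-≢ {v} v≢p with v Fin.≟ p
      ... | yes eq = ⊥-elim (v≢p eq)
      ... | no _   = refl
      hit : ∀ {e} → e ∈ es → 1 ≤ ∑ B (λ v → spoils v * (ιᴱ e p * ιᴱ e v))
      hit {e} e∈ with Any.any? (λ v → v ∈? edge H e ×-dec ¬? (v Fin.≟ p)) B
      ... | yes found with find found
      ...   | v , v∈B , v∈e , v≢p = ≤-trans
              (≤-reflexive (sym (cong₂ _*_ (spoils-≢ v≢p) (cong₂ _*_ (ι-∈ (p∈ e∈)) (ι-∈ v∈e)))))
              (∑-term B (λ _ → z≤n) v∈B)
      hit {e} e∈ | no ¬found = ⊥-elim (none (lose e∈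
              (All.tabulate (λ v∈B bad → ¬found (lose v∈B bad)))))
      once : ∀ v → ∑ es (λ e → spoils v * (ιᴱ e p * ιᴱ e v)) ≤ 1
      once v with v Fin.≟ p
      ... | yes _   = ≤-trans (≤-reflexive (∑-zero es)) z≤n
      ... | no v≢p = ≤-trans (≤-reflexive (∑-cong es (λ e → *-identityˡ (ιᴱ e p * ιᴱ e v))))
                             (codegree-edges≤1 uniq (≢-sym v≢p))

  length-concatMap : ∀ {X Y : Set} (f : X → List Y) b xs → (∀ x → length (f x) ≤ b) →
                     length (concatMap f xs) ≤ length xs * b
  length-concatMap f b []       h = z≤n
  length-concatMap f b (x ∷ xs) h = ≤-trans (≤-reflexive (List.length-++ (f x)))
    (+-mono-≤ (h x) (length-concatMap f b xs h))

  module Embedding {k t n : ℕ} (T : KGraph k t) (H : KGraph k n) (linear : Linear H) where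
    open EdgeFamily H linear
    open Colorings T
    open Paths T using (Growth; root; grow; growth-closed)

    -- A fixed order on every host edge. A hypertree vertex of colour `i` is always placed at
    -- position `i`, so `slot` collects the edges that can continue the embedding at a vertex used
    -- in position `i`.
    π : ∀ e → Enumeration (edge H e) k
    π e = subst (Enumeration (edge H e)) (uniform H e) (enumerate (edge H e))

    slot : Edges → Fin n → Fin k → Edges
    slot F v i = filter (λ e → at (π e) i Fin.≟ v) F

    module Greedy (F : Edges) (uniq : Unique F)
      (Bad : Fin n → List (Fin n)) (Bad-sym : ∀ {u v} → u ∈ Bad v → v ∈ Bad u)
      (b : ℕ) (∣Bad∣≤b : ∀ v → length (Bad v) ≤ b)
      (good : ∀ {e u v} → e ∈ F → u ∈ₛ edge H e → v ∈ₛ edge H e → u ≢ v → u ∉ Bad v)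
      (rich : ∀ {e} → e ∈ F → ∀ i → t * suc b < length (slot F (at (π e) i) i))
      {e₀ : Fin (size H)} (e₀∈F : e₀ ∈ F) (χ : Fin t → Fin k)
      where

      -- `slotted` serves twice: with `rich` it provides many edges for the next step, and it makes
      -- the cost of an image depend on its colour only. `apart` is what bounds the intersections
      -- with earlier copies.
      record PartialEmbedding (X : Subset t) (G : List (Fin (size T))) : Set where
        field
          ψ         : Fin t → Fin n
          injective : ∀ {u w} → u ∈ₛ X → w ∈ₛ X → ψ u ≡ ψ w → u ≡ w
          slotted   : ∀ {u} → u ∈ₛ X → ∃[ e ] (e ∈ F × at (π e) (χ u) ≡ ψ u)
          apart     : ∀ {u w} → u ∈ₛ X → w ∈ₛ X → u ≢ w → ψ u ∉ Bad (ψ w)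
          onEdges   : ∀ {f} → f ∈ G → ∃[ e ] (e ∈ F × (∀ {u} → u ∈ₛ edge T f → ψ u ≡ at (π e) (χ u)))

      embed : ∀ {X G} → Growth X G → (∀ {f} → f ∈ G → Rainbow χ f) → PartialEmbedding X G
      embed (root v) _ = record
        { ψ = λ _ → at (π e₀) (χ v)
        ; injective = λ u∈ w∈ _ → trans (x∈⁅y⁆⇒x≡y v u∈) (sym (x∈⁅y⁆⇒x≡y v w∈))
        ; slotted = λ u∈ → e₀ , e₀∈F , cong (at (π e₀) ∘ χ) (x∈⁅y⁆⇒x≡y v u∈)
        ; apart = λ u∈ w∈ u≢w → ⊥-elim (u≢w (trans (x∈⁅y⁆⇒x≡y v u∈) (sym (x∈⁅y⁆⇒x≡y v w∈))))
        ; onEdges = λ ()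
        }
      embed {G = f ∷ G} (grow {X} {v = v} γ v∈X v∈f meet) rainbow = extend (embed γ (rainbow ∘ there))
        where
        ρ = rainbow (here refl)
        module _ (p : PartialEmbedding X G) where
          open PartialEmbedding p

          -- This runs over all of `Fin t`; the values of `ψ` at vertices not yet placed are
          -- arbitrary and are forbidden as well, which the count `t * suc b` includes.
          forbidden : List (Fin n)
          forbidden = concatMap (λ u → ψ u ∷ Bad (ψ u)) (allFin t)
          ψ-forbidden : ∀ u → ψ u ∈ forbidden
          ψ-forbidden u = ∈-concatMap⁺ _ {xs = allFin t} (Any.map (λ { refl → here refl }) (∈-allFin u))
          bad-forbidden : ∀ u {z} → z ∈ Bad (ψ u) → z ∈ forbidden
          bad-forbidden u z∈ = ∈-concatMap⁺ _ {xs = allFin t} (Any.map (λ { refl → there z∈ }) (∈-allFin u))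
          ∣forbidden∣ : length forbidden ≤ t * suc b
          ∣forbidden∣ = ≤-trans (length-concatMap _ (suc b) (allFin t) (λ u → s≤s (∣Bad∣≤b (ψ u))))
                                (≤-reflexive (cong (_* suc b) (length-allFin t)))

          candidates : Edges
          candidates = slot F (ψ v) (χ v)
          many : length forbidden < length candidates
          many with slotted v∈X
          ... | e , e∈ , eq = ≤-<-trans ∣forbidden∣ (subst (λ z → t * suc b < length (slot F z (χ v))) eq (rich e∈ (χ v)))
          candidate⁻ : ∀ {e} → e ∈ candidates → e ∈ F × at (π e) (χ v) ≡ ψ v
          candidate⁻ = ∈-filter⁻ (λ e → at (π e) (χ v) Fin.≟ ψ v) {xs = F}
          choice : ∃[ e ] (e ∈ candidates × (∀ {z} → z ∈ₛ edge H e → z ≢ ψ v → z ∉ forbidden))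
          choice = avoid (filter⁺ (λ e → at (π e) (χ v) Fin.≟ ψ v) uniq)
            (λ {e} e∈ → subst (_∈ₛ edge H e) (proj₂ (candidate⁻ e∈)) (at-∈ (π e) (χ v))) forbidden many

          e : Fin (size H)
          e = proj₁ choice
          e∈F : e ∈ F
          e∈F = proj₁ (candidate⁻ (proj₁ (proj₂ choice)))
          e-at-v : at (π e) (χ v) ≡ ψ v
          e-at-v = proj₂ (candidate⁻ (proj₁ (proj₂ choice)))

          ψ′ : Fin t → Fin n
          ψ′ u with u ∈? X
          ... | yes _ = ψ u
          ... | no _  = at (π e) (χ u)
          on-X : ∀ {u} → u ∈ₛ X → ψ′ u ≡ ψ u
          on-X {u} u∈X with u ∈? X
          ... | yes _  = refl
          ... | no u∉X = ⊥-elim (u∉X u∈X)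
          on-f : ∀ {u} → u ∈ₛ edge T f → ψ′ u ≡ at (π e) (χ u)
          on-f {u} u∈f with u ∈? X
          ... | no _ = refl
          ... | yes u∈X with meet u∈f u∈X
          ...   | refl = sym e-at-v
          in-f : ∀ {u} → u ∉ₛ X → u ∈ₛ X ∪ edge T f → u ∈ₛ edge T f
          in-f u∉X u∈ with x∈p∪q⁻ X (edge T f) u∈
          ... | inj₁ u∈X = ⊥-elim (u∉X u∈X)
          ... | inj₂ u∈f = u∈f
          new-allowed : ∀ {w} → w ∉ₛ X → w ∈ₛ edge T f → at (π e) (χ w) ∉ forbidden
          new-allowed {w} w∉X w∈f = proj₂ (proj₂ choice) (at-∈ (π e) (χ w))
            (λ eq → w∉X (subst (_∈ₛ X) (sym (Rainbow.injective ρ w∈f v∈f (at-injective (π e) (trans eq (sym e-at-v))))) v∈X))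

          extend : PartialEmbedding (X ∪ edge T f) (f ∷ G)
          extend = record
            { ψ = ψ′ ; injective = injective′ ; slotted = slotted′ ; apart = apart′ ; onEdges = onEdges′ }
            where
            injective′ : ∀ {u w} → u ∈ₛ X ∪ edge T f → w ∈ₛ X ∪ edge T f → ψ′ u ≡ ψ′ w → u ≡ w
            injective′ {u} {w} u∈ w∈ eq with u ∈? X | w ∈? X
            ... | yes u∈X | yes w∈X = injective u∈X w∈X eq
            ... | yes u∈X | no w∉X  = ⊥-elim (new-allowed w∉X (in-f w∉X w∈) (subst (_∈ forbidden) eq (ψ-forbidden u)))
            ... | no u∉X  | yes w∈X = ⊥-elim (new-allowed u∉X (in-f u∉X u∈) (subst (_∈ forbidden) (sym eq) (ψ-forbidden w)))
            ... | no u∉X  | no w∉X  = Rainbow.injective ρ (in-f u∉X u∈) (in-f w∉X w∈) (at-injective (π e) eq)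
            slotted′ : ∀ {u} → u ∈ₛ X ∪ edge T f → ∃[ e ] (e ∈ F × at (π e) (χ u) ≡ ψ′ u)
            slotted′ {u} u∈ with u ∈? X
            ... | yes u∈X = slotted u∈X
            ... | no u∉X  = e , e∈F , refl
            apart′ : ∀ {u w} → u ∈ₛ X ∪ edge T f → w ∈ₛ X ∪ edge T f → u ≢ w → ψ′ u ∉ Bad (ψ′ w)
            apart′ {u} {w} u∈ w∈ u≢w bad with u ∈? X | w ∈? X
            ... | yes u∈X | yes w∈X = apart u∈X w∈X u≢w bad
            ... | yes u∈X | no w∉X  = new-allowed w∉X (in-f w∉X w∈) (bad-forbidden u (Bad-sym bad))
            ... | no u∉X  | yes w∈X = new-allowed u∉X (in-f u∉X u∈) (bad-forbidden w bad)
            ... | no u∉X  | no w∉X  = good e∈F (at-∈ (π e) (χ u)) (at-∈ (π e) (χ w))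
                  (λ eq → u≢w (Rainbow.injective ρ (in-f u∉X u∈) (in-f w∉X w∈) (at-injective (π e) eq))) bad
            onEdges′ : ∀ {g} → g ∈ f ∷ G → ∃[ e ] (e ∈ F × (∀ {u} → u ∈ₛ edge T g → ψ′ u ≡ at (π e) (χ u)))
            onEdges′ (here refl) = e , e∈F , on-f
            onEdges′ (there g∈) with onEdges g∈
            ... | e′ , e′∈ , h = e′ , e′∈ , λ u∈g → trans (on-X (growth-closed γ g∈ u∈g)) (h u∈g)

      module Copy {G} (all-edges : ∀ f → f ∈ G) (rainbow : ∀ f → Rainbow χ f)
                  (p : PartialEmbedding ⊤ G) where
        open PartialEmbedding p public

        image-edge : Fin (size T) → Fin (size H)
        image-edge f = proj₁ (onEdges (all-edges f))

        private
          module CV = Comprehension (λ v → Fin.any? (λ u → ψ u Fin.≟ v))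
          module CE = Comprehension (λ e → Fin.any? (λ f → image-edge f Fin.≟ e))

        -- All `k` colours occur on `f`, hence every position of the host edge is filled by an
        -- image.
        edge⁻ : ∀ f {v} → v ∈ₛ edge H (image-edge f) → ∃[ u ] (u ∈ₛ edge T f × ψ u ≡ v)
        edge⁻ f v∈ with index (π (image-edge f)) v∈
        ... | i , eq with Rainbow.surjective (rainbow f) i
        ...   | u , u∈f , χu≡i = u , u∈f , trans (proj₂ (proj₂ (onEdges (all-edges f))) u∈f)
                (trans (cong (at (π (image-edge f))) χu≡i) eq)

        edge⁺ : ∀ f {u} → u ∈ₛ edge T f → ψ u ∈ₛ edge H (image-edge f)
        edge⁺ f {u} u∈f = subst (_∈ₛ edge H (image-edge f)) (sym (proj₂ (proj₂ (onEdges (all-edges f))) u∈f))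
                                (at-∈ (π (image-edge f)) (χ u))

        copy : SubHypergraph H
        copy = record
          { vertices = CV.⟪⟫ ; edges = CE.⟪⟫
          ; closed = λ e e∈ {v} v∈e → let (f , eq) = CE.∈⟪⟫⁻ e∈
                                          (u , _ , ψu≡v) = edge⁻ f (subst (λ e → v ∈ₛ edge H e) (sym eq) v∈e)
                                      in CV.∈⟪⟫⁺ (u , ψu≡v)
          }

        isCopy : IsCopyOf T copy
        isCopy = record
          { onVertices = ψ
          ; vertex-injective = injective ∈⊤ ∈⊤
          ; vertex-image = λ v → mk⇔ CV.∈⟪⟫⁻ CV.∈⟪⟫⁺
          ; onEdges = image-edge
          ; edge-image = λ e → mk⇔ CE.∈⟪⟫⁻ CE.∈⟪⟫⁺
          ; incident = λ f v → mk⇔ (edge⁻ f) (λ { (u , u∈f , refl) → edge⁺ f u∈f })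
          }

        S : Subset n
        S = CV.⟪⟫

        S-enumeration : Enumeration S t
        S-enumeration = record
          { at = ψ ; at-injective = injective ∈⊤ ∈⊤ ; at-∈ = λ u → CV.∈⟪⟫⁺ (u , refl) ; index = CV.∈⟪⟫⁻ }

        S-apart : ∀ {u v} → u ∈ₛ S → v ∈ₛ S → u ≢ v → u ∉ Bad v
        S-apart u∈ v∈ u≢v with CV.∈⟪⟫⁻ u∈ | CV.∈⟪⟫⁻ v∈
        ... | a , refl | b , refl = apart ∈⊤ ∈⊤ (λ { refl → u≢v refl })

-- Pigeonhole on patterns and pruning of slots.

module Counting where

  open import Data.List using (map; cartesianProduct)
  open import Data.List.Membership.Propositional using (find; lose)
  open import Data.List.Membership.Propositional.Properties using (∈-filter⁺; ∈-cartesianProduct⁺)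
  import Data.List.Properties as List
  import Data.List.Relation.Unary.Any as Any
  open import Data.List.Relation.Unary.Unique.Propositional.Properties using (filter⁺)
  open import Data.Nat
  open import Data.Nat.Properties
  open import Data.Product.Properties using (≡-dec)
  open import Level using (0ℓ)
  open import Relation.Unary using (Pred; Decidable)

  filter-split : ∀ {X : Set} {P : Pred X 0ℓ} (P? : Decidable P) xs →
                 length (filter P? xs) + length (filter (¬? ∘ P?) xs) ≡ length xs
  filter-split P? []       = refl
  filter-split P? (x ∷ xs) with P? x
  ... | yes _ = cong suc (filter-split P? xs)
  ... | no _  = trans (+-suc _ _) (cong suc (filter-split P? xs))

  filter-filter-≤ : ∀ {X : Set} {P Q : Pred X 0ℓ} (P? : Decidable P) (Q? : Decidable Q) xs →
                    length (filter P? (filter Q? xs)) ≤ length (filter P? xs)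
  filter-filter-≤ P? Q? []       = z≤n
  filter-filter-≤ P? Q? (x ∷ xs) with does (Q? x)
  ... | true with does (P? x)
  ...   | true  = s≤s (filter-filter-≤ P? Q? xs)
  ...   | false = filter-filter-≤ P? Q? xs
  filter-filter-≤ P? Q? (x ∷ xs) | false with does (P? x)
  ...   | true  = m≤n⇒m≤1+n (filter-filter-≤ P? Q? xs)
  ...   | false = filter-filter-≤ P? Q? xs

  length>0 : ∀ {X : Set} (xs : List X) → 0 < length xs → ∃[ x ] x ∈ xs
  length>0 (x ∷ xs) _ = x , here refl

  module _ {X : Set} where

    Sublist : List X → List X → Set
    Sublist ys xs = (∀ {x} → x ∈ ys → x ∈ xs) × (Unique xs → Unique ys)

    sublist-trans : ∀ {xs ys zs} → Sublist zs ys → Sublist ys xs → Sublist zs xs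
    sublist-trans (p , q) (p′ , q′) = p′ ∘ p , q ∘ q′

    filter-sublist : ∀ {P : Pred X 0ℓ} (P? : Decidable P) xs → Sublist (filter P? xs) xs
    filter-sublist P? xs = proj₁ ∘ ∈-filter⁻ P? {xs = xs} , filter⁺ P?

    -- Either the largest value is popular, or discarding its at most `N` elements leaves more than
    -- `b * N` elements with only `b` possible values.
    popular-value : ∀ (g : X → ℕ) b N xs → (∀ {x} → x ∈ xs → g x < b) → b * N < length xs →
                    ∃[ v ] N < length (filter (λ x → g x ≟ v) xs)
    popular-value g zero    N xs g< many with length>0 xs many
    ... | x , x∈ with g< x∈
    ...   | ()
    popular-value g (suc b) N xs g< many with N <? length (filter (λ x → g x ≟ b) xs)
    ... | yes p = b , p
    ... | no ¬p = let (v , le) = popular-value g b N others below enough in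
                  v , ≤-trans le (filter-filter-≤ (λ x → g x ≟ v) (¬? ∘ (λ x → g x ≟ b)) xs)
      where
      others : List X
      others = filter (¬? ∘ (λ x → g x ≟ b)) xs
      below : ∀ {x} → x ∈ others → g x < b
      below x∈ = let (x∈xs , ≢b) = ∈-filter⁻ (¬? ∘ (λ x → g x ≟ b)) {xs = xs} x∈
                 in ≤∧≢⇒< (s≤s⁻¹ (g< x∈xs)) ≢b
      enough : b * N < length others
      enough = +-cancelˡ-< N _ _ (≤-trans many (≤-trans (≤-reflexive (sym (filter-split (λ x → g x ≟ b) xs)))
                 (+-monoˡ-≤ (length others) (≮⇒≥ ¬p))))

    -- One coordinate is made constant at a time, each at the cost of a factor `b`.
    popular-pattern : ∀ {I : Set} (g : I → X → ℕ) b N (is : List I) xs → (∀ i {x} → x ∈ xs → g i x < b) →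
      b ^ length is * N < length xs →
      ∃[ ys ] (Sublist ys xs × N < length ys × (∀ {i} → i ∈ is → ∀ {x y} → x ∈ ys → y ∈ ys → g i x ≡ g i y))
    popular-pattern g b N []       xs g< many = xs , ((λ p → p) , (λ u → u)) , ≤-trans (s≤s (≤-reflexive (sym (+-identityʳ N)))) many , λ ()
    popular-pattern g b N (i ∷ is) xs g< many
      with popular-value (g i) b (b ^ length is * N) xs (g< i) (≤-trans (s≤s (≤-reflexive (sym (*-assoc b _ N)))) many)
    ... | v , many′ with popular-pattern g b N is (filter (λ x → g i x ≟ v) xs)
                           (λ j x∈ → g< j (proj₁ (∈-filter⁻ (λ x → g i x ≟ v) {xs = xs} x∈))) many′
    ...   | ys , sub , N< , same = ys , sublist-trans sub (filter-sublist (λ x → g i x ≟ v) xs) , N< , same′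
      where
      value : ∀ {x} → x ∈ ys → g i x ≡ v
      value x∈ = proj₂ (∈-filter⁻ (λ x → g i x ≟ v) {xs = xs} (proj₁ sub x∈))
      same′ : ∀ {j} → j ∈ i ∷ is → ∀ {x y} → x ∈ ys → y ∈ ys → g j x ≡ g j y
      same′ (here refl) x∈ y∈ = trans (value x∈) (sym (value y∈))
      same′ (there j∈)  x∈ y∈ = same j∈ x∈ y∈

  -- Repeatedly discarding the elements of a slot with at most P of them loses at most P elements per slot.
  module Pruning {X : Set} {n k : ℕ} (s : X → Fin k → Fin n) (P : ℕ) where

    slot : List X → Fin n → Fin k → List X
    slot xs v i = filter (λ x → s x i Fin.≟ v) xs

    Rich : List X → Set
    Rich xs = ∀ {x} → x ∈ xs → ∀ i → P < length (slot xs (s x i) i)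

    private
      Slot : Set
      Slot = Fin n × Fin k
      _≟ₛ_ : (σ τ : Slot) → Dec (σ ≡ τ)
      _≟ₛ_ = ≡-dec Fin._≟_ Fin._≟_

      -- `A` contains all slots still in use. A round empties one of them and loses at most `P`
      -- elements, so `P * length A < length xs` persists and the final list is nonempty.
      prune′ : ∀ m (A : List Slot) xs → length A ≤ m → (∀ {x} → x ∈ xs → ∀ i → (s x i , i) ∈ A) →
               P * length A < length xs → ∃[ ys ] (Sublist ys xs × (∃[ y ] y ∈ ys) × Rich ys)
      prune′ m A xs A≤m slots many
        with Any.any? (λ x → Fin.any? (λ i → length (slot xs (s x i) i) ≤? P)) xs
      ... | no none = xs , ((λ p → p) , (λ u → u)) , length>0 xs (≤-trans (s≤s z≤n) many)
                    , λ x∈ i → ≰⇒> (λ small → none (lose x∈ (i , small)))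
      ... | yes found with find found
      ...   | x , x∈ , i , small = go m A≤m
        where
        σ : Slot
        σ = s x i , i
        rest : List X
        rest = filter (¬? ∘ (λ x′ → s x′ i Fin.≟ s x i)) xs
        A′ : List Slot
        A′ = filter (¬? ∘ (σ ≟ₛ_)) A
        A′-shorter : suc (length A′) ≤ length A
        A′-shorter = List.filter-notAll (¬? ∘ (σ ≟ₛ_)) A (Any.map (λ eq ≢ → ≢ eq) (slots x∈ i))
        slots′ : ∀ {x′} → x′ ∈ rest → ∀ j → (s x′ j , j) ∈ A′
        slots′ x′∈ j = let (x′∈xs , ≢) = ∈-filter⁻ (¬? ∘ (λ x′ → s x′ i Fin.≟ s x i)) {xs = xs} x′∈ in
          ∈-filter⁺ (¬? ∘ (σ ≟ₛ_)) (slots x′∈xs j) (λ eq → ≢ (trans (cong (s _) (cong proj₂ eq)) (sym (cong proj₁ eq))))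
        many′ : P * length A′ < length rest
        many′ = +-cancelˡ-< P _ _ (begin-strict
          P + P * length A′   ≡⟨ *-suc P (length A′) ⟨
          P * suc (length A′) ≤⟨ *-monoʳ-≤ P A′-shorter ⟩
          P * length A        <⟨ many ⟩
          length xs           ≡⟨ filter-split (λ x′ → s x′ i Fin.≟ s x i) xs ⟨
          length (slot xs (s x i) i) + length rest ≤⟨ +-monoˡ-≤ (length rest) small ⟩
          P + length rest ∎)
          where open ≤-Reasoning
        go : ∀ m → length A ≤ m → ∃[ ys ] (Sublist ys xs × (∃[ y ] y ∈ ys) × Rich ys)
        go zero    A≤0 = ⊥-elim (<⇒≱ (≤-trans (s≤s z≤n) A′-shorter) A≤0)
        go (suc m) A≤m = let (ys , sub , ne , rich) = prune′ m A′ rest (s≤s⁻¹ (≤-trans A′-shorter A≤m)) slots′ many′ in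
          ys , sublist-trans sub (filter-sublist (¬? ∘ (λ x′ → s x′ i Fin.≟ s x i)) xs) , ne , rich

    prune : ∀ xs → P * (n * k) < length xs → ∃[ ys ] (Sublist ys xs × (∃[ y ] y ∈ ys) × Rich ys)
    prune xs many = prune′ (length all-slots) all-slots xs ≤-refl
      (λ {x} _ i → ∈-cartesianProduct⁺ (∈-allFin (s x i)) (∈-allFin i))
      (≤-trans (s≤s (≤-reflexive (cong (P *_) count))) many)
      where
      all-slots : List Slot
      all-slots = cartesianProduct (allFin n) (allFin k)
      count : length all-slots ≡ n * k
      count = trans (length-product (allFin n) (allFin k))
        (cong₂ _*_ (List.length-tabulate {n = n} (λ i → i)) (List.length-tabulate {n = k} (λ i → i)))
        where
        length-product : ∀ {Y Z : Set} (ys : List Y) (zs : List Z) → length (cartesianProduct ys zs) ≡ length ys * length zs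
        length-product []       zs = refl
        length-product (y ∷ ys) zs = trans (List.length-++ (map (y ,_) zs))
          (cong₂ _+_ (List.length-map (y ,_) zs) (length-product ys zs))

-- Linearly many edges of low total degree.

module LowEdges where

  open import Data.Fin using (fromℕ<)
  open import Data.List.Extrema.Nat using (argmin; f[argmin]≤f[xs])
  open import Data.List.Relation.Unary.Unique.Propositional.Properties using (allFin⁺)
  open import Data.Nat
  open import Data.Nat.Properties
  open import Data.Nat.Tactic.RingSolver using (solve-∀)
  open Numbers
  open SetFamilies
  open HypertreeGrowth
  open TreeEmbedding
  open import Defs using (KGraph; Linear)

  open KGraph
  open ∑ℕ

  if-cases : ∀ {P : Set} (d : Dec P) → (if does d then 0 else 1) ≡ 0 ⊎ ((if does d then 0 else 1) ≡ 1 × ¬ P)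
  if-cases (yes _)  = inj₁ refl
  if-cases (no ¬p) = inj₂ (refl , ¬p)

  module Low {k n : ℕ} (H : KGraph k n) (linear : Linear H)
    (min-degree : ∀ v → n ≤ k * ∑ (allFin (size H)) (λ e → ι (edge H e) v))
    (c : Fin n → ℕ)
    where
    open EdgeFamily H linear

    private
      E : Edges
      E = allFin (size H)

    deg : Fin n → ℕ
    deg v = ∑ E (λ e → ιᴱ e v)

    Y : ℕ
    Y = ∑ᵥ c

    level : Fin (size H) → ℕ
    level e = ∑ᵥ (λ v → ιᴱ e v * c v)

    low? : ∀ e → Dec (n * level e ≤ k * Y + n * k)
    low? e = n * level e ≤? k * Y + n * k

    low : List (Fin (size H))
    low = filter low? E

    -- If there are few low edges, then weight each vertex by z = M c + ℓ, where ℓ is its degree in the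
    -- low edges.  Around a vertex v of least weight m the edges are disjoint outside v, so the excess
    -- z - m summed over all of them is at most its total; but each of the other edges at v has
    -- large excess, and there are almost n/k of them.
    ℓ : Fin n → ℕ
    ℓ v = ∑ low (λ e → ιᴱ e v)

    module FewLow (W M : ℕ) (M≡ : M ≡ suc (k * W)) (few : length low ≤ W * n)
      (v : Fin n) (m : ℕ) (m≡ : m ≡ M * c v + ℓ v) (m≤z : ∀ u → m ≤ M * c u + ℓ u) where
      private
        V = allFin n

      Q : ℕ
      z w : Fin n → ℕ
      z v = M * c v + ℓ v
      w u = z u ∸ m
      Q = M * (Y + n)

      w+m : ∀ u → w u + m ≡ z u
      w+m u = m∸n+n≡m (m≤z u)

      Σw Z : ℕ
      Σw = ∑ᵥ w
      Z  = ∑ᵥ z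

      Σw+nm : Σw + n * m ≡ Z
      Σw+nm = sym (trans (∑-cong V (λ u → sym (w+m u))) (trans (∑-+ V w (λ _ → m))
        (cong (Σw +_) (trans (∑-const V m) (cong (_* m) (length-allFin n))))))

      -- Here `M = k W + 1` is needed: the low edges contribute at most `k W n` to `Z`, and one more
      -- `n` remains as the slack that makes the averaging strict.
      Z+n≤Q : Z + n ≤ Q
      Z+n≤Q = begin
        Z + n ≡⟨ cong (_+ n) (trans (∑-+ V (λ v → M * c v) ℓ) (cong₂ _+_ (∑-*ˡ V M c) Σℓ)) ⟩
        M * Y + length low * k + n ≤⟨ +-monoˡ-≤ n (+-monoʳ-≤ (M * Y) (*-monoˡ-≤ k few)) ⟩
        M * Y + W * n * k + n ≡⟨ trans (lemma (M * Y) k W n) (cong (λ p → M * Y + p * n) (sym M≡)) ⟩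
        M * Y + M * n ≡⟨ *-distribˡ-+ M Y n ⟨
        Q ∎
        where
        open ≤-Reasoning
        lemma : ∀ y k W n → y + W * n * k + n ≡ y + (1 + k * W) * n
        lemma = solve-∀
        Σℓ : ∑ᵥ ℓ ≡ length low * k
        Σℓ = trans (∑-swap V low (λ v e → ιᴱ e v))
               (trans (∑-cong low (λ e → trans (sym (∣∣≡∑ (edge H e))) (uniform H e))) (∑-const low k))

      excess : Fin (size H) → ℕ
      excess e = ∑ᵥ (λ u → ιᴱ e u * w u)

      excess+km : ∀ e → excess e + k * m ≡ ∑ᵥ (λ u → ιᴱ e u * z u)
      excess+km e = sym (begin
        ∑ᵥ (λ u → ιᴱ e u * z u)
          ≡⟨ ∑-cong V (λ u → trans (cong (ιᴱ e u *_) (sym (w+m u))) (*-distribˡ-+ (ιᴱ e u) (w u) m)) ⟩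
        ∑ᵥ (λ u → ιᴱ e u * w u + ιᴱ e u * m)
          ≡⟨ ∑-+ V (λ u → ιᴱ e u * w u) (λ u → ιᴱ e u * m) ⟩
        excess e + ∑ᵥ (λ u → ιᴱ e u * m)
          ≡⟨ cong (excess e +_) (trans (∑-*ʳ V m (ιᴱ e)) (cong (_* m) (trans (sym (∣∣≡∑ (edge H e))) (uniform H e)))) ⟩
        excess e + k * m ∎)
        where open ≡-Reasoning

      high-excess : ∀ e → ¬ (n * level e ≤ k * Y + n * k) → k * Q ≤ n * excess e + n * (k * m)
      high-excess e high = begin
        k * Q ≡⟨ lemma k M Y n ⟩
        M * (k * Y + n * k) ≤⟨ *-monoʳ-≤ M (<⇒≤ (≰⇒> high)) ⟩
        M * (n * level e) ≡⟨ swap M n (level e) ⟩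
        n * (M * level e) ≤⟨ *-monoʳ-≤ n bound ⟩
        n * ∑ᵥ (λ u → ιᴱ e u * z u) ≡⟨ cong (n *_) (excess+km e) ⟨
        n * (excess e + k * m) ≡⟨ *-distribˡ-+ n (excess e) (k * m) ⟩
        n * excess e + n * (k * m) ∎
        where
        open ≤-Reasoning
        lemma : ∀ k M Y n → k * (M * (Y + n)) ≡ M * (k * Y + n * k)
        lemma = solve-∀
        swap : ∀ a b c → a * (b * c) ≡ b * (a * c)
        swap = solve-∀
        bound : M * level e ≤ ∑ᵥ (λ u → ιᴱ e u * z u)
        bound = ≤-trans (≤-reflexive (sym (∑-*ˡ V M (λ u → ιᴱ e u * c u))))
          (∑-mono V (λ u → ≤-trans (≤-reflexive (swap M (ιᴱ e u) (c u)))
            (*-monoʳ-≤ (ιᴱ e u) (m≤m+n (M * c u) (ℓ u)))))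

      -- Exchanging sums weights `w u` by the codegree of `v` and `u`. This is at most one for `u`
      -- other than `v`, and at `v` itself `w` vanishes.
      excess-at-v : ∑ E (λ e → ιᴱ e v * excess e) ≤ Σw
      excess-at-v = begin
        ∑ E (λ e → ιᴱ e v * excess e)
          ≡⟨ ∑-cong E (λ e → sym (∑-*ˡ V (ιᴱ e v) (λ u → ιᴱ e u * w u))) ⟩
        ∑ E (λ e → ∑ᵥ (λ u → ιᴱ e v * (ιᴱ e u * w u)))
          ≡⟨ ∑-swap E V (λ e u → ιᴱ e v * (ιᴱ e u * w u)) ⟩
        ∑ᵥ (λ u → ∑ E (λ e → ιᴱ e v * (ιᴱ e u * w u)))
          ≡⟨ ∑-cong V (λ u → trans (∑-cong E (λ e → sym (*-assoc (ιᴱ e v) (ιᴱ e u) (w u))))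
               (∑-*ʳ E (w u) (λ e → ιᴱ e v * ιᴱ e u))) ⟩
        ∑ᵥ (λ u → ∑ E (λ e → ιᴱ e v * ιᴱ e u) * w u) ≤⟨ ∑-mono V pointwise ⟩
        ∑ᵥ w ∎
        where
        open ≤-Reasoning
        w-v : w v ≡ 0
        w-v = m≤n⇒m∸n≡0 (≤-reflexive (sym m≡))
        pointwise : ∀ u → ∑ E (λ e → ιᴱ e v * ιᴱ e u) * w u ≤ w u
        pointwise u with v Fin.≟ u
        ... | yes refl = ≤-reflexive (trans (cong (∑ E (λ e → ιᴱ e v * ιᴱ e v) *_) w-v)
                           (trans (*-zeroʳ (∑ E (λ e → ιᴱ e v * ιᴱ e v))) (sym w-v)))
        ... | no v≢u = ≤-trans (*-monoˡ-≤ (w u) (codegree-edges≤1 (allFin⁺ (size H)) v≢u)) (≤-reflexive (*-identityˡ (w u)))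

      high? : Fin (size H) → ℕ
      high? e = if does (low? e) then 0 else 1

      high : ℕ
      high = ∑ E (λ e → ιᴱ e v * high? e)

      deg-split : deg v ≡ ℓ v + high
      deg-split = sym (trans (cong (_+ high) (∑-filter low? E (λ e → ιᴱ e v)))
        (trans (sym (∑-+ E (λ e → if does (low? e) then ιᴱ e v else 0) (λ e → ιᴱ e v * high? e)))
          (∑-cong E split)))
        where
        split : ∀ e → (if does (low? e) then ιᴱ e v else 0) + ιᴱ e v * high? e ≡ ιᴱ e v
        split e with does (low? e)
        ... | true  = trans (cong (ιᴱ e v +_) (*-zeroʳ (ιᴱ e v))) (+-identityʳ _)
        ... | false = *-identityʳ _

      high-total : high * (k * Q) ≤ n * Σw + high * (n * (k * m))
      high-total = begin
        high * (k * Q) ≡⟨ ∑-*ʳ E (k * Q) (λ e → ιᴱ e v * high? e) ⟨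
        ∑ E (λ e → ιᴱ e v * high? e * (k * Q)) ≤⟨ ∑-mono E pointwise ⟩
        ∑ E (λ e → n * (ιᴱ e v * excess e) + ιᴱ e v * high? e * (n * (k * m)))
          ≡⟨ trans (∑-+ E (λ e → n * (ιᴱ e v * excess e)) (λ e → ιᴱ e v * high? e * (n * (k * m))))
               (cong₂ _+_ (∑-*ˡ E n (λ e → ιᴱ e v * excess e)) (∑-*ʳ E (n * (k * m)) (λ e → ιᴱ e v * high? e))) ⟩
        n * ∑ E (λ e → ιᴱ e v * excess e) + high * (n * (k * m))
          ≤⟨ +-monoˡ-≤ (high * (n * (k * m))) (*-monoʳ-≤ n excess-at-v) ⟩
        n * Σw + high * (n * (k * m)) ∎
        where
        open ≤-Reasoning
        lemma : ∀ i n x y → i * 1 * (n * x + y) ≡ n * (i * x) + i * 1 * y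
        lemma = solve-∀
        pointwise : ∀ e → ιᴱ e v * high? e * (k * Q) ≤ n * (ιᴱ e v * excess e) + ιᴱ e v * high? e * (n * (k * m))
        pointwise e with if-cases (low? e)
        ... | inj₁ eq rewrite eq = ≤-trans (≤-reflexive (cong (_* (k * Q)) (*-zeroʳ (ιᴱ e v)))) z≤n
        ... | inj₂ (eq , high) rewrite eq = ≤-trans (*-monoʳ-≤ (ιᴱ e v * 1) (high-excess e high))
                                (≤-reflexive (lemma (ιᴱ e v) n (excess e) (n * (k * m))))

      nm≤Q : n * m ≤ Q
      nm≤Q = ≤-trans (≤-trans (m≤n+m (n * m) Σw) (≤-reflexive Σw+nm)) (≤-trans (m≤m+n Z n) Z+n≤Q)

      -- With R = Q - nm, the above reads high·k·R + n² ≤ n·R, while n ≤ k·high + k·ℓ v.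
      n²≤kℓQ : n * n ≤ k * ℓ v * Q
      n²≤kℓQ = let (R , nm+R) = m≤n⇒∃[o]m+o≡n nm≤Q in bound R nm+R
        where
        open ≤-Reasoning
        module _ (R : ℕ) (nm+R : n * m + R ≡ Q) where
          R≤Q : R ≤ Q
          R≤Q = ≤-trans (m≤n+m R (n * m)) (≤-reflexive nm+R)
          Σw+n≤R : Σw + n ≤ R
          Σw+n≤R = +-cancelˡ-≤ (n * m) _ _ (begin
            n * m + (Σw + n) ≡⟨ rot (n * m) Σw n ⟩
            Σw + n * m + n   ≡⟨ cong (_+ n) Σw+nm ⟩
            Z + n            ≤⟨ Z+n≤Q ⟩
            Q                ≡⟨ nm+R ⟨
            n * m + R ∎)
            where
            rot : ∀ a b c → a + (b + c) ≡ b + a + c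
            rot = solve-∀
          highR : high * (k * R) ≤ n * Σw
          highR = +-cancelʳ-≤ (high * (n * (k * m))) _ _ (begin
            high * (k * R) + high * (n * (k * m)) ≡⟨ lemma high k R n m ⟩
            high * (k * (n * m + R)) ≡⟨ cong (λ p → high * (k * p)) nm+R ⟩
            high * (k * Q) ≤⟨ high-total ⟩
            n * Σw + high * (n * (k * m)) ∎)
            where
            lemma : ∀ h k R n m → h * (k * R) + h * (n * (k * m)) ≡ h * (k * (n * m + R))
            lemma = solve-∀
          key : high * (k * R) + n * n ≤ high * (k * R) + k * ℓ v * R
          key = begin
            high * (k * R) + n * n ≤⟨ +-monoˡ-≤ (n * n) highR ⟩
            n * Σw + n * n ≡⟨ *-distribˡ-+ n Σw n ⟨
            n * (Σw + n) ≤⟨ *-mono-≤ (min-degree v) Σw+n≤R ⟩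
            k * deg v * R ≡⟨ cong (λ p → k * p * R) deg-split ⟩
            k * (ℓ v + high) * R ≡⟨ lemma k (ℓ v) high R ⟩
            high * (k * R) + k * ℓ v * R ∎
            where
            lemma : ∀ k l h R → k * (l + h) * R ≡ h * (k * R) + k * l * R
            lemma = solve-∀
          bound : n * n ≤ k * ℓ v * Q
          bound = ≤-trans (+-cancelˡ-≤ (high * (k * R)) _ _ key) (*-monoʳ-≤ (k * ℓ v) R≤Q)

      -- `ℓ v` is at most the minimum `m`, and `n m ≤ Q`; this goes into `n²≤kℓQ`.
      n³≤kQ² : n * (n * n) ≤ k * (Q * Q)
      n³≤kQ² = begin
        n * (n * n) ≤⟨ *-monoʳ-≤ n n²≤kℓQ ⟩
        n * (k * ℓ v * Q) ≡⟨ lemma n k (ℓ v) Q ⟩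
        k * (n * ℓ v * Q) ≤⟨ *-monoʳ-≤ k (*-monoˡ-≤ Q (≤-trans (*-monoʳ-≤ n (≤-trans (m≤n+m (ℓ v) (M * c v)) (≤-reflexive (sym m≡)))) nm≤Q)) ⟩
        k * (Q * Q) ∎
        where
        open ≤-Reasoning
        lemma : ∀ n k l Q → n * (k * l * Q) ≡ k * (n * l * Q)
        lemma = solve-∀

    threshold : ℕ → ℕ → ℕ
    threshold W D = k * (suc (k * W) * suc (k * W)) * (suc D * suc D)

    -- With few low edges, `Q ≤ M n (D + 1)` turns `n³≤kQ²` into an upper bound for `n`, and
    -- `threshold` is this bound.
    many-low : ∀ W D → Y ≤ n * D → threshold W D < n → W * n < length low
    many-low W D Y≤nD n-large with W * n <? length low
    ... | yes p = p
    ... | no ¬p = ⊥-elim (<⇒≱ n-large (conclude (suc (k * W)) refl))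
      where
      open ≤-Reasoning
      positive : 0 < n
      positive = ≤-trans (s≤s z≤n) n-large
      instance
        n≢0 : NonZero n
        n≢0 = >-nonZero positive
      lemma : ∀ k M n D → k * (M * (n * D) * (M * (n * D))) ≡ n * (n * (k * (M * M) * (D * D)))
      lemma = solve-∀
      conclude : ∀ M → M ≡ suc (k * W) → n ≤ k * (M * M) * (suc D * suc D)
      conclude M M≡ = *-cancelˡ-≤ n (*-cancelˡ-≤ n (begin
        n * (n * n) ≤⟨ FewLow.n³≤kQ² W M M≡ (≮⇒≥ ¬p) v (z v) refl (λ u → All.lookup (f[argmin]≤f[xs] v₀ (allFin n)) (∈-allFin u)) ⟩
        k * (M * (Y + n) * (M * (Y + n))) ≤⟨ *-monoʳ-≤ k (*-mono-≤ Q≤ Q≤) ⟩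
        k * (M * (n * suc D) * (M * (n * suc D))) ≡⟨ lemma k M n (suc D) ⟩
        n * (n * (k * (M * M) * (suc D * suc D))) ∎))
        where
        z : Fin n → ℕ
        z u = M * c u + ℓ u
        v₀ v : Fin n
        v₀ = fromℕ< positive
        v  = argmin z v₀ (allFin n)
        Q≤ : M * (Y + n) ≤ M * (n * suc D)
        Q≤ = *-monoʳ-≤ M (≤-trans (+-monoˡ-≤ n Y≤nD) (≤-reflexive (trans (+-comm (n * D) n) (sym (*-suc n D)))))

-- A cheap new copy that meets every earlier copy in at most one vertex.

module CheapCopy where

  open import Data.Fin.Subset using (⊤)
  open import Data.Fin.Subset.Properties using (x∈p∩q⁻; ∈⊤)
  open import Data.List.Membership.Propositional using (_∉_; find; lose)
  open import Data.List.Membership.Propositional.Properties using (∈-filter⁺)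
  import Data.List.Membership.DecPropositional as DecMembership
  open import Data.List.Relation.Unary.Unique.Propositional.Properties using (allFin⁺)
  import Data.List.Relation.Unary.Any as Any
  open import Data.Nat
  open import Data.Nat.Properties
  open import Data.Nat.Tactic.RingSolver using (solve-∀)
  open import Relation.Nullary.Decidable using (decidable-stable)
  open Numbers
  open SetFamilies
  open NearPerfectMatching using (degree)
  open HypertreeGrowth
  open RainbowColoring
  open TreeEmbedding
  open Counting
  open LowEdges
  open import Defs using (KGraph; Linear; SubHypergraph; IsCopyOf)

  open Enumeration
  open KGraph
  open SubHypergraph
  open ∑ℕ

  indicator-≤ : ∀ {P : Set} (d : Dec P) {m} → (P → 1 ≤ m) → (if does d then 1 else 0) ≤ m
  indicator-≤ (yes p) h = h p
  indicator-≤ (no _)  h = z≤n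

  length-filter-≤ : ∀ {X : Set} {P : X → Set} (P? : ∀ x → Dec (P x)) xs {f : X → ℕ} →
                    (∀ {x} → P x → 1 ≤ f x) → length (filter P? xs) ≤ ∑ xs f
  length-filter-≤ P? xs h = ≤-trans (≤-reflexive (trans (length≡∑ (filter P? xs)) (∑-filter P? xs (λ _ → 1))))
    (∑-mono xs (λ x → indicator-≤ (P? x) h))

  module Bounds (k t D : ℕ) where
    -- `B` bounds the degrees, `b` the number of bad partners of a vertex, `P` the vertices
    -- forbidden in one greedy step. `W * n` adds up the losses: `n * b` edges with a bad pair, then
    -- a factor `suc B ^ k` for the cost pattern and `P` edges for each of `n * k` slots.
    B b P W : ℕ
    B = (2 * t + 1) * D
    b = t * B
    P = t * suc b
    W = b + suc B ^ k * (P * k)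

  -- After division by `n * t`, `cheap` allows the mean degree on the copy to exceed the overall
  -- mean by one; this slack is inherited from `low?`.
  record NewCopy {k t n : ℕ} (T : KGraph k t) (H : KGraph k n) (𝒢 : List (Subset n)) : Set where
    field
      copy   : SubHypergraph H
      isCopy : IsCopyOf T copy
      size-t : ∣ vertices copy ∣ ≡ t
      nearly : All (λ f → ∣ vertices copy ∩ f ∣ ≤ 1) 𝒢
      cheap  : n * ∑ᵥ (λ v → ι (vertices copy) v * degree 𝒢 v) ≤ t * ∑ᵥ (degree 𝒢) + n * t

  module CopySearch {k t n : ℕ} (T : KGraph k t) .{{_ : NonZero k}}
    {G} (γ : Paths.Growth T ⊤ G) (all-edges : ∀ f → f ∈ G)
    (χ : Fin t → Fin k) (rainbow : ∀ f → Colorings.Rainbow T χ f)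
    (H : KGraph k n) (linear : Linear H)
    (min-degree : ∀ v → n ≤ k * ∑ (allFin (size H)) (λ e → ι (edge H e) v))
    (D : ℕ)
    (𝒢 : List (Subset n)) (uniform-𝒢 : ∀ {f} → f ∈ 𝒢 → ∣ f ∣ ≡ t)
    (c≤B : ∀ v → degree 𝒢 v ≤ Bounds.B k t D) (Y≤nD : ∑ᵥ (degree 𝒢) ≤ n * D)
    (n-large : Low.threshold H linear min-degree (degree 𝒢) (Bounds.W k t D) D < n)
    where
    open Bounds k t D
    open EdgeFamily H linear
    open Low H linear min-degree (degree 𝒢) using (Y; low; low?; many-low)
    open Colorings T
    open Rotation
    open Embedding T H linear

    private
      c : Fin n → ℕ
      c = degree 𝒢
      V = allFin n
      _∈ᴸ?_ = DecMembership._∈?_ (Fin._≟_ {n})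

    Together : Fin n → Fin n → Subset n → Set
    Together u v f = u ∈ₛ f × v ∈ₛ f

    together? : ∀ u v f → Dec (Together u v f)
    together? u v f = u ∈? f ×-dec v ∈? f

    -- The list contains `v` itself as soon as an earlier copy does, hence the side condition
    -- `u ≢ v` wherever bad pairs are excluded.
    Bad : Fin n → List (Fin n)
    Bad v = filter (λ u → Any.any? (together? u v) 𝒢) V

    Bad⁻ : ∀ {u v} → u ∈ Bad v → ∃[ f ] (f ∈ 𝒢 × Together u v f)
    Bad⁻ {u} {v} u∈ = find (proj₂ (∈-filter⁻ (λ u → Any.any? (together? u v) 𝒢) {xs = V} u∈))

    Bad⁺ : ∀ {u v f} → f ∈ 𝒢 → u ∈ₛ f → v ∈ₛ f → u ∈ Bad v
    Bad⁺ {u} {v} f∈ u∈f v∈f = ∈-filter⁺ (λ u → Any.any? (together? u v) 𝒢) (∈-allFin u) (lose f∈ (u∈f , v∈f))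

    Bad-sym : ∀ {u v} → u ∈ Bad v → v ∈ Bad u
    Bad-sym u∈ = let (f , f∈ , u∈f , v∈f) = Bad⁻ u∈ in Bad⁺ f∈ v∈f u∈f

    ∣Bad∣≤b : ∀ v → length (Bad v) ≤ b
    ∣Bad∣≤b v = begin
      length (Bad v)
        ≤⟨ length-filter-≤ (λ u → Any.any? (together? u v) 𝒢) V hit ⟩
      ∑ᵥ (λ u → ∑ 𝒢 (λ f → ι f u * ι f v)) ≡⟨ ∑-swap V 𝒢 (λ u f → ι f u * ι f v) ⟩
      ∑ 𝒢 (λ f → ∑ᵥ (λ u → ι f u * ι f v))
        ≡⟨ ∑-cong-∈ 𝒢 (λ {f} f∈ → trans (∑-*ʳ V (ι f v) (ι f)) (cong (_* ι f v) (trans (sym (∣∣≡∑ f)) (uniform-𝒢 f∈)))) ⟩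
      ∑ 𝒢 (λ f → t * ι f v) ≡⟨ ∑-*ˡ 𝒢 t (λ f → ι f v) ⟩
      t * c v ≤⟨ *-monoʳ-≤ t (c≤B v) ⟩
      b ∎
      where
      open ≤-Reasoning
      hit : ∀ {u} → Any.Any (Together u v) 𝒢 → 1 ≤ ∑ 𝒢 (λ f → ι f u * ι f v)
      hit found with find found
      ... | f , f∈ , u∈f , v∈f = ≤-trans (≤-reflexive (sym (cong₂ _*_ (ι-∈ u∈f) (ι-∈ v∈f)))) (∑-term 𝒢 (λ _ → z≤n) f∈)

    Spoiled : Fin (size H) → Set
    Spoiled e = ∃[ v ] ∃[ u ] (u ∈ Bad v × u ≢ v × u ∈ₛ edge H e × v ∈ₛ edge H e)

    spoiled? : ∀ e → Dec (Spoiled e)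
    spoiled? e = Fin.any? (λ v → Fin.any? (λ u →
      u ∈ᴸ? Bad v ×-dec ¬? (u Fin.≟ v) ×-dec u ∈? edge H e ×-dec v ∈? edge H e))

    -- There are at most `n * b` bad pairs, and by linearity of the host two distinct vertices lie
    -- in at most one edge.
    few-spoiled : ∀ {es} → Unique es → length (filter spoiled? es) ≤ n * b
    few-spoiled {es} uniq = begin
      length (filter spoiled? es) ≤⟨ length-filter-≤ spoiled? es hit ⟩
      ∑ es (λ e → ∑ᵥ (λ v → ∑ (Bad v) (λ u → distinct u v * (ιᴱ e u * ιᴱ e v))))
        ≡⟨ ∑-swap es V (λ e v → ∑ (Bad v) (λ u → distinct u v * (ιᴱ e u * ιᴱ e v))) ⟩
      ∑ᵥ (λ v → ∑ es (λ e → ∑ (Bad v) (λ u → distinct u v * (ιᴱ e u * ιᴱ e v))))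
        ≤⟨ ∑-mono V per-vertex ⟩
      ∑ᵥ (λ (v : Fin n) → b) ≡⟨ trans (∑-const V b) (cong (_* b) (length-allFin n)) ⟩
      n * b ∎
      where
      open ≤-Reasoning
      distinct : Fin n → Fin n → ℕ
      distinct u v = if does (u Fin.≟ v) then 0 else 1
      distinct-≢ : ∀ {u v} → u ≢ v → distinct u v ≡ 1
      distinct-≢ {u} {v} u≢v with u Fin.≟ v
      ... | yes eq = ⊥-elim (u≢v eq)
      ... | no _   = refl
      hit : ∀ {e} → Spoiled e → 1 ≤ ∑ᵥ (λ v → ∑ (Bad v) (λ u → distinct u v * (ιᴱ e u * ιᴱ e v)))
      hit (v , u , u∈ , u≢v , u∈e , v∈e) = ≤-trans
        (≤-reflexive (sym (cong₂ _*_ (distinct-≢ u≢v) (cong₂ _*_ (ι-∈ u∈e) (ι-∈ v∈e)))))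
        (≤-trans (∑-term (Bad v) (λ _ → z≤n) u∈) (∑-term V (λ _ → z≤n) (∈-allFin v)))
      once : ∀ v u → ∑ es (λ e → distinct u v * (ιᴱ e u * ιᴱ e v)) ≤ 1
      once v u with u Fin.≟ v
      ... | yes _  = ≤-trans (≤-reflexive (∑-zero es)) z≤n
      ... | no u≢v = ≤-trans (≤-reflexive (∑-cong es (λ e → *-identityˡ (ιᴱ e u * ιᴱ e v))))
                             (codegree-edges≤1 uniq u≢v)
      per-vertex : ∀ v → ∑ es (λ e → ∑ (Bad v) (λ u → distinct u v * (ιᴱ e u * ιᴱ e v))) ≤ b
      per-vertex v = ≤-trans (≤-reflexive (∑-swap es (Bad v) (λ e u → distinct u v * (ιᴱ e u * ιᴱ e v))))
        (≤-trans (∑-mono (Bad v) (once v)) (≤-trans (≤-reflexive (sym (length≡∑ (Bad v)))) (∣Bad∣≤b v)))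

    usable : Edges
    usable = filter (¬? ∘ spoiled?) low

    usable-sublist : Sublist usable (allFin (size H))
    usable-sublist = sublist-trans (filter-sublist (¬? ∘ spoiled?) low) (filter-sublist low? (allFin (size H)))

    many-usable : suc B ^ length (allFin k) * (P * (n * k)) < length usable
    many-usable = +-cancelˡ-< (n * b) _ _ (begin-strict
      n * b + suc B ^ length (allFin k) * (P * (n * k))
        ≡⟨ cong (λ j → n * b + suc B ^ j * (P * (n * k))) (length-allFin k) ⟩
      n * b + suc B ^ k * (P * (n * k)) ≡⟨ lemma n b (suc B ^ k) P k ⟩
      W * n <⟨ many-low W D Y≤nD n-large ⟩
      length low ≡⟨ filter-split spoiled? low ⟨
      length (filter spoiled? low) + length usable
        ≤⟨ +-monoˡ-≤ (length usable) (few-spoiled (proj₂ (filter-sublist low? (allFin (size H))) (allFin⁺ (size H)))) ⟩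
      n * b + length usable ∎)
      where
      open ≤-Reasoning
      lemma : ∀ n b s P k → n * b + s * (P * (n * k)) ≡ (b + s * (P * k)) * n
      lemma = solve-∀

    module FromPattern (F : Edges) (F⊆usable : Sublist F usable)
      (rich : Pruning.Rich (λ e i → at (π e) i) P F)
      (same : ∀ i {e e′} → e ∈ F → e′ ∈ F → c (at (π e) i) ≡ c (at (π e′) i))
      {e₀ : Fin (size H)} (e₀∈ : e₀ ∈ F)
      (r : Fin k) (cheap-r : k * ∑ᵥ (λ u → c (at (π e₀) (rotate r (χ u)))) ≤ t * ∑ᵥ (λ i → c (at (π e₀) i)))
      where

      good : ∀ {e u v} → e ∈ F → u ∈ₛ edge H e → v ∈ₛ edge H e → u ≢ v → u ∉ Bad v
      good {u = u} {v} e∈ u∈e v∈e u≢v bad =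
        proj₂ (∈-filter⁻ (¬? ∘ spoiled?) {xs = low} (proj₁ F⊆usable e∈)) (v , u , bad , u≢v , u∈e , v∈e)
      module Gr = Greedy F (proj₂ (sublist-trans F⊆usable usable-sublist) (allFin⁺ (size H)))
        Bad Bad-sym b ∣Bad∣≤b good rich e₀∈ (rotate r ∘ χ)

      module FromEmbedding (p : Gr.PartialEmbedding ⊤ G) where
        module Cp = Gr.Copy all-edges (λ f → rotate-rainbow r (rainbow f)) p

        unique-in : ∀ {f} → f ∈ 𝒢 → ∀ {u v} → u ∈ₛ Cp.S ∩ f → v ∈ₛ Cp.S ∩ f → u ≡ v
        unique-in {f} f∈ {u} {v} u∈ v∈ = decidable-stable (u Fin.≟ v) (λ u≢v →
          let (u∈S , u∈f) = x∈p∩q⁻ Cp.S f u∈ ; (v∈S , v∈f) = x∈p∩q⁻ Cp.S f v∈ in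
          Cp.S-apart u∈S v∈S u≢v (Bad⁺ f∈ u∈f v∈f))
        l : Fin k → ℕ
        l i = c (at (π e₀) i)
        -- The image of `u` occupies the position of its colour in some edge of `F`, and all edges
        -- of `F` have the same cost in that position as `e₀`.
        cψ : ∀ u → c (Cp.ψ u) ≡ l (rotate r (χ u))
        cψ u = let (e , e∈ , eq) = Cp.slotted {u} ∈⊤ in
          trans (cong c (sym eq)) (same (rotate r (χ u)) e∈ e₀∈)
        level-e₀ : n * ∑ᵥ l ≤ k * Y + n * k
        level-e₀ = ≤-trans (≤-reflexive (cong (n *_) (sym (∑-enumeration (π e₀) c))))
          (proj₂ (∈-filter⁻ low? {xs = allFin (size H)} (proj₁ (filter-sublist (¬? ∘ spoiled?) low) (proj₁ F⊆usable e₀∈))))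
        cheap-S : n * ∑ᵥ (λ v → ι Cp.S v * c v) ≤ t * Y + n * t
        cheap-S = *-cancelˡ-≤ k (begin
          k * (n * ∑ᵥ (λ v → ι Cp.S v * c v))
            ≡⟨ cong (λ p → k * (n * p)) (trans (∑-enumeration Cp.S-enumeration c) (∑-cong (allFin t) cψ)) ⟩
          k * (n * ∑ᵥ (λ u → l (rotate r (χ u)))) ≡⟨ swap k n _ ⟩
          n * (k * ∑ᵥ (λ u → l (rotate r (χ u)))) ≤⟨ *-monoʳ-≤ n cheap-r ⟩
          n * (t * ∑ᵥ l) ≡⟨ swap n t _ ⟩
          t * (n * ∑ᵥ l) ≤⟨ *-monoʳ-≤ t level-e₀ ⟩
          t * (k * Y + n * k) ≡⟨ lemma t k Y n ⟩
          k * (t * Y + n * t) ∎)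
          where
          open ≤-Reasoning
          swap : ∀ a b c → a * (b * c) ≡ b * (a * c)
          swap = solve-∀
          lemma : ∀ t k Y n → t * (k * Y + n * k) ≡ k * (t * Y + n * t)
          lemma = solve-∀

        result : NewCopy T H 𝒢
        result = record
          { copy = Cp.copy ; isCopy = Cp.isCopy ; size-t = enumeration-size Cp.S-enumeration
          ; nearly = All.tabulate (λ {f} f∈ → at-most-one (Cp.S ∩ f) (unique-in f∈))
          ; cheap = cheap-S }

      found : NewCopy T H 𝒢
      found = FromEmbedding.result (Gr.embed γ (λ {f} _ → rotate-rainbow r (rainbow f)))

    new-copy : NewCopy T H 𝒢
    new-copy =
      let (F₁ , sub₁ , many₁ , same) = popular-pattern (λ i e → c (at (π e) i)) (suc B) (P * (n * k)) (allFin k) usable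
            (λ i {e} _ → s≤s (c≤B (at (π e) i))) many-usable
          (F , sub , (e₀ , e₀∈) , rich) = Pruning.prune (λ e i → at (π e) i) P F₁ many₁
          (r , cheap-r) = cheap-rotation χ (λ i → c (at (π e₀) i))
      in FromPattern.found F (sublist-trans sub sub₁) rich
           (λ i e∈ e′∈ → same (∈-allFin i) (proj₁ sub e∈) (proj₁ sub e′∈)) e₀∈ r cheap-r

-- An almost disjoint family of copies with nearly equal degrees.

module CopyFamily where

  open import Data.Fin.Subset using (⊤)
  open import Data.Nat
  open import Data.Nat.Properties
  open import Data.Nat.Tactic.RingSolver using (solve-∀)
  open Numbers
  open SetFamilies
  open NearPerfectMatching using (degree; Disjoint; module Constants; module Process)
  open HypertreeGrowth
  open RainbowColoring
  open CheapCopy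
  open import Defs using (KGraph; Linear; SubHypergraph; IsCopyOf)

  open KGraph using (size; edge)
  open SubHypergraph
  open ∑ℕ

  module Build {k t n : ℕ} (T : KGraph k t) .{{_ : NonZero k}}
    {G} (γ : Paths.Growth T ⊤ G) (all-edges : ∀ f → f ∈ G)
    (χ : Fin t → Fin k) (rainbow : ∀ f → Colorings.Rainbow T χ f)
    (H : KGraph k n) (linear : Linear H)
    (min-degree : ∀ v → n ≤ k * ∑ (allFin (size H)) (λ e → ι (edge H e) v))
    (D′ : ℕ) (1≤D : 1 ≤ t * D′)
    -- `Low.threshold` written out, since that function belongs to a module over the host, while the
    -- bound on `n` is fixed before the host.
    (n-large : k * (suc (k * Bounds.W k t (t * D′)) * suc (k * Bounds.W k t (t * D′))) * (suc (t * D′) * suc (t * D′)) < n)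
    where

    private
      V = allFin n

    D : ℕ
    D = t * D′

    open Bounds k t D

    instance
      n≢0 : NonZero n
      n≢0 = >-nonZero (≤-trans (s≤s z≤n) n-large)

    -- The degrees sum to `t * j`, so `squares` says that `n²` times their variance is at most
    -- `3 n t j`.
    record Family (j : ℕ) : Set where
      field
        𝒢       : List (Subset n)
        size-j  : length 𝒢 ≡ j
        uniform : ∀ {f} → f ∈ 𝒢 → ∣ f ∣ ≡ t
        almost  : AlmostDisjoint 𝒢
        bounded : ∀ v → degree 𝒢 v ≤ B
        squares : n * ∑ᵥ (λ v → degree 𝒢 v * degree 𝒢 v) ≤ (t * j) * (t * j) + 3 * (n * (t * j))
        copies  : ∀ {f} → f ∈ 𝒢 → ∃[ S ] (IsCopyOf T {H} S × vertices S ≡ f)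

      total : ∑ᵥ (degree 𝒢) ≡ t * j
      total = trans (∑-swap V 𝒢 (λ v f → ι f v)) (trans (∑-cong-∈ 𝒢 (λ {f} f∈ → trans (sym (∣∣≡∑ f)) (uniform f∈)))
        (trans (∑-const 𝒢 t) (trans (cong (_* t) size-j) (*-comm j t))))

    open Family

    empty : Family 0
    empty = record
      { 𝒢 = [] ; size-j = refl ; uniform = λ () ; almost = [] ; bounded = λ _ → z≤n ; copies = λ ()
      ; squares = ≤-trans (≤-reflexive (trans (cong (n *_) (∑-zero V)) (*-zeroʳ n))) z≤n }

    tj≤nD : ∀ {j} → j ≤ D′ * n → t * j ≤ n * D
    tj≤nD j≤ = ≤-trans (*-monoʳ-≤ t j≤) (≤-reflexive (lemma t D′ n))
      where
      lemma : ∀ t d n → t * (d * n) ≡ n * (t * d)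
      lemma = solve-∀

    extend-by : ∀ {j} → j ≤ D′ * n → (F : Family j) → NewCopy T H (𝒢 F) → Family (suc j)
    extend-by {j} j≤ F N = record
      { 𝒢 = vertices copy ∷ 𝒢 F
      ; size-j = cong suc (size-j F)
      ; uniform = λ { (here refl) → size-t ; (there f∈) → uniform F f∈ }
      ; almost = nearly ∷ almost F
      ; bounded = bounded′
      ; squares = squares′
      ; copies = λ { (here refl) → copy , isCopy , refl ; (there f∈) → copies F f∈ }
      }
      where
      open NewCopy N
      c s : Fin n → ℕ
      c = degree (𝒢 F)
      s = ι (vertices copy)
      cS : ℕ
      cS = ∑ᵥ (λ v → s v * c v)
      cheap′ : n * cS ≤ t * (t * j) + n * t
      cheap′ = ≤-trans cheap (≤-reflexive (cong (λ p → t * p + n * t) (total F)))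
      cS≤ : cS ≤ t * D + t
      cS≤ = *-cancelˡ-≤ n (begin
        n * cS                ≤⟨ cheap′ ⟩
        t * (t * j) + n * t   ≤⟨ +-monoˡ-≤ (n * t) (*-monoʳ-≤ t (tj≤nD j≤)) ⟩
        t * (n * D) + n * t   ≡⟨ lemma t n D ⟩
        n * (t * D + t) ∎)
        where
        open ≤-Reasoning
        lemma : ∀ t n D → t * (n * D) + n * t ≡ n * (t * D + t)
        lemma = solve-∀
      -- A single degree on the new copy is at most their sum `cS`, and cheapness bounds `cS` by
      -- `t D + t`. So the maximum degree stays bounded although only totals are controlled.
      bounded′ : ∀ v → s v + c v ≤ B
      bounded′ v with v ∈? vertices copy
      ... | no v∉ rewrite ι-∉ v∉ = bounded F v
      ... | yes v∈ = begin
        s v + c v          ≡⟨ cong (_+ c v) (ι-∈ v∈) ⟩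
        1 + c v            ≤⟨ +-mono-≤ 1≤D (≤-trans c≤cS cS≤) ⟩
        D + (t * D + t)    ≤⟨ +-monoʳ-≤ D (+-monoʳ-≤ (t * D) (≤-trans (≤-reflexive (sym (*-identityʳ t))) (*-monoʳ-≤ t 1≤D))) ⟩
        D + (t * D + t * D) ≡⟨ lemma t D ⟩
        B ∎
        where
        open ≤-Reasoning
        lemma : ∀ t D → D + (t * D + t * D) ≡ (2 * t + 1) * D
        lemma = solve-∀
        c≤cS : c v ≤ cS
        c≤cS = ≤-trans (≤-reflexive (sym (trans (cong (_* c v) (ι-∈ v∈)) (*-identityˡ (c v)))))
                       (∑-term V {λ v → s v * c v} (λ _ → z≤n) (∈-allFin v))
      -- The new copy adds `t + 2 cS` to the sum of squares. By `cheap′`, `n` times this is at most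
      -- `2 t² j + 3 n t`, which the right-hand side gains with `t²` to spare.
      squares′ : n * ∑ᵥ (λ v → (s v + c v) * (s v + c v)) ≤ (t * suc j) * (t * suc j) + 3 * (n * (t * suc j))
      squares′ = begin
        n * ∑ᵥ (λ v → (s v + c v) * (s v + c v)) ≡⟨ cong (n *_) expand ⟩
        n * (t + (cS + cS) + C²) ≡⟨ distribute n t cS C² ⟩
        n * t + (n * cS + n * cS) + n * C²
          ≤⟨ +-mono-≤ (+-monoʳ-≤ (n * t) (+-mono-≤ cheap′ cheap′)) (squares F) ⟩
        n * t + ((t * (t * j) + n * t) + (t * (t * j) + n * t)) + ((t * j) * (t * j) + 3 * (n * (t * j)))
          ≤⟨ m≤m+n _ (t * t) ⟩
        n * t + ((t * (t * j) + n * t) + (t * (t * j) + n * t)) + ((t * j) * (t * j) + 3 * (n * (t * j))) + t * t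
          ≡⟨ collect n t j ⟩
        (t * (1 + j)) * (t * (1 + j)) + 3 * (n * (t * (1 + j))) ∎
        where
        open ≤-Reasoning
        C² : ℕ
        C² = ∑ᵥ (λ v → c v * c v)
        distribute : ∀ n t x y → n * (t + (x + x) + y) ≡ n * t + (n * x + n * x) + n * y
        distribute = solve-∀
        collect : ∀ n t j → n * t + ((t * (t * j) + n * t) + (t * (t * j) + n * t)) + ((t * j) * (t * j) + 3 * (n * (t * j))) + t * t
                ≡ (t * (1 + j)) * (t * (1 + j)) + 3 * (n * (t * (1 + j)))
        collect = solve-∀
        square : ∀ s c → (s + c) * (s + c) ≡ s * s + (s * c + s * c) + c * c
        square = solve-∀
        expand : ∑ᵥ (λ v → (s v + c v) * (s v + c v)) ≡ t + (cS + cS) + C²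
        expand = trans
          (∑-cong V (λ v → trans (square (s v) (c v)) (cong (λ p → p + (s v * c v + s v * c v) + c v * c v) (ι-idem (vertices copy) v))))
          (trans (∑-+ V (λ v → s v + (s v * c v + s v * c v)) (λ v → c v * c v)) (cong (_+ C²)
            (trans (∑-+ V s (λ v → s v * c v + s v * c v)) (cong₂ _+_ (trans (sym (∣∣≡∑ (vertices copy))) size-t)
              (∑-+ V (λ v → s v * c v) (λ v → s v * c v))))))

    extend : ∀ {j} → j ≤ D′ * n → Family j → Family (suc j)
    extend j≤ F = extend-by j≤ F (CopySearch.new-copy T γ all-edges χ rainbow H linear min-degree D (𝒢 F) (uniform F) (bounded F)
      (≤-trans (≤-reflexive (total F)) (tj≤nD j≤)) n-large)

    build : ∀ j → j ≤ D′ * n → Family j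
    build zero    _  = empty
    build (suc j) j< = extend (<⇒≤ j<) (build j (<⇒≤ j<))

    module Tiling (F : Family (D′ * n)) (q : ℕ) (1≤t : 1 ≤ t) (1≤q : 1 ≤ q)
      (D₁≤D : Constants.D₁ t q ≤ D) (n₁≤n : Constants.n₁ t q D ≤ n) where

      -- Since `D` is a multiple of `t`, `D′ * n` copies have average degree exactly `D`, as the
      -- matching process requires.
      tJ : t * (D′ * n) ≡ n * D
      tJ = lemma t D′ n
        where
        lemma : ∀ t d n → t * (d * n) ≡ n * (t * d)
        lemma = solve-∀

      square-sum : ∑ᵥ (λ v → degree (𝒢 F) v * degree (𝒢 F) v) ≤ n * (D * D) + 3 * (n * D)
      square-sum = *-cancelˡ-≤ n (≤-trans (squares F) (≤-reflexive
        (trans (cong (λ p → p * p + 3 * (n * p)) tJ) (lemma n D))))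
        where
        lemma : ∀ n D → n * D * (n * D) + 3 * (n * (n * D)) ≡ n * (n * (D * D) + 3 * (n * D))
        lemma = solve-∀

      matching : ∃[ M ] ∃[ R ] ((∀ {f} → f ∈ M → f ∈ 𝒢 F) × AllPairs Disjoint M ×
                     (∀ v → v ∈ₛ R ⊎ ∃[ f ] (f ∈ M × v ∈ₛ f)) × q * ∣ R ∣ < n)
      matching = Process.near-perfect-matching t q D n 1≤t 1≤q 1≤D D₁≤D n₁≤n (𝒢 F) (uniform F) (almost F) (bounded F)
        (trans (total F) tJ) square-sum

-- Choice of constants and passage to real numbers.

module AsymptoticTiling where

  open import Data.Fin.Subset using (⋃; Empty)
  open import Data.Fin.Subset.Properties using (x∈p∩q⁻; x∈p∪q⁺)
  import Data.Integer as ℤ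
  import Data.Integer.Properties as ℤ
  open import Data.List using (map)
  open import Data.List.Extrema.Nat using (min≤xs)
  open import Data.List.Membership.Propositional.Properties using (∈-map⁺)
  open import Data.Nat as ℕ using (ℕ; zero; suc; z≤n; s≤s)
  import Data.Nat.Properties as ℕ
  open import Data.Rational as ℚ using (ℚ; mkℚ; 0ℚ; 1ℚ; _+_; _*_; -_; _-_; _≤_; _<_; _/_; *≤*; toℚᵘ)
  open import Data.Rational.Properties
  import Data.Rational.Unnormalised as ℚᵘ
  import Data.Rational.Unnormalised.Properties as ℚᵘ
  open import Data.Vec using (lookup; tabulate)
  open import Data.Vec.Properties using (lookup∘tabulate)
  open Numbers
  open SetFamilies
  open NearPerfectMatching using (Disjoint; inverse; module Constants)
  open HypertreeGrowth using (module Paths)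
  open RainbowColoring
  open CheapCopy
  open CopyFamily
  open import Defs renaming (degree to degreeᴴ) hiding (x; y)

  open Rationals
  open KGraph
  open SubHypergraph
  open ℝ

  module _ {k n : ℕ} (H : KGraph k n) where

    degree≡ : ∀ v → degreeᴴ H v ≡ ∑ℕ.∑ (allFin (size H)) (λ e → ∑ℕ.ι (edge H e) v)
    degree≡ v = trans (∣∣≡∑ (tabulate (λ e → lookup (edge H e) v)))
      (∑ℕ.∑-cong (allFin (size H)) (λ e → cong (λ s → if s then 1 else 0) (lookup∘tabulate (λ e → lookup (edge H e) v) e)))

    minDegree≤ : ∀ v → minDegree H ℕ.≤ degreeᴴ H v
    minDegree≤ v = All.lookup (min≤xs (size H) (map (degreeᴴ H) (allFin n))) (∈-map⁺ (degreeᴴ H) (∈-allFin v))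

  -- The quotient `_/_` is reduced by a gcd, so the comparison is made with unnormalised rationals.
  ⟦⟧≡/1 : ∀ n → ⟦ n ⟧ ≡ ℤ.+ n / 1
  ⟦⟧≡/1 zero    = refl
  ⟦⟧≡/1 (suc n) = toℚᵘ-injective (ℚᵘ.≃-trans (toℚᵘ-homo-+ 1ℚ ⟦ n ⟧)
    (ℚᵘ.≃-trans (ℚᵘ.+-congʳ (toℚᵘ 1ℚ) (ℚᵘ.≃-trans (toℚᵘ-cong (⟦⟧≡/1 n)) (toℚᵘ-fromℚᵘ (ℚᵘ.mkℚᵘ (ℤ.+ n) 0))))
      (ℚᵘ.≃-trans (ℚᵘ.*≡* (cong (ℤ._* ℤ.+ 1) (cong (ℤ._+_ (ℤ.+ 1)) (ℤ.*-identityʳ (ℤ.+ n)))))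
        (ℚᵘ.≃-sym (toℚᵘ-fromℚᵘ (ℚᵘ.mkℚᵘ (ℤ.+ suc n) 0))))))

  /-≤⇒ : ∀ n k m → ℤ.+ n / suc k ≤ ℤ.+ m / 1 → n ℕ.≤ suc k ℕ.* m
  /-≤⇒ n k m p with ℚᵘ.≤-respˡ-≃ (toℚᵘ-fromℚᵘ (ℚᵘ.mkℚᵘ (ℤ.+ n) k))
                     (ℚᵘ.≤-respʳ-≃ (toℚᵘ-fromℚᵘ (ℚᵘ.mkℚᵘ (ℤ.+ m) 0)) (toℚᵘ-mono-≤ p))
  ... | ℚᵘ.*≤* q = ℕ.≤-trans (ℤ.drop‿+≤+ (subst₂ ℤ._≤_ (ℤ.*-identityʳ (ℤ.+ n)) (sym (ℤ.pos-* m (suc k))) q))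
                             (ℕ.≤-reflexive (ℕ.*-comm m (suc k)))

  fromNat-mono⁻ : ∀ {m n} → ℤ.+ m / 1 ≤ ℤ.+ n / 1 → m ℕ.≤ n
  fromNat-mono⁻ {m} {n} p = subst (m ℕ.≤_) (ℕ.*-identityˡ n) (/-≤⇒ m 0 n p)

  archimedean : ∀ p → ∃[ m ] p ≤ ⟦ m ⟧
  archimedean p@(mkℚ num d-1 _) = ℤ.∣ num ∣ , subst (p ≤_) (sym (⟦⟧≡/1 ℤ.∣ num ∣)) (toℚᵘ-cancel-≤
    (ℚᵘ.≤-respʳ-≃ (ℚᵘ.≃-sym (toℚᵘ-fromℚᵘ (ℚᵘ.mkℚᵘ (ℤ.+ ℤ.∣ num ∣) 0))) (ℚᵘ.*≤* (bound num))))
    where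
    bound : ∀ i → i ℤ.* ℤ.+ 1 ℤ.≤ ℤ.+ ℤ.∣ i ∣ ℤ.* ℤ.+ suc d-1
    bound (ℤ.+ m) = subst₂ ℤ._≤_ (sym (ℤ.*-identityʳ (ℤ.+ m))) (ℤ.pos-* m (suc d-1))
      (ℤ.+≤+ (ℕ.m≤m*n m (suc d-1)))
    bound ℤ.-[1+ m ] = ℤ.-≤+

  reciprocal-below : ∀ {δ} → 0ℚ < δ → ∃[ q ] (1 ℕ.≤ q × 1ℚ ≤ δ * ⟦ q ⟧)
  reciprocal-below {δ} 0<δ =
    let (s , s*δ , _) = inverse 0<δ
        (m , s≤m)     = archimedean s
    in suc m , s≤s z≤n , ≤-trans (≤-reflexive (trans (sym s*δ) (*-comm s δ)))
         (*-monoˡ (<⇒≤ 0<δ) (≤-trans s≤m (⟦⟧-mono (ℕ.n≤1+n m))))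

  ·-seq : ∀ n r i → seq (n · r) i ≡ ⟦ n ⟧ * seq r i
  ·-seq zero    r i = sym (*-zeroˡ (seq r i))
  ·-seq (suc n) r i = trans (cong (seq r i +_) (·-seq n r i)) (lemma (seq r i) ⟦ n ⟧)
    where
    lemma : ∀ s n → s + n * s ≡ (1ℚ + n) * s
    lemma = solve-∀ ring

  module _ {k n : ℕ} {H : KGraph k n} where

    realized : ∀ {t} {T : KGraph k t} (M : List (Subset n)) → (∀ {f} → f ∈ M → ∃[ S ] (IsCopyOf T {H} S × vertices S ≡ f)) →
               ∃[ 𝒮 ] (All (IsCopyOf T {H}) 𝒮 × map vertices 𝒮 ≡ M)
    realized {T = T} []      copies = [] , [] , refl
    realized {T = T} (f ∷ M) copies =
      let (S , isCopy , S≡) = copies (here refl) ; (𝒮 , all , 𝒮≡) = realized {T = T} M (copies ∘ there) in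
      S ∷ 𝒮 , isCopy ∷ all , cong₂ _∷_ S≡ 𝒮≡

    vertexDisjoint : ∀ (𝒮 : List (SubHypergraph H)) → AllPairs Disjoint (map vertices 𝒮) → VertexDisjoint 𝒮
    vertexDisjoint []      []       = []
    vertexDisjoint (S ∷ 𝒮) (p ∷ ps) = go 𝒮 p ∷ vertexDisjoint 𝒮 ps
      where
      go : ∀ 𝒮 → All (Disjoint (vertices S)) (map vertices 𝒮) → All (λ S′ → Empty (vertices S ∩ vertices S′)) 𝒮
      go []       []       = []
      go (S′ ∷ 𝒮) (d ∷ ds) = (λ { (v , v∈) → let (v∈S , v∈S′) = x∈p∩q⁻ (vertices S) (vertices S′) v∈ in d v∈S v∈S′ }) ∷ go 𝒮 ds

  ∈-⋃ : ∀ {n} {M : List (Subset n)} {f v} → f ∈ M → v ∈ₛ f → v ∈ₛ ⋃ M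
  ∈-⋃ (here refl) v∈ = x∈p∪q⁺ (inj₁ v∈)
  ∈-⋃ (there f∈)  v∈ = x∈p∪q⁺ (inj₂ (∈-⋃ f∈ v∈))

  cover-size : ∀ {n} (M : List (Subset n)) (R : Subset n) →
               (∀ v → v ∈ₛ R ⊎ ∃[ f ] (f ∈ M × v ∈ₛ f)) → n ℕ.≤ ∣ ⋃ M ∣ ℕ.+ ∣ R ∣
  cover-size {n} M R covers = begin
    n ≡⟨ length-allFin n ⟨
    length (allFin n) ≡⟨ length≡∑ (allFin n) ⟩
    ∑ℕ.∑ᵥ (λ (v : Fin n) → 1) ≤⟨ ∑ℕ.∑-mono (allFin n) covered-once ⟩
    ∑ℕ.∑ᵥ (λ v → ∑ℕ.ι (⋃ M) v ℕ.+ ∑ℕ.ι R v) ≡⟨ ∑ℕ.∑-+ (allFin n) (∑ℕ.ι (⋃ M)) (∑ℕ.ι R) ⟩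
    ∑ℕ.∑ᵥ (∑ℕ.ι (⋃ M)) ℕ.+ ∑ℕ.∑ᵥ (∑ℕ.ι R) ≡⟨ cong₂ ℕ._+_ (∣∣≡∑ (⋃ M)) (∣∣≡∑ R) ⟨
    ∣ ⋃ M ∣ ℕ.+ ∣ R ∣ ∎
    where
    open ℕ.≤-Reasoning
    covered-once : ∀ v → 1 ℕ.≤ ∑ℕ.ι (⋃ M) v ℕ.+ ∑ℕ.ι R v
    covered-once v with covers v
    ... | inj₁ v∈R            = ℕ.≤-trans (ℕ.≤-reflexive (sym (ι-∈ v∈R))) (ℕ.m≤n+m _ _)
    ... | inj₂ (f , f∈ , v∈f) = ℕ.≤-trans (ℕ.≤-reflexive (sym (ι-∈ (∈-⋃ f∈ v∈f)))) (ℕ.m≤m+n _ _)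

  -- At most `n / q` vertices are missed, and `1 / q ≤ δ ≤ η`; the chain is multiplied by `q` to
  -- avoid the quotient.
  coverage-bound : ∀ {n q cov r δ η} → 1 ℕ.≤ q → n ℕ.≤ cov ℕ.+ r → q ℕ.* r ℕ.≤ n → 1ℚ ≤ δ * ⟦ q ⟧ → δ ≤ η →
                   ⟦ n ⟧ * (1ℚ - η) ≤ ⟦ cov ⟧
  coverage-bound {n} {q} {cov} {r} {δ} {η} 1≤q n≤ qr≤n 1≤δq δ≤η = *-cancelˡ-≤ (⟦⟧>0 1≤q) (begin
    ⟦ q ⟧ * (⟦ n ⟧ * (1ℚ - η))
      ≤⟨ ≤-by (⟦ q ⟧ * ⟦ n ⟧ * (η - δ)) (*≥0 (*≥0 (⟦⟧≥0 q) (⟦⟧≥0 n)) (≤⇒0≤- δ≤η)) (lemma₁ ⟦ q ⟧ ⟦ n ⟧ η δ) ⟩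
    ⟦ q ⟧ * ⟦ n ⟧ + ⟦ n ⟧ * (1ℚ - δ * ⟦ q ⟧) - ⟦ n ⟧
      ≤⟨ ≤-by (⟦ n ⟧ * (δ * ⟦ q ⟧ - 1ℚ)) (*≥0 (⟦⟧≥0 n) (≤⇒0≤- 1≤δq)) (lemma₂ ⟦ q ⟧ ⟦ n ⟧ (δ * ⟦ q ⟧)) ⟩
    ⟦ q ⟧ * ⟦ n ⟧ - ⟦ n ⟧
      ≤⟨ ≤-by ((⟦ q ⟧ * (⟦ cov ⟧ + ⟦ r ⟧) - ⟦ q ⟧ * ⟦ n ⟧) + (⟦ n ⟧ - ⟦ q ⟧ * ⟦ r ⟧))
           (+≥0 (≤⇒0≤- (*-monoˡ (⟦⟧≥0 q) (≤-trans (⟦⟧-mono n≤) (≤-reflexive (⟦⟧-+ cov r)))))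
                (≤⇒0≤- (≤-trans (≤-reflexive (sym (⟦⟧-* q r))) (⟦⟧-mono qr≤n))))
           (lemma₃ ⟦ q ⟧ ⟦ n ⟧ ⟦ cov ⟧ ⟦ r ⟧) ⟩
    ⟦ q ⟧ * ⟦ cov ⟧ ∎)
    where
    open ≤-Reasoning
    lemma₁ : ∀ q n η δ → q * n + n * (1ℚ - δ * q) - n ≡ q * (n * (1ℚ - η)) + q * n * (η - δ)
    lemma₁ = solve-∀ ring
    lemma₂ : ∀ q n x → q * n - n ≡ (q * n + n * (1ℚ - x) - n) + n * (x - 1ℚ)
    lemma₂ = solve-∀ ring
    lemma₃ : ∀ q n c r → q * c ≡ (q * n - n) + ((q * (c + r) - q * n) + (n - q * r))
    lemma₃ = solve-∀ ring

  0<⇒0<ℝ : ∀ n → 0ℝ <ℝ fromNat (suc n)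
  0<⇒0<ℝ n = 1ℚ , 0<1 , 0 , λ _ _ → ≤-trans (≤-reflexive (+-identityˡ 1ℚ))
    (subst (1ℚ ≤_) (⟦⟧≡/1 (suc n)) (⟦⟧≥1 (s≤s {n = n} z≤n)))

  TilingUpTo : ∀ {k t n} → ℕ → KGraph k t → KGraph k n → Set
  TilingUpTo {n = n} q T H = ∃[ 𝒮 ] (All (IsCopyOf T {H}) 𝒮 × VertexDisjoint 𝒮 ×
    ∃[ r ] (n ℕ.≤ covered 𝒮 ℕ.+ r × q ℕ.* r ℕ.≤ n))

  module Setup {k t : ℕ} (2≤k : 2 ℕ.≤ suc k) (T : KGraph (suc k) t) (tree : IsLinearHypertree T) (q : ℕ) (1≤q : 1 ℕ.≤ q) where
    open Paths T
    open Tree tree 2≤k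
    open Colorings T

    D′ D W n₂ n₀ : ℕ
    D′ = suc (Constants.D₁ t q)
    D = t ℕ.* D′
    W = Bounds.W (suc k) t D
    n₂ = suc k ℕ.* (suc (suc k ℕ.* W) ℕ.* suc (suc k ℕ.* W)) ℕ.* (suc D ℕ.* suc D)
    n₀ = n₂ ℕ.+ Constants.n₁ t q D

    1≤t : 1 ℕ.≤ t
    1≤t = IsLinearHypertree.nonempty tree

    D′≤D : D′ ℕ.≤ D
    D′≤D = ℕ.≤-trans (ℕ.≤-reflexive (sym (ℕ.*-identityˡ D′))) (ℕ.*-monoˡ-≤ D′ 1≤t)

    colouring : ∃[ χ ] (∀ {f} → f ∈ proj₁ growth-order → Rainbow χ f)
    colouring = growth-coloring Fin.zero (proj₁ (proj₂ growth-order))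

    tiling : ∀ {n} (H : KGraph (suc k) n) → Linear H → n₀ ℕ.< n → (∀ v → n ℕ.≤ suc k ℕ.* degreeᴴ H v) → TilingUpTo q T H
    tiling {n} H linear n₀<n min-degree = finish Tl.matching
      where
      module Bd = Build T (proj₁ (proj₂ growth-order)) (proj₂ (proj₂ growth-order))
        (proj₁ colouring) (λ f → proj₂ colouring (proj₂ (proj₂ growth-order) f)) H linear
        (λ v → subst (λ d → n ℕ.≤ suc k ℕ.* d) (degree≡ H v) (min-degree v)) D′ (ℕ.≤-trans (s≤s z≤n) D′≤D)
        (ℕ.≤-<-trans (ℕ.m≤m+n n₂ (Constants.n₁ t q D)) n₀<n)
      F : Bd.Family (D′ ℕ.* n)
      F = Bd.build (D′ ℕ.* n) ℕ.≤-refl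
      module Tl = Bd.Tiling F q 1≤t 1≤q (ℕ.≤-trans (ℕ.n≤1+n (Constants.D₁ t q)) D′≤D)
        (ℕ.≤-trans (ℕ.m≤n+m (Constants.n₁ t q D) n₂) (ℕ.<⇒≤ n₀<n))
      finish : ∃[ M ] ∃[ R ] ((∀ {f} → f ∈ M → f ∈ Bd.Family.𝒢 F) × AllPairs Disjoint M ×
                 (∀ v → v ∈ₛ R ⊎ ∃[ f ] (f ∈ M × v ∈ₛ f)) × q ℕ.* ∣ R ∣ ℕ.< n) → TilingUpTo q T H
      finish (M , R , M⊆ , disjoint , covers , small) =
        let (𝒮 , isCopies , 𝒮≡M) = realized {T = T} M (λ f∈ → Bd.Family.copies F (M⊆ f∈)) in
        𝒮 , isCopies , vertexDisjoint 𝒮 (subst (AllPairs Disjoint) (sym 𝒮≡M) disjoint) ,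
        ∣ R ∣ , subst (λ L → n ℕ.≤ ∣ ⋃ L ∣ ℕ.+ ∣ R ∣) (sym 𝒮≡M) (cover-size M R covers) , ℕ.<⇒≤ small

  Conclusion : ∀ (ε : ℝ) (k t : ℕ) → KGraph (suc k) t → Set
  Conclusion ε k t T = ∃[ C ] ∃[ n₀ ] (0ℝ <ℝ C × 0ℝ <ℝ n₀ ×
      (∀ n → n₀ ≤ℝ fromNat n → ∀ (H : KGraph (suc k) n) → Linear H →
       fromℚ (ℤ.+ n / suc k) +ℝ C ≤ℝ fromNat (minDegree H) →
       ∃[ 𝒮 ] (All (IsCopyOf T {H}) 𝒮 × VertexDisjoint 𝒮 × n · (1ℝ -ℝ ε) ≤ℝ fromNat (covered 𝒮))))

  module Limits {k t : ℕ} (T : KGraph (suc k) t) (ε : ℝ) {δ : ℚ} {N : ℕ}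
    (δ≤ε : ∀ i → N ℕ.≤ i → 0ℚ + δ ≤ seq ε i) {q : ℕ} (1≤q : 1 ℕ.≤ q) (1≤δq : 1ℚ ≤ δ * ⟦ q ⟧)
    (n₀ : ℕ) (tiling : ∀ {n} (H : KGraph (suc k) n) → Linear H → n₀ ℕ.< n →
                       (∀ v → n ℕ.≤ suc k ℕ.* degreeᴴ H v) → TilingUpTo q T H)
    where

    drop-one : ∀ {p r} → p + ℤ.+ 1 / 1 ≤ r + 1ℚ → p ≤ r
    drop-one {p} {r} h = subst₂ _≤_ (lemma p 1ℚ) (lemma r 1ℚ) (+-monoˡ-≤ (- 1ℚ) h)
      where
      lemma : ∀ p s → (p + s) + (- s) ≡ p
      lemma = solve-∀ ring

    module _ (n : ℕ) (n-large : fromNat (suc (suc n₀)) ≤ℝ fromNat n) (H : KGraph (suc k) n)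
      (δH : fromℚ (ℤ.+ n / suc k) +ℝ fromNat 1 ≤ℝ fromNat (minDegree H)) where

      n₀<n : n₀ ℕ.< n
      n₀<n = let (N′ , h) = n-large 1ℚ 0<1 in
        ℕ.s≤s⁻¹ (fromNat-mono⁻ {suc (suc n₀)} {suc n} (≤-trans (h N′ ℕ.≤-refl)
          (≤-reflexive (trans (cong (_+ 1ℚ) (sym (⟦⟧≡/1 n))) (trans (+-comm ⟦ n ⟧ 1ℚ) (⟦⟧≡/1 (suc n)))))))

      min-degree : ∀ v → n ℕ.≤ suc k ℕ.* degreeᴴ H v
      min-degree v = let (N′ , h) = δH 1ℚ 0<1 in
        ℕ.≤-trans (/-≤⇒ n k (minDegree H) (drop-one (h N′ ℕ.≤-refl))) (ℕ.*-monoʳ-≤ (suc k) (minDegree≤ H v))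

      covers-most : ∀ (c r : ℕ) → n ℕ.≤ c ℕ.+ r → q ℕ.* r ℕ.≤ n → n · (1ℝ -ℝ ε) ≤ℝ fromNat c
      covers-most c r n≤ qr≤n η 0<η = N , λ i N≤i → begin
        seq (n · (1ℝ -ℝ ε)) i      ≡⟨ ·-seq n (1ℝ -ℝ ε) i ⟩
        ⟦ n ⟧ * (1ℚ - seq ε i)     ≤⟨ coverage-bound {n} {q} {c} {r} {δ} {seq ε i} 1≤q n≤ qr≤n 1≤δq
                                        (≤-trans (≤-reflexive (sym (+-identityˡ δ))) (δ≤ε i N≤i)) ⟩
        ⟦ c ⟧                      ≡⟨ +-identityʳ ⟦ c ⟧ ⟨
        ⟦ c ⟧ + 0ℚ                 ≤⟨ +-mono-≤ (≤-reflexive (⟦⟧≡/1 c)) (<⇒≤ 0<η) ⟩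
        ℤ.+ c / 1 + η ∎
        where open ≤-Reasoning

    conclusion : Conclusion ε k t T
    -- `_≤ℝ_` is evaluated at tolerance 1. This cancels `C = 1` in the degree condition; of the two
    -- successors on `n₀`, one is lost to the tolerance and one makes the bound strict.
    conclusion = fromNat 1 , fromNat (suc (suc n₀)) , 0<⇒0<ℝ 0 , 0<⇒0<ℝ (suc n₀) , λ n n-large H linear δH →
      let (𝒮 , isCopies , disjoint , r , n≤ , qr≤n) = tiling H linear (n₀<n n n-large H δH) (min-degree n n-large H δH)
      in 𝒮 , isCopies , disjoint , covers-most n n-large H δH (covered 𝒮) r n≤ qr≤n

  asymptotic-tiling : ∀ (ε : ℝ) → 0ℝ <ℝ ε → ∀ k → 2 ℕ.≤ suc k → ∀ t (T : KGraph (suc k) t) → IsLinearHypertree T → Conclusion ε k t T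
  asymptotic-tiling ε (δ , 0<δ , N , δ≤ε) k 2≤k t T tree =
    let (q , 1≤q , 1≤δq) = reciprocal-below 0<δ in
    Limits.conclusion T ε {δ} {N} δ≤ε {q} 1≤q 1≤δq (Setup.n₀ 2≤k T tree q 1≤q) (Setup.tiling 2≤k T tree q 1≤q)

open import Defs
open import Data.Nat using (ℕ; _≤_; NonZero)
open import Data.Integer using (+_)
open import Data.Rational using (_/_)

theorem1p4 : ∀ (ε : ℝ) → 0ℝ <ℝ ε →
    ∀ (k : ℕ) .{{_ : NonZero k}} → 2 ≤ k →
    ∀ (t : ℕ) (T : KGraph k t) → IsLinearHypertree T →
    ∃[ C ] ∃[ n₀ ] (0ℝ <ℝ C × 0ℝ <ℝ n₀ ×
    (∀ (n : ℕ) → n₀ ≤ℝ fromNat n →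
    ∀ (H : KGraph k n) → Linear H →
    fromℚ (+ n / k) +ℝ C ≤ℝ fromNat (minDegree H) →
    ∃[ 𝒮 ] (All (IsCopyOf T {H}) 𝒮 × VertexDisjoint 𝒮 ×
    n · (1ℝ -ℝ ε) ≤ℝ fromNat (covered 𝒮))))
theorem1p4 ε 0<ε (ℕ.suc k) 2≤k t T tree = AsymptoticTiling.asymptotic-tiling ε 0<ε k 2≤k t T tree
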